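{- For every $\varepsilon > 0$ there are $\delta = \delta(\varepsilon) > 0$ and $n_0 = n_0(\varepsilon)$, with $\delta(\varepsilon)$ polynomial in $\varepsilon$ and $n_0(\varepsilon)$ polynomial in $1/\varepsilon$ (that is, there is an absolute constant $C \ge 1$ such that $\delta(\varepsilon) \ge \varepsilon^{C}/C$ and $n_0(\varepsilon) \le C\varepsilon^{ -C}$ for all $0<\varepsilon<1$), such that the following holds. Let $H$ be a $3$-uniform hypergraph on $n \geq n_0$ vertices which contains less than $\delta n^4$ induced copies of $D_2$. Then $H$ can be made induced $D_2$-free by adding/deleting at most $\varepsilon n^3$ edges.
   Context: Hypergraphs are finite. $D_2$ denotes the $3$-uniform hypergraph with $4$ vertices and $2$ edges (unique up to isomorphism). An induced copy of $D_2$ in a $3$-uniform hypergraph $H$ is a set of $4$ vertices of $H$ spanning exactly $2$ edges of $H$. $H$ is induced $D_2$-free if it has no induced copy of $D_2$. Adding/deleting edges means changing the edge set by a symmetric difference of the stated size (the vertex set stays fixed). -}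

module Defs where

open import Data.Bool using (Bool; T; T?; _xor_)
open import Data.Fin.Subset using (Subset; inside; outside; ∣_∣; _⊆_)
open import Data.Fin.Subset.Properties using (_⊆?_)
open import Data.Integer using (+_)
open import Data.List using (List; []; _∷_; _++_; map; filter; length)
open import Data.Nat using (ℕ; zero; suc; _≟_)
open import Data.Product using (_×_)
open import Data.Rational as ℚ using (ℚ)
open import Data.Vec using ([]; _∷_)
open import Level using (Level)
open import Relation.Binary.PropositionalEquality using (_≡_)
open import Relation.Nullary using (¬_)
open import Relation.Nullary.Decidable using (_×-dec_)
open import Relation.Unary using (Pred; Decidable)

open import Algebra.Definitions.RawSemiring ℚ.+-*-rawSemiring public
  using (_^_)

private
  variable
    n : ℕ
    ℓ : Level

fromℕ : ℕ → ℚ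
fromℕ k = + k ℚ./ 1

-- Every subset of Fin n is listed exactly once, so filtering this list
-- counts subsets.
subsets : ∀ n → List (Subset n)
subsets zero    = [] ∷ []
subsets (suc n) = map (outside ∷_) (subsets n) ++ map (inside ∷_) (subsets n)

count : {P : Pred (Subset n) ℓ} → Decidable P → ℕ
count {n = n} P? = length (filter P? (subsets n))

-- The vertex set is Fin n and the edge set is a set of 3-element subsets
-- of it, given by its characteristic function.
record Hypergraph₃ (n : ℕ) : Set where
  field
    edge    : Subset n → Bool
    uniform : ∀ e → T (edge e) → ∣ e ∣ ≡ 3

open Hypergraph₃ public

EdgeIn : Hypergraph₃ n → Subset n → Pred (Subset n) _
EdgeIn H W e = T (edge H e) × e ⊆ W

edgeIn? : (H : Hypergraph₃ n) (W : Subset n) → Decidable (EdgeIn H W)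
edgeIn? H W e = T? (edge H e) ×-dec (e ⊆? W)

#edgesIn : Hypergraph₃ n → Subset n → ℕ
#edgesIn H W = count (edgeIn? H W)

IsInducedD₂ : Hypergraph₃ n → Pred (Subset n) _
IsInducedD₂ H W = ∣ W ∣ ≡ 4 × #edgesIn H W ≡ 2

isInducedD₂? : (H : Hypergraph₃ n) → Decidable (IsInducedD₂ H)
isInducedD₂? H W = (∣ W ∣ ≟ 4) ×-dec (#edgesIn H W ≟ 2)

#inducedD₂ : Hypergraph₃ n → ℕ
#inducedD₂ H = count (isInducedD₂? H)

InducedD₂-free : Hypergraph₃ n → Set
InducedD₂-free H = ∀ W → ¬ IsInducedD₂ H W

-- Size of the symmetric difference of the two edge sets.
editDistance : Hypergraph₃ n → Hypergraph₃ n → ℕ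
editDistance H H′ = count (λ e → T? (edge H e xor edge H′ e))

{-# OPTIONS --safe #-}
-- If V = X ∪ Y and the triples meeting both X and Y are all edges, or all non-edges, then no
-- induced D₂ meets both X and Y.  Hence it suffices to find, in every large vertex set spanning
-- few copies of D₂, a partition X ∪ Y whose crossing triples are nearly all of one kind, the
-- number of exceptions being a small multiple of |X| |Y| |V|: splitting recursively, the
-- exceptions add up to a small multiple of n³, because each pair of vertices is separated once.
--
-- To find the partition, take a vertex v in few copies.  If its link G is sparse or co-sparse,
-- such vertices can be split off.  Otherwise note that an induced P₄ of G yields a D₂ on its
-- vertices and v, so G is nearly a cograph.  Choose w such that neither its degree in G nor its
-- co-degree is small.  Passing to the complement if necessary, the set R of non-neighbours of w
-- having few common neighbours with w is large.  Let W be the rest.  Few edges of G join W to R,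
-- while two vertices of W are joined by short paths inside W; together with the scarcity of D₂
-- this leaves few edges of type WWR.  Finally, x y y′ and x′ y y′ with x, x′ ∈ W and y, y′ ∈ R
-- form a D₂ unless there is an edge of type WWR among these vertices, so by Cauchy–Schwarz there
-- are few edges of type WRR as well, and W ∪ R is the required partition.
module Submission where

-- If `v a b c` is not a D₂, the number of link edges among `a`, `b`, `c` constrains the triple
-- itself: one link edge forces a non-edge, two force an edge, and only zero or three leave it free.
-- In an induced P₄ two triples span one link edge and two span two, so exactly two of the four
-- triples would be edges, again a D₂. The same rule drives every later case check.
--
-- The obstacle is that R may be a tiny fraction of V, while the exceptions must be small against
-- |W| |R| |V|. All errors are therefore measured against |R|. In particular the borderline
-- vertices, whose number of common neighbours with w is neither clearly small nor clearly large,
-- must be few even relative to R; this forces the threshold to be found by pigeonhole.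
--
-- The depth of the recursion costs nothing: the number of copies is always compared with n⁴, and a
-- set of size m is abandoned, at a cost of at most m n² / q, once q m² ≤ n². So every set that is
-- split has size polynomially related to n, and all constants are fixed powers of one integer p, of
-- order 1/ε for ε < 1.

module Counting where

  open import Algebra.Properties.CommutativeSemigroup using (interchange; x∙yz≈y∙xz)
  open import Data.Bool using (Bool; true; false; T; not; _∧_; if_then_else_)
  open import Data.Empty using (⊥; ⊥-elim)
  open import Data.List using (List; []; _∷_; length; filterᵇ)
  open import Data.List.Membership.Propositional using (_∈_)
  open import Data.List.Relation.Unary.Any using (here; there)
  open import Data.Nat
  open import Data.Nat.Properties
  open import Data.Product using (_×_; _,_; ∃-syntax; proj₁; proj₂)
  open import Data.Sum using (_⊎_; inj₁; inj₂)
  open import Data.Unit using (tt)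
  open import Data.Vec using (Vec; []; _∷_)
  open import Function using (_∘_; case_of_)
  open import Relation.Binary.PropositionalEquality

  private
    variable
      A B : Set

  -- Sums over lists, averaging, and Boolean inequalities by evaluation.

  ∑ : List A → (A → ℕ) → ℕ
  ∑ []      f = 0
  ∑ (x ∷ l) f = f x + ∑ l f

  syntax ∑ l (λ x → e) = ∑[ x ∈ l ] e

  infix 7 ∑

  ⟦_⟧ : Bool → ℕ
  ⟦ b ⟧ = if b then 1 else 0

  # : List A → (A → Bool) → ℕ
  # l P = ∑[ x ∈ l ] ⟦ P x ⟧

  ∑-cong : ∀ (l : List A) {f g} → (∀ x → f x ≡ g x) → ∑ l f ≡ ∑ l g
  ∑-cong []      h = refl
  ∑-cong (x ∷ l) h = cong₂ _+_ (h x) (∑-cong l h)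

  ∑-mono : ∀ (l : List A) {f g} → (∀ x → f x ≤ g x) → ∑ l f ≤ ∑ l g
  ∑-mono []      h = z≤n
  ∑-mono (x ∷ l) h = +-mono-≤ (h x) (∑-mono l h)

  ∑-0 : ∀ (l : List A) → ∑[ _ ∈ l ] 0 ≡ 0
  ∑-0 []      = refl
  ∑-0 (_ ∷ l) = ∑-0 l

  ∑-const : ∀ (l : List A) k → ∑[ _ ∈ l ] k ≡ length l * k
  ∑-const []      k = refl
  ∑-const (_ ∷ l) k = cong (k +_) (∑-const l k)

  ∑-+ : ∀ (l : List A) f g → ∑[ x ∈ l ] (f x + g x) ≡ ∑ l f + ∑ l g
  ∑-+ []      f g = refl
  ∑-+ (x ∷ l) f g =
    trans (cong (f x + g x +_) (∑-+ l f g)) (interchange +-commutativeSemigroup (f x) (g x) _ _)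

  ∑-*ˡ : ∀ (l : List A) k f → ∑[ x ∈ l ] (k * f x) ≡ k * ∑ l f
  ∑-*ˡ []      k f = sym (*-zeroʳ k)
  ∑-*ˡ (x ∷ l) k f =
    trans (cong (k * f x +_) (∑-*ˡ l k f)) (sym (*-distribˡ-+ k (f x) _))

  ∑-*ʳ : ∀ (l : List A) k f → ∑[ x ∈ l ] (f x * k) ≡ ∑ l f * k
  ∑-*ʳ l k f = trans (∑-cong l (λ x → *-comm (f x) k)) (trans (∑-*ˡ l k f) (*-comm k _))

  ∑-comm : ∀ (l : List A) (k : List B) (f : A → B → ℕ) →
    ∑[ x ∈ l ] (∑[ y ∈ k ] f x y) ≡ ∑[ y ∈ k ] (∑[ x ∈ l ] f x y)
  ∑-comm []      k f = sym (∑-0 k)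
  ∑-comm (x ∷ l) k f =
    trans (cong (∑ k (f x) +_) (∑-comm l k f)) (sym (∑-+ k (f x) _))

  ∑-× : ∀ (l : List A) (k : List B) f g →
    ∑[ x ∈ l ] (∑[ y ∈ k ] (f x * g y)) ≡ ∑ l f * ∑ k g
  ∑-× l k f g = trans (∑-cong l (λ x → ∑-*ˡ k (f x) g)) (∑-*ʳ l _ f)

  ∑-≤+ : ∀ (l : List A) {f g h} → (∀ x → f x ≤ g x + h x) → ∑ l f ≤ ∑ l g + ∑ l h
  ∑-≤+ l {g = g} {h} p = ≤-trans (∑-mono l p) (≤-reflexive (∑-+ l g h))

  *∑-≤ : ∀ (l : List A) k {f g} → (∀ x → k * f x ≤ g x) → k * ∑ l f ≤ ∑ l g
  *∑-≤ l k {f} p = ≤-trans (≤-reflexive (sym (∑-*ˡ l k f))) (∑-mono l p)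

  ∑-≤const : ∀ (l : List A) k {f} → (∀ x → f x ≤ k) → ∑ l f ≤ length l * k
  ∑-≤const l k p = ≤-trans (∑-mono l p) (≤-reflexive (∑-const l k))

  ⟦⟧≤1 : ∀ b → ⟦ b ⟧ ≤ 1
  ⟦⟧≤1 false = z≤n
  ⟦⟧≤1 true  = ≤-refl

  ⟦∧⟧ : ∀ a b → ⟦ a ∧ b ⟧ ≡ ⟦ a ⟧ * ⟦ b ⟧
  ⟦∧⟧ false b = refl
  ⟦∧⟧ true  b = sym (+-identityʳ _)

  ⟦not⟧ : ∀ b → ⟦ b ⟧ + ⟦ not b ⟧ ≡ 1
  ⟦not⟧ false = refl
  ⟦not⟧ true  = refl

  ⟦⟧*≤ : ∀ b {k m} → (b ≡ true → k ≤ m) → ⟦ b ⟧ * k ≤ m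
  ⟦⟧*≤ false p = z≤n
  ⟦⟧*≤ true  p = ≤-trans (≤-reflexive (+-identityʳ _)) (p refl)

  *⟦⟧≤ : ∀ b {k m} → (b ≡ true → k ≤ m) → k * ⟦ b ⟧ ≤ m
  *⟦⟧≤ b {k} p = ≤-trans (≤-reflexive (*-comm k ⟦ b ⟧)) (⟦⟧*≤ b p)

  #≤length : ∀ (l : List A) P → # l P ≤ length l
  #≤length l P = ≤-trans (∑-≤const l 1 (λ x → ⟦⟧≤1 (P x))) (≤-reflexive (*-identityʳ _))

  #-not : ∀ (l : List A) P → # l P + # l (not ∘ P) ≡ length l
  #-not l P = trans (sym (∑-+ l _ _))
    (trans (∑-cong l (λ x → ⟦not⟧ (P x))) (trans (∑-const l 1) (*-identityʳ _)))

  ∑-split : ∀ (l : List A) (P : A → Bool) f →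
    ∑ l f ≡ ∑ (filterᵇ P l) f + ∑ (filterᵇ (not ∘ P) l) f
  ∑-split []      P f = refl
  ∑-split (x ∷ l) P f with P x
  ... | true  = trans (cong (f x +_) (∑-split l P f)) (sym (+-assoc (f x) _ _))
  ... | false = trans (cong (f x +_) (∑-split l P f)) (x∙yz≈y∙xz +-commutativeSemigroup (f x) (∑ (filterᵇ P l) f) _)

  ∑-filter : ∀ (l : List A) (P : A → Bool) f → ∑ (filterᵇ P l) f ≡ ∑[ x ∈ l ] (⟦ P x ⟧ * f x)
  ∑-filter []      P f = refl
  ∑-filter (x ∷ l) P f with P x
  ... | true  = cong₂ _+_ (sym (+-identityʳ (f x))) (∑-filter l P f)
  ... | false = ∑-filter l P f

  length-filter : ∀ (l : List A) P → length (filterᵇ P l) ≡ # l P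
  length-filter l P = trans (sym (trans (∑-const (filterᵇ P l) 1) (*-identityʳ _)))
    (trans (∑-filter l P (λ _ → 1)) (∑-cong l λ x → *-identityʳ ⟦ P x ⟧))

  ∑-mono-∈ : ∀ (l : List A) {f g} → (∀ x → x ∈ l → f x ≤ g x) → ∑ l f ≤ ∑ l g
  ∑-mono-∈ []      h = z≤n
  ∑-mono-∈ (x ∷ l) h = +-mono-≤ (h x (here refl)) (∑-mono-∈ l (λ y y∈ → h y (there y∈)))

  minimiser : ∀ (l : List A) (P : A → Bool) (f : A → ℕ) →
    # l P ≡ 0 ⊎ ∃[ x ] (P x ≡ true × (∀ y → y ∈ l → P y ≡ true → f x ≤ f y))
  minimiser []      P f = inj₁ refl
  minimiser (z ∷ l) P f with P z in Pz | minimiser l P f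
  ... | false | inj₁ none = inj₁ none
  ... | false | inj₂ (x , Px , min) = inj₂ (x , Px , λ where
    y (here refl) Py → case trans (sym Pz) Py of λ ()
    y (there y∈)  Py → min y y∈ Py)
  ... | true  | inj₁ none = inj₂ (z , Pz , λ where
    y (here refl) Py → ≤-refl
    y (there y∈)  Py → ⊥-elim (none⇒∉ l none y∈ Py))
    where
    none⇒∉ : ∀ l {y} → # l P ≡ 0 → y ∈ l → P y ≡ true → ⊥
    none⇒∉ (y ∷ l) eq (here refl) Py rewrite Py = case eq of λ ()
    none⇒∉ (x ∷ l) eq (there y∈)  Py = none⇒∉ l (m+n≡0⇒n≡0 ⟦ P x ⟧ eq) y∈ Py
  ... | true  | inj₂ (x , Px , min) with ≤-total (f z) (f x)
  ...   | inj₁ fz≤fx = inj₂ (z , Pz , λ where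
    y (here refl) Py → ≤-refl
    y (there y∈)  Py → ≤-trans fz≤fx (min y y∈ Py))
  ...   | inj₂ fx≤fz = inj₂ (x , Px , λ where
    y (here refl) Py → fx≤fz
    y (there y∈)  Py → min y y∈ Py)

  -- The minimiser of `f` on `P` is below the average over `P`, and the values outside `P` only
  -- enlarge the sum.
  below-average : ∀ (l : List A) (P : A → Bool) f → 1 ≤ # l P →
    ∃[ x ] (P x ≡ true × # l P * f x ≤ ∑ l f)
  below-average l P f 1≤#P with minimiser l P f
  ... | inj₁ none = ⊥-elim (n≮n 0 (subst (1 ≤_) none 1≤#P))
  ... | inj₂ (x , Px , min) = x , Px , ≤-trans
    (≤-reflexive (sym (∑-*ʳ l (f x) (λ y → ⟦ P y ⟧))))
    (∑-mono-∈ l (λ y y∈ → ⟦⟧*≤ (P y) (min y y∈)))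

  all-valuations : ∀ n → (Vec Bool n → Bool) → Bool
  all-valuations zero    p = p []
  all-valuations (suc n) p =
    all-valuations n (p ∘ (true ∷_)) ∧ all-valuations n (p ∘ (false ∷_))

  ∧-elim : ∀ a {b} → T (a ∧ b) → T a × T b
  ∧-elim true t = tt , t

  all-valuations-sound : ∀ n p → T (all-valuations n p) → ∀ v → T (p v)
  all-valuations-sound zero    p t []          = t
  all-valuations-sound (suc n) p t (true  ∷ v) =
    all-valuations-sound n (p ∘ (true ∷_)) (proj₁ (∧-elim _ t)) v
  all-valuations-sound (suc n) p t (false ∷ v) =
    all-valuations-sound n (p ∘ (false ∷_)) (proj₂ (∧-elim (all-valuations n (p ∘ (true ∷_))) t)) v

  -- For closed `f` and `g` the implicit premise evaluates to the unit type and is filled in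
  -- silently, so a pointwise inequality between indicators costs only its two Boolean formulas.
  by-valuation : ∀ n (f g : Vec Bool n → ℕ) {t : T (all-valuations n (λ v → f v ≤ᵇ g v))} →
    ∀ v → f v ≤ g v
  by-valuation n f g {t} v = ≤ᵇ⇒≤ _ _ (all-valuations-sound n (λ v → f v ≤ᵇ g v) t v)

module Cuts where

  open Counting
  open import Data.Bool using (Bool; true; false; T; not; _∧_; _∨_; _xor_)
  open import Data.Bool.Properties 
    using (∧-zeroʳ; not-involutive; not-distribˡ-xor; not-distribʳ-xor; xor-identityʳ)
  open import Data.Empty using (⊥; ⊥-elim)
  open import Data.List using (List; length)
  open import Data.List.Membership.Propositional using (_∈_)
  open import Data.Nat
  open import Data.Nat.Properties
  open import Data.Nat.Tactic.RingSolver using (solve-∀)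
  open import Data.Product using (_×_; _,_; ∃-syntax; proj₁; proj₂)
  open import Data.Sum using (_⊎_; inj₁; inj₂)
  open import Data.Vec using (Vec; []; _∷_; _∷ʳ_)
  open import Function using (_∘_)
  open import Relation.Binary.PropositionalEquality
  open import Relation.Nullary using (yes; no)

  open ≤-Reasoning

  ∧-true : ∀ {a b} → a ∧ b ≡ true → a ≡ true × b ≡ true
  ∧-true {true} {true} _ = refl , refl

  not-true : ∀ {b} → not b ≡ true → b ≡ false
  not-true {false} _ = refl

  ∨-right : ∀ {a b} → a ∨ b ≡ true → a ≡ false → b ≡ true
  ∨-right eq refl = eq

  decide : ∀ b → b ≡ true ⊎ b ≡ false
  decide true  = inj₁ refl
  decide false = inj₂ refl

  ⟦⟧≤ : ∀ {b k} → (b ≡ true → 1 ≤ k) → ⟦ b ⟧ ≤ k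
  ⟦⟧≤ {false} p = z≤n
  ⟦⟧≤ {true}  p = p refl

  ≤ᵇ-true : ∀ {a b} → (a ≤ᵇ b) ≡ true → a ≤ b
  ≤ᵇ-true {a} {b} eq = ≤ᵇ⇒≤ a b (subst T (sym eq) _)

  ≤ᵇ-false : ∀ {a b} → (a ≤ᵇ b) ≡ false → b < a
  ≤ᵇ-false {a} {b} eq = ≰⇒> (λ a≤b → subst T eq (≤⇒≤ᵇ a≤b))

  -- Copies of D₂ forced by patterns in the link of a vertex.

  two : Bool → Bool → Bool → Bool → ℕ
  two a b c d = ⟦ ⟦ a ⟧ + ⟦ b ⟧ + ⟦ c ⟧ + ⟦ d ⟧ ≡ᵇ 2 ⟧

  record Symmetric₃ {A : Set} (E : A → A → A → Bool) : Set where
    field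
      swap₁₂ : ∀ x y z → E x y z ≡ E y x z
      swap₂₃ : ∀ x y z → E x y z ≡ E x z y

  module _ {A : Set} (E : A → A → A → Bool) where

    -- The vertices need not be distinct: degenerate quadruples only contribute O(n³).
    D₂ : A → A → A → A → ℕ
    D₂ a b c d = two (E a b c) (E a b d) (E a c d) (E b c d)

    -- All five quadruples are counted together, because a pattern in the link of `v` only
    -- guarantees that one of them is a copy, without telling which.
    D₂⁵ : A → A → A → A → A → ℕ
    D₂⁵ v a b c d = D₂ v a b c + D₂ v a b d + D₂ v a c d + D₂ v b c d + D₂ a b c d

  -- `D₂⁵` with its ten triples replaced by independent truth values, so that all hypergraphs on
  -- five vertices with a given link pattern can be checked by evaluation.
  two⁵ : (ab ac ad bc bd cd abc abd acd bcd : Bool) → ℕ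
  two⁵ ab ac ad bc bd cd abc abd acd bcd =
    two ab ac bc abc + two ab ad bd abd + two ac ad cd acd + two bc bd cd bcd
    + two abc abd acd bcd

  positive : (ab ac ad bc bd cd : Bool) → Vec Bool 4 → Bool
  positive ab ac ad bc bd cd (abc ∷ abd ∷ acd ∷ bcd ∷ []) =
    1 ≤ᵇ two⁵ ab ac ad bc bd cd abc abd acd bcd

  2ab≤a²+b² : ∀ a b → 2 * (a * b) ≤ a * a + b * b
  2ab≤a²+b² a b with ≤-total a b
  ... | inj₁ a≤b = subst (λ b → 2 * (a * b) ≤ a * a + b * b) (m+[n∸m]≡n a≤b)
    (≤-trans (m≤m+n _ _) (≤-reflexive (square a (b ∸ a))))
    where
    square : ∀ a d → 2 * (a * (a + d)) + d * d ≡ a * a + (a + d) * (a + d)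
    square = solve-∀
  ... | inj₂ b≤a = subst (λ a → 2 * (a * b) ≤ a * a + b * b) (m+[n∸m]≡n b≤a)
    (≤-trans (m≤m+n _ _) (≤-reflexive (square b (a ∸ b))))
    where
    square : ∀ b d → 2 * ((b + d) * b) + d * d ≡ (b + d) * (b + d) + b * b
    square = solve-∀

  module Cut {A : Set} (l : List A) (E : A → A → A → Bool) (E-sym : Symmetric₃ E) (v w : A) where

    open Symmetric₃ E-sym

    private
      m : ℕ
      m = length l

    G : A → A → Bool
    G = E v

    G-sym : ∀ {x y b} → G x y ≡ b → G y x ≡ b
    G-sym {x} {y} eq = trans (sym (swap₂₃ v x y)) eq

    bad : A → A → A → A → ℕ
    bad = D₂⁵ E v

    N : A → Bool
    N = G w

    c : A → ℕ
    c y = # l (λ t → N t ∧ G t y)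

    B B[w] : ℕ
    B    = ∑[ a ∈ l ] ∑[ b ∈ l ] ∑[ c ∈ l ] ∑[ d ∈ l ] bad a b c d
    B[w] = ∑[ b ∈ l ] ∑[ c ∈ l ] ∑[ d ∈ l ] bad w b c d

    -- The six pairs are prescribed, and the implicit premise checks all sixteen choices of the four
    -- triples. Every use below is an induced P₄ of the link.
    hit : ∀ {a b c d ab ac ad bc bd cd} →
      G a b ≡ ab → G a c ≡ ac → G a d ≡ ad → G b c ≡ bc → G b d ≡ bd → G c d ≡ cd →
      {T (all-valuations 4 (positive ab ac ad bc bd cd))} → 1 ≤ bad a b c d
    hit {a} {b} {c} {d} refl refl refl refl refl refl {t} = ≤ᵇ⇒≤ 1 _
      (all-valuations-sound 4 (positive (G a b) (G a c) (G a d) (G b c) (G b d) (G c d)) t (E a b c ∷ E a b d ∷ E a c d ∷ E b c d ∷ []))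

    -- Prescribing a triple as well serves the star with edges `t x`, `t x′` and isolated `y`: the
    -- link forces every triple except `x x′ y`, and if that one is an edge it joins `x x′ t` as the
    -- second edge of a D₂.
    hit-abc : ∀ {a b c d ab ac ad bc bd cd abc} → E a b c ≡ abc →
      G a b ≡ ab → G a c ≡ ac → G a d ≡ ad → G b c ≡ bc → G b d ≡ bd → G c d ≡ cd →
      {T (all-valuations 3 (positive ab ac ad bc bd cd ∘ (abc ∷_)))} → 1 ≤ bad a b c d
    hit-abc {a} {b} {c} {d} refl refl refl refl refl refl refl {t} = ≤ᵇ⇒≤ 1 _
      (all-valuations-sound 3
        (positive (G a b) (G a c) (G a d) (G b c) (G b d) (G c d) ∘ (E a b c ∷_)) t (E a b d ∷ E a c d ∷ E b c d ∷ []))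

    hit-bcd : ∀ {a b c d ab ac ad bc bd cd bcd} → E b c d ≡ bcd →
      G a b ≡ ab → G a c ≡ ac → G a d ≡ ad → G b c ≡ bc → G b d ≡ bd → G c d ≡ cd →
      {T (all-valuations 3 (positive ab ac ad bc bd cd ∘ (_∷ʳ bcd)))} → 1 ≤ bad a b c d
    hit-bcd {a} {b} {c} {d} refl refl refl refl refl refl refl {t} = ≤ᵇ⇒≤ 1 _
      (all-valuations-sound 3
        (positive (G a b) (G a c) (G a d) (G b c) (G b d) (G c d) ∘ (_∷ʳ E b c d)) t (E a b c ∷ E a b d ∷ E a c d ∷ []))

    private-nbr : A → A → A → Bool
    private-nbr x y t = (N t ∧ G t x) ∧ not (G t y)

    c-difference : ∀ x y → c x ≤ # l (private-nbr x y) + c y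
    c-difference x y = ∑-≤+ l λ t →
      by-valuation 3 (λ { (n ∷ p ∷ q ∷ []) → ⟦ n ∧ p ⟧ })
        (λ { (n ∷ p ∷ q ∷ []) → ⟦ (n ∧ p) ∧ not q ⟧ + ⟦ n ∧ q ⟧ })
        (N t ∷ G t x ∷ G t y ∷ [])

    -- The analogue of `c` for the complement of `G`, in which `not ∘ N` is the neighbourhood of
    -- `w`.
    c̄ : A → ℕ
    c̄ x = # l (λ t → not (N t) ∧ not (G t x))

    -- Nearly nested neighbourhoods.

    module Dichotomy (θ h β : ℕ) where

      low low̄ : A → Bool
      low y = not (N y) ∧ not (θ ≤ᵇ c y)
      low̄ x = N x ∧ not (θ ≤ᵇ c̄ x)

      crossing : A → A → A → A → ℕ
      crossing y₀ y x x′ = bad w y₀ x x′ + bad y₀ y x x′ + bad w y₀ y x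

      badness : A → ℕ
      badness y₀ = ∑[ y ∈ l ] ∑[ x ∈ l ] ∑[ x′ ∈ l ] crossing y₀ y x x′

      atypical : A → Bool
      atypical y = not (badness y ≤ᵇ β)

      ∑-badness : ∑ l badness ≡ m * B[w] + B + m * B[w]
      ∑-badness = trans
        (∑-cong l λ y₀ → trans
          (∑-cong l λ y → trans
            (∑-cong l λ x → trans (∑-+ l (λ x′ → bad w y₀ x x′ + bad y₀ y x x′) _)
              (cong₂ _+_ (∑-+ l (bad w y₀ x) _) (∑-const l (bad w y₀ y x))))
            (trans (∑-+ l (λ x → ∑ l (bad w y₀ x) + ∑ l (bad y₀ y x)) _)
              (cong₂ _+_ (∑-+ l (λ x → ∑ l (bad w y₀ x)) _) (∑-*ˡ l m (bad w y₀ y)))))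
          (trans (∑-+ l (λ y → ∑ l (λ x → ∑ l (bad w y₀ x)) + ∑ l (λ x → ∑ l (bad y₀ y x))) _)
            (cong₂ _+_ (trans (∑-+ l (λ y → ∑ l (λ x → ∑ l (bad w y₀ x))) _)
                (cong (_+ ∑ l (λ y → ∑ l (λ x → ∑ l (bad y₀ y x)))) (∑-const l _)))
              (∑-*ˡ l m _))))
        (trans (∑-+ l (λ y₀ → m * ∑ l (λ x → ∑ l (bad w y₀ x)) + ∑ l (λ y → ∑ l (λ x → ∑ l (bad y₀ y x)))) _)
          (cong₂ _+_ (trans (∑-+ l (λ y₀ → m * ∑ l (λ x → ∑ l (bad w y₀ x))) _) (cong (_+ B) (∑-*ˡ l m _)))
            (∑-*ˡ l m _)))

      -- Markov's inequality; the factors `m` come from the terms of `crossing` that omit one of the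
      -- summation variables.
      atypical-bound : suc β * # l atypical ≤ m * B[w] + B + m * B[w]
      atypical-bound = ≤-trans
        (*∑-≤ l (suc β) {g = badness} λ y → *⟦⟧≤ (atypical y) λ a → ≤ᵇ-false (not-true a))
        (≤-reflexive ∑-badness)

      -- Private neighbours in both directions give an induced P₄: `y₀ x w x′` if `x x′` is absent,
      -- `y₀ x x′ y` if it is present and `y₀ y` absent, and `w x y₀ y` if both are present.
      crossing≥1 : ∀ {y₀ y x x′} → N y₀ ≡ false → N y ≡ false →
        private-nbr y₀ y x ≡ true → private-nbr y y₀ x′ ≡ true → 1 ≤ crossing y₀ y x x′
      crossing≥1 {y₀} {y} {x} {x′} ¬Ny₀ ¬Ny p p′
        with decide (G x x′) | decide (G y₀ y) | ∧-true {N x ∧ G x y₀} p | ∧-true {N x′ ∧ G x′ y} p′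
      ... | inj₂ ¬xx′ | _ | nx,g , _ | nx′,g′ , ¬g′ = ≤-trans
        (hit {w} {y₀} {x} {x′} ¬Ny₀ (proj₁ (∧-true {N x} nx,g)) (proj₁ (∧-true {N x′} nx′,g′))
          (G-sym (proj₂ (∧-true {N x} nx,g))) (G-sym (not-true ¬g′)) ¬xx′)
        (≤-trans (m≤m+n _ (bad y₀ y x x′)) (m≤m+n _ (bad w y₀ y x)))
      ... | inj₁ xx′ | inj₂ ¬y₀y | nx,g , ¬g | nx′,g′ , ¬g′ = ≤-trans
        (hit {y₀} {y} {x} {x′} ¬y₀y (G-sym (proj₂ (∧-true {N x} nx,g))) (G-sym (not-true ¬g′))
          (G-sym (not-true ¬g)) (G-sym (proj₂ (∧-true {N x′} nx′,g′))) xx′)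
        (≤-trans (m≤n+m _ (bad w y₀ x x′)) (m≤m+n _ (bad w y₀ y x)))
      ... | inj₁ xx′ | inj₁ y₀y | nx,g , ¬g | _ = ≤-trans
        (hit {w} {y₀} {y} {x} ¬Ny₀ ¬Ny (proj₁ (∧-true {N x} nx,g)) y₀y
          (G-sym (proj₂ (∧-true {N x} nx,g))) (G-sym (not-true ¬g)))
        (m≤n+m _ (bad w y₀ x x′ + bad y₀ y x x′))

      typical : A → Bool
      typical y = (not (N y) ∧ (θ ≤ᵇ c y)) ∧ (badness y ≤ᵇ β)

      -- The sets N ∩ N(y), for typical y outside N, are nearly nested.  If nearly all had
      -- at least θ elements, then the elements of the smallest one, which belongs to y₀, would be
      -- adjacent to almost everything outside N.
      dichotomy : # l (not ∘ N) ≤ # l low + # l atypical ⊎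
        2 * (h * (θ * θ)) ≤
          m * (h * h) + β + 2 * (h * (m * (# l low + # l atypical))) + 2 * (h * (θ * # l low̄))
      dichotomy with minimiser l typical c
      ... | inj₁ none = inj₁ (≤-trans (∑-≤+ l split)
        (≤-reflexive (trans (cong (_+ (# l typical)) (∑-+ l (⟦_⟧ ∘ low) (⟦_⟧ ∘ atypical)))
          (trans (cong (# l low + # l atypical +_) none) (+-identityʳ _)))))
        where
        split : ∀ y → ⟦ not (N y) ⟧ ≤ ⟦ low y ⟧ + ⟦ atypical y ⟧ + ⟦ typical y ⟧
        split y = by-valuation 3 (λ { (n ∷ t ∷ b ∷ []) → ⟦ not n ⟧ })
          (λ { (n ∷ t ∷ b ∷ []) → ⟦ not n ∧ not t ⟧ + ⟦ not b ⟧ + ⟦ (not n ∧ t) ∧ b ⟧ })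
          (N y ∷ (θ ≤ᵇ c y) ∷ (badness y ≤ᵇ β) ∷ [])
      ... | inj₂ (y₀ , typical-y₀ , minimal) = inj₂ (begin
        2 * (h * (θ * θ))
          ≤⟨ *-monoʳ-≤ 2 (*-monoʳ-≤ h lower) ⟩
        2 * (h * (∑ l losses + θ * # l low̄))
          ≡⟨ distribute h (∑ l losses) (θ * # l low̄) ⟩
        2 * h * ∑ l losses + 2 * (h * (θ * # l low̄))
          ≤⟨ +-monoˡ-≤ (2 * (h * (θ * # l low̄))) upper ⟩
        m * (h * h) + β + 2 * (h * (m * (# l low + # l atypical))) + 2 * (h * (θ * # l low̄))
          ∎)
        where
        open ≤-Reasoning
        distribute : ∀ h a b → 2 * (h * (a + b)) ≡ 2 * h * a + 2 * (h * b)
        distribute = solve-∀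
        not-N,θ≤c = ∧-true {not (N y₀)} (proj₁ (∧-true {not (N y₀) ∧ (θ ≤ᵇ c y₀)} typical-y₀))
        ¬Ny₀ : N y₀ ≡ false
        ¬Ny₀ = not-true (proj₁ not-N,θ≤c)
        loss : A → ℕ
        loss y = # l (private-nbr y₀ y)
        losses : A → ℕ
        losses y = ⟦ not (N y) ⟧ * loss y

        -- Double counting of the non-adjacent pairs formed by a `y` outside N and a common
        -- neighbour `t` of `w` and `y₀`.
        loss-swap : ∑ l losses ≡ ∑[ t ∈ l ] (⟦ N t ∧ G t y₀ ⟧ * c̄ t)
        loss-swap = trans (∑-cong l λ y → sym (∑-*ˡ l ⟦ not (N y) ⟧ _))
          (trans (∑-comm l l _) (∑-cong l λ t → trans
            (∑-cong l λ y → trans (bool (not (N y)) (N t ∧ G t y₀) (G t y))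
              (cong (λ g → ⟦ N t ∧ G t y₀ ⟧ * ⟦ not (N y) ∧ not g ⟧) (swap₂₃ v t y)))
            (∑-*ˡ l ⟦ N t ∧ G t y₀ ⟧ _)))
          where
          bool : ∀ a b d → ⟦ a ⟧ * ⟦ b ∧ not d ⟧ ≡ ⟦ b ⟧ * ⟦ a ∧ not d ⟧
          bool false b d = sym (*-zeroʳ ⟦ b ⟧)
          bool true  b d = trans (+-identityʳ _) (⟦∧⟧ b (not d))

        -- There are at least `θ` common neighbours of `w` and `y₀`, and each that is not in `low̄`
        -- misses at least `θ` vertices outside N.
        lower : θ * θ ≤ ∑ l losses + θ * # l low̄
        lower = begin
          θ * θ                                                      ≤⟨ *-monoʳ-≤ θ (≤ᵇ-true (proj₂ not-N,θ≤c)) ⟩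
          θ * c y₀                                                   ≡⟨ ∑-*ˡ l θ _ ⟨
          ∑[ t ∈ l ] (θ * ⟦ N t ∧ G t y₀ ⟧)                          ≤⟨ ∑-≤+ l pointwise ⟩
          ∑[ t ∈ l ] (⟦ N t ∧ G t y₀ ⟧ * c̄ t) + ∑[ t ∈ l ] (θ * ⟦ low̄ t ⟧)  ≡⟨ cong₂ _+_ loss-swap (sym (∑-*ˡ l θ _)) ⟨
          ∑ l losses + θ * # l low̄                                   ∎
          where
          pointwise : ∀ t → θ * ⟦ N t ∧ G t y₀ ⟧ ≤ ⟦ N t ∧ G t y₀ ⟧ * c̄ t + θ * ⟦ low̄ t ⟧
          pointwise t with N t | G t y₀ | θ ≤ᵇ c̄ t in θ≤
          ... | false | _     | _     = ≤-trans (≤-reflexive (*-zeroʳ θ)) z≤n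
          ... | true  | false | _     = ≤-trans (≤-reflexive (*-zeroʳ θ)) z≤n
          ... | true  | true  | true  = ≤-trans (≤-reflexive (*-identityʳ θ))
            (≤-trans (≤ᵇ-true θ≤) (≤-trans (≤-reflexive (sym (+-identityʳ _))) (m≤m+n _ _)))
          ... | true  | true  | false = m≤n+m _ _

        pairs : A → ℕ
        pairs y = ∑[ x ∈ l ] ∑[ x′ ∈ l ] crossing y₀ y x x′

        -- By minimality of `c y₀`, at least as many neighbours are private to `y` as to `y₀`, and
        -- every pair of opposite private neighbours is counted by `crossing`.
        loss² : ∀ y → N y ≡ false → c y₀ ≤ c y → loss y * loss y ≤ pairs y
        loss² y ¬Ny c≤ = begin
          loss y * loss y                      ≤⟨ *-monoʳ-≤ (loss y) loss≤ ⟩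
          loss y * # l (private-nbr y y₀)      ≡⟨ ∑-× l l _ _ ⟨
          _                                    ≤⟨ (∑-mono l λ x → ∑-mono l λ x′ →
                                                    ⟦⟧*≤ (private-nbr y₀ y x) λ p → ⟦⟧≤ λ p′ →
                                                    crossing≥1 {y₀} {y} {x} {x′} ¬Ny₀ ¬Ny p p′) ⟩
          pairs y                              ∎
          where
          exchange : loss y + c y ≤ # l (private-nbr y y₀) + c y₀
          exchange = ≤-trans (≤-reflexive (sym (∑-+ l _ _))) (∑-≤+ l λ t →
            by-valuation 3 (λ { (n ∷ p ∷ q ∷ []) → ⟦ (n ∧ p) ∧ not q ⟧ + ⟦ n ∧ q ⟧ })
              (λ { (n ∷ p ∷ q ∷ []) → ⟦ (n ∧ q) ∧ not p ⟧ + ⟦ n ∧ p ⟧ })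
              (N t ∷ G t y₀ ∷ G t y ∷ []))
          loss≤ : loss y ≤ # l (private-nbr y y₀)
          loss≤ = +-cancelʳ-≤ (c y) _ _ (≤-trans exchange (+-monoʳ-≤ _ c≤))

        -- The inequality 2 h x ≤ h² + x² linearises `loss²`. Typical `y` are paid for by
        -- `badness y₀`, low and atypical ones by the trivial bound `loss y ≤ m`.
        upper : 2 * h * ∑ l losses ≤ m * (h * h) + β + 2 * (h * (m * (# l low + # l atypical)))
        upper = begin
          2 * h * ∑ l losses
            ≡⟨ ∑-*ˡ l (2 * h) losses ⟨
          ∑[ y ∈ l ] (2 * h * losses y)
            ≤⟨ ∑-mono-∈ l pointwise ⟩
          ∑[ y ∈ l ] (h * h + pairs y + 2 * (h * m) * (⟦ low y ⟧ + ⟦ atypical y ⟧))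
            ≡⟨ trans (∑-+ l (λ y → h * h + pairs y) _) (cong₂ _+_
                 (trans (∑-+ l (λ _ → h * h) pairs) (cong (_+ badness y₀) (∑-const l (h * h))))
                 (trans (∑-*ˡ l (2 * (h * m)) _) (cong (2 * (h * m) *_) (∑-+ l _ _)))) ⟩
          m * (h * h) + badness y₀ + 2 * (h * m) * (# l low + # l atypical)
            ≤⟨ +-monoˡ-≤ _ (+-monoʳ-≤ (m * (h * h)) (≤ᵇ-true (proj₂ (∧-true {not (N y₀) ∧ (θ ≤ᵇ c y₀)} typical-y₀)))) ⟩
          m * (h * h) + β + 2 * (h * m) * (# l low + # l atypical)
            ≡⟨ cong (m * (h * h) + β +_) (reassoc h m _) ⟩
          m * (h * h) + β + 2 * (h * (m * (# l low + # l atypical)))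
            ∎
          where
          reassoc : ∀ h m k → 2 * (h * m) * k ≡ 2 * (h * (m * k))
          reassoc = solve-∀
          rearrange : ∀ h a → 2 * h * (1 * a) ≡ 2 * (h * a)
          rearrange = solve-∀
          kept : ∀ {y} → N y ≡ false → 2 * h * losses y ≡ 2 * (h * loss y)
          kept {y} ¬Ny = trans (cong (λ b → 2 * h * (⟦ not b ⟧ * loss y)) ¬Ny) (rearrange h (loss y))
          coarse : ∀ y → N y ≡ false → 1 ≤ ⟦ low y ⟧ + ⟦ atypical y ⟧ → 2 * h * losses y ≤
            h * h + pairs y + 2 * (h * m) * (⟦ low y ⟧ + ⟦ atypical y ⟧)
          coarse y ¬Ny 1≤k = begin
            2 * h * losses y        ≡⟨ kept ¬Ny ⟩
            2 * (h * loss y)        ≤⟨ *-monoʳ-≤ 2 (*-monoʳ-≤ h (#≤length l _)) ⟩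
            2 * (h * m)             ≡⟨ *-identityʳ _ ⟨
            2 * (h * m) * 1         ≤⟨ *-monoʳ-≤ (2 * (h * m)) 1≤k ⟩
            2 * (h * m) * (⟦ low y ⟧ + ⟦ atypical y ⟧)  ≤⟨ m≤n+m _ (h * h + pairs y) ⟩
            h * h + pairs y + 2 * (h * m) * (⟦ low y ⟧ + ⟦ atypical y ⟧) ∎
          pointwise : ∀ y → y ∈ l → 2 * h * losses y ≤
            h * h + pairs y + 2 * (h * m) * (⟦ low y ⟧ + ⟦ atypical y ⟧)
          pointwise y y∈l with decide (N y) | decide (θ ≤ᵇ c y) | decide (badness y ≤ᵇ β)
          ... | inj₁ Ny | _ | _ = ≤-trans
            (≤-reflexive (trans (cong (λ b → 2 * h * (⟦ not b ⟧ * loss y)) Ny) (*-zeroʳ (2 * h)))) z≤n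
          ... | inj₂ ¬Ny | inj₂ lo | _ = coarse y ¬Ny
            (≤-trans (≤-reflexive (cong₂ (λ a b → ⟦ not a ∧ not b ⟧) (sym ¬Ny) (sym lo))) (m≤m+n _ _))
          ... | inj₂ ¬Ny | inj₁ hi | inj₂ bd = coarse y ¬Ny
            (≤-trans (≤-reflexive (cong (λ b → ⟦ not b ⟧) (sym bd))) (m≤n+m _ ⟦ low y ⟧))
          ... | inj₂ ¬Ny | inj₁ hi | inj₁ ok =
            ≤-trans (≤-reflexive (kept ¬Ny))
            (≤-trans (2ab≤a²+b² h (loss y)) (≤-trans
              (+-monoʳ-≤ (h * h) (loss² y ¬Ny (minimal y y∈l
                (trans (cong₂ (λ a b → (not a ∧ b) ∧ (badness y ≤ᵇ β)) ¬Ny hi) ok))))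
              (m≤m+n _ _)))

    -- The partition into W and R, and its crossing edges.

    module Threshold (σ e : ℕ) where

      τ : ℕ
      τ = σ + e

      -- W stands for the component of w in G.  The gap e between the thresholds makes every
      -- vertex of L miss at least e of the common neighbours of w and a vertex of Z.
      W R Z K L : A → Bool
      W x = N x ∨ (τ ≤ᵇ c x)
      R x = not (W x)
      Z x = not (N x) ∧ (τ ≤ᵇ c x)
      L x = not (N x) ∧ not (σ ≤ᵇ c x)
      K x = R x ∧ (σ ≤ᵇ c x)

      gap : ∀ {x y} → (τ ≤ᵇ c x) ≡ true → (σ ≤ᵇ c y) ≡ false → e ≤ # l (private-nbr x y)
      gap {x} {y} hi lo = +-cancelˡ-≤ σ e _ (≤-trans (≤ᵇ-true hi) (≤-trans (c-difference x y)
        (≤-trans (+-monoʳ-≤ (# l (private-nbr x y)) (<⇒≤ (≤ᵇ-false lo)))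
          (≤-reflexive (+-comm _ σ)))))

      N-L-edges : ∑[ x ∈ l ] ∑[ y ∈ l ] ⟦ (N x ∧ L y) ∧ G x y ⟧ ≤ # l L * σ
      N-L-edges = begin
        ∑[ x ∈ l ] ∑[ y ∈ l ] ⟦ (N x ∧ L y) ∧ G x y ⟧  ≡⟨ ∑-comm l l _ ⟩
        ∑[ y ∈ l ] ∑[ x ∈ l ] ⟦ (N x ∧ L y) ∧ G x y ⟧  ≤⟨ ∑-mono l into ⟩
        ∑[ y ∈ l ] (⟦ L y ⟧ * c y)                      ≤⟨ ∑-mono l below ⟩
        ∑[ y ∈ l ] (⟦ L y ⟧ * σ)                        ≡⟨ ∑-*ʳ l σ (⟦_⟧ ∘ L) ⟩
        # l L * σ                                       ∎
        where
        open ≤-Reasoning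
        into : ∀ y → ∑[ x ∈ l ] ⟦ (N x ∧ L y) ∧ G x y ⟧ ≤ ⟦ L y ⟧ * c y
        into y = ≤-trans
          (∑-mono l λ x → by-valuation 3 (λ { (n ∷ r ∷ g ∷ []) → ⟦ (n ∧ r) ∧ g ⟧ })
            (λ { (n ∷ r ∷ g ∷ []) → ⟦ r ⟧ * ⟦ n ∧ g ⟧ }) (N x ∷ L y ∷ G x y ∷ []))
          (≤-reflexive (∑-*ˡ l ⟦ L y ⟧ _))
        below : ∀ y → ⟦ L y ⟧ * c y ≤ ⟦ L y ⟧ * σ
        below y = ⟦⟧*≤ (L y) λ Ly → ≤-trans
          (<⇒≤ (≤ᵇ-false {σ} (not-true (proj₂ (∧-true {not (N y)} Ly)))))
          (≤-reflexive (sym (trans (cong (λ b → ⟦ b ⟧ * σ) Ly) (+-identityʳ σ))))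

      ZL : A → A → Bool
      ZL x y = (Z x ∧ L y) ∧ G x y

      -- A link edge from `x` in Z to `y` in L extends, by any `t` private to `x`, to the induced P₄
      -- `w t x y`; there are at least `e` such `t`.
      Z-L-edges : e * (∑[ x ∈ l ] ∑[ y ∈ l ] ⟦ ZL x y ⟧) ≤ B[w]
      Z-L-edges = *∑-≤ l e λ x → *∑-≤ l e λ y → *⟦⟧≤ (ZL x y) λ eq →
        let zl , g = ∧-true {Z x ∧ L y} eq
            z , lo = ∧-true {Z x} zl
            nx , hi = ∧-true {not (N x)} z
            ny , lo = ∧-true {not (N y)} lo
        in ≤-trans (gap {x} {y} hi (not-true lo)) (∑-mono l λ t → ⟦⟧≤ λ eq →
          let nt,gtx , gty = ∧-true {N t ∧ G t x} eq
              nt , gtx = ∧-true {N t} nt,gtx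
          in hit (not-true nx) (not-true ny) nt g (G-sym gtx) (G-sym (not-true gty)))

      -- The edges of type WWR that remain after discarding those with `y` in K and those with a
      -- link edge from `x` or `x′` to `y`.
      core : A → A → A → Bool
      core x x′ y = ((W x ∧ W x′) ∧ L y) ∧ (not (G x y) ∧ not (G x′ y)) ∧ E x x′ y

      -- Patterns with no, one or two auxiliary vertices `t`, `t′` carry the weights `e * e`, `e`
      -- and 1: each auxiliary vertex can be chosen in at least `e` ways, so every case totals at
      -- least `e * e`.
      witnesses : A → A → A → ℕ
      witnesses x x′ y =
        e * e * bad w x x′ y
        + e * (∑[ t ∈ l ] (bad w x x′ t + bad x x′ y t))
        + (∑[ t ∈ l ] ∑[ t′ ∈ l ] ((bad x x′ y t + bad x x′ y t′) + (bad x x′ t t′ + bad w x t t′)))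

      -- Each of x, x′ is a neighbour of w or has at least e common neighbours with w that are not
      -- adjacent to y.  The resulting path from x to x′ contains an induced P₄ of G, or can be
      -- shortened to a path x t x′ with t not adjacent to y, and then E x x′ y gives a D₂.
      core≤witnesses : ∀ x x′ y → core x x′ y ≡ true → e * e ≤ witnesses x x′ y
      core≤witnesses x x′ y eq = by-cases
        where
        WWL = proj₁ (∧-true {(W x ∧ W x′) ∧ L y} eq)
        WW = proj₁ (∧-true {W x ∧ W x′} WWL)
        Wx = proj₁ (∧-true {W x} WW)
        Wx′ = proj₂ (∧-true {W x} WW)
        Ly = proj₂ (∧-true {W x ∧ W x′} WWL)
        ¬Ny = not-true (proj₁ (∧-true {not (N y)} Ly))
        lo = not-true (proj₂ (∧-true {not (N y)} Ly))
        rest = proj₂ (∧-true {(W x ∧ W x′) ∧ L y} eq)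
        ¬xy = not-true (proj₁ (∧-true {not (G x y)} (proj₁ (∧-true {not (G x y) ∧ not (G x′ y)} rest))))
        ¬x′y = not-true (proj₂ (∧-true {not (G x y)} (proj₁ (∧-true {not (G x y) ∧ not (G x′ y)} rest))))
        xx′y = proj₂ (∧-true {not (G x y) ∧ not (G x′ y)} rest)

        direct : 1 ≤ bad w x x′ y → e * e ≤ witnesses x x′ y
        direct h = ≤-trans (≤-reflexive (sym (*-identityʳ (e * e))))
          (≤-trans (*-monoʳ-≤ (e * e) h) (≤-trans (m≤m+n _ _) (m≤m+n _ _)))

        one-step : e ≤ ∑[ t ∈ l ] (bad w x x′ t + bad x x′ y t) → e * e ≤ witnesses x x′ y
        one-step h = ≤-trans (*-monoʳ-≤ e h)
          (≤-trans (m≤n+m _ (e * e * bad w x x′ y)) (m≤m+n _ _))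

        inr : ∀ a {b} → 1 ≤ b → 1 ≤ a + b
        inr a {b} h = ≤-trans h (m≤n+m b a)
        inl : ∀ {a b} → 1 ≤ a → 1 ≤ a + b
        inl {a} {b} h = ≤-trans h (m≤m+n a b)

        star : ∀ {t} → G x x′ ≡ false → G t x ≡ true → G t x′ ≡ true → G t y ≡ false →
          1 ≤ bad x x′ y t
        star ¬xx′ tx tx′ ¬ty =
          hit-abc xx′y ¬xx′ ¬xy (G-sym tx) ¬x′y (G-sym tx′) (G-sym ¬ty)

        via-x′ : ∀ t → N x ≡ true → N x′ ≡ false → G x x′ ≡ false → private-nbr x′ y t ≡ true →
          1 ≤ bad w x x′ t + bad x x′ y t
        via-x′ t Nx ¬Nx′ ¬xx′ eq with decide (G t x) | ∧-true {N t ∧ G t x′} eq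
        ... | inj₁ tx | nt,tx′ , ¬ty = inr (bad w x x′ t) (star ¬xx′ tx (proj₂ (∧-true {N t} nt,tx′)) (not-true ¬ty))
        ... | inj₂ tx | nt,tx′ , ¬ty = inl
          (hit Nx ¬Nx′ (proj₁ (∧-true {N t} nt,tx′)) ¬xx′ (G-sym tx) (G-sym (proj₂ (∧-true {N t} nt,tx′))))

        via-x : ∀ t → N x ≡ false → N x′ ≡ true → G x x′ ≡ false → private-nbr x y t ≡ true →
          1 ≤ bad w x x′ t + bad x x′ y t
        via-x t ¬Nx Nx′ ¬xx′ eq with decide (G t x′) | ∧-true {N t ∧ G t x} eq
        ... | inj₁ tx′ | nt,tx , ¬ty = inr (bad w x x′ t) (star ¬xx′ (proj₂ (∧-true {N t} nt,tx)) tx′ (not-true ¬ty))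
        ... | inj₂ tx′ | nt,tx , ¬ty = inl
          (hit ¬Nx Nx′ (proj₁ (∧-true {N t} nt,tx)) ¬xx′ (G-sym (proj₂ (∧-true {N t} nt,tx))) (G-sym tx′))

        -- If neither `t` nor `t′` is the centre of a star, then `x t t′ x′` is an induced P₄ when
        -- `t t′` is present, and `x t w t′` is one when it is absent.
        via-both : ∀ t t′ → N x ≡ false → N x′ ≡ false → G x x′ ≡ false →
          private-nbr x y t ≡ true → private-nbr x′ y t′ ≡ true →
          1 ≤ (bad x x′ y t + bad x x′ y t′) + (bad x x′ t t′ + bad w x t t′)
        via-both t t′ ¬Nx ¬Nx′ ¬xx′ eq eq′
          with decide (G t x′) | decide (G t′ x) | decide (G t t′)
             | ∧-true {N t ∧ G t x} eq | ∧-true {N t′ ∧ G t′ x′} eq′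
        ... | inj₁ tx′ | _ | _ | nt,tx , ¬ty | _ =
          inl (inl (star ¬xx′ (proj₂ (∧-true {N t} nt,tx)) tx′ (not-true ¬ty)))
        ... | inj₂ _ | inj₁ t′x | _ | _ | nt′,t′x′ , ¬t′y =
          inl (inr (bad x x′ y t) (star ¬xx′ t′x (proj₂ (∧-true {N t′} nt′,t′x′)) (not-true ¬t′y)))
        ... | inj₂ tx′ | inj₂ t′x | inj₁ tt′ | nt,tx , _ | nt′,t′x′ , _ =
          inr (bad x x′ y t + bad x x′ y t′) (inl
            (hit ¬xx′ (G-sym (proj₂ (∧-true {N t} nt,tx))) (G-sym t′x) (G-sym tx′)
              (G-sym (proj₂ (∧-true {N t′} nt′,t′x′))) tt′))
        ... | inj₂ tx′ | inj₂ t′x | inj₂ tt′ | nt,tx , _ | nt′,t′x′ , _ =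
          inr (bad x x′ y t + bad x x′ y t′) (inr (bad x x′ t t′)
            (hit ¬Nx (proj₁ (∧-true {N t} nt,tx)) (proj₁ (∧-true {N t′} nt′,t′x′))
              (G-sym (proj₂ (∧-true {N t} nt,tx))) (G-sym t′x) tt′))

        by-cases : e * e ≤ witnesses x x′ y
        by-cases with decide (G x x′) | decide (N x) | decide (N x′)
        -- If `x x′` is a link edge, it and the edge `x x′ y` are the only edges of `v x x′ y`. If
        -- it is absent and both vertices are in N, then `w` itself is the centre of the star.
        ... | inj₁ xx′ | inj₁ Nx | inj₁ Nx′ = direct (hit-bcd xx′y Nx Nx′ ¬Ny xx′ ¬xy ¬x′y)
        ... | inj₁ xx′ | inj₁ Nx | inj₂ Nx′ = direct (hit-bcd xx′y Nx Nx′ ¬Ny xx′ ¬xy ¬x′y)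
        ... | inj₁ xx′ | inj₂ Nx | inj₁ Nx′ = direct (hit-bcd xx′y Nx Nx′ ¬Ny xx′ ¬xy ¬x′y)
        ... | inj₁ xx′ | inj₂ Nx | inj₂ Nx′ = direct (hit-bcd xx′y Nx Nx′ ¬Ny xx′ ¬xy ¬x′y)
        ... | inj₂ xx′ | inj₁ Nx | inj₁ Nx′ = direct (hit-bcd xx′y Nx Nx′ ¬Ny xx′ ¬xy ¬x′y)
        ... | inj₂ xx′ | inj₁ Nx | inj₂ Nx′ = one-step
          (≤-trans (gap {x′} {y} (∨-right Wx′ Nx′) lo) (∑-mono l λ t → ⟦⟧≤ (via-x′ t Nx Nx′ xx′)))
        ... | inj₂ xx′ | inj₂ Nx | inj₁ Nx′ = one-step
          (≤-trans (gap {x} {y} (∨-right Wx Nx) lo) (∑-mono l λ t → ⟦⟧≤ (via-x t Nx Nx′ xx′)))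
        ... | inj₂ xx′ | inj₂ Nx | inj₂ Nx′ = ≤-trans
          (≤-trans (*-mono-≤ (gap {x} {y} (∨-right Wx Nx) lo) (gap {x′} {y} (∨-right Wx′ Nx′) lo))
            (≤-trans (≤-reflexive (sym (∑-× l l _ _)))
              (∑-mono l λ t → ∑-mono l λ t′ → ⟦⟧*≤ (private-nbr x y t) λ p → ⟦⟧≤ λ p′ →
                via-both t t′ Nx Nx′ xx′ p p′)))
          (m≤n+m _ (e * e * bad w x x′ y + e * (∑[ t ∈ l ] (bad w x x′ t + bad x x′ y t))))

      ∑³ : (A → A → A → ℕ) → ℕ
      ∑³ f = ∑[ x ∈ l ] ∑[ y ∈ l ] ∑[ z ∈ l ] f x y z

      ∑³-+ : ∀ f g → ∑³ (λ x y z → f x y z + g x y z) ≡ ∑³ f + ∑³ g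
      ∑³-+ f g = trans
        (∑-cong l λ x → trans (∑-cong l λ y → ∑-+ l (f x y) (g x y)) (∑-+ l _ _))
        (∑-+ l _ _)

      ∑³-*ˡ : ∀ k f → ∑³ (λ x y z → k * f x y z) ≡ k * ∑³ f
      ∑³-*ˡ k f = trans
        (∑-cong l λ x → trans (∑-cong l λ y → ∑-*ˡ l k (f x y)) (∑-*ˡ l k _))
        (∑-*ˡ l k _)

      ∑³-witnesses : ∑³ witnesses ≡
        e * e * B[w] + e * (m * B[w] + B) + ((m * B + m * B) + (m * B + m * (m * B[w])))
      ∑³-witnesses = trans (∑³-+ (λ x x′ y → e * e * bad w x x′ y + e * (∑[ t ∈ l ] (bad w x x′ t + bad x x′ y t))) _) (cong₂ _+_
        (trans (∑³-+ (λ x x′ y → e * e * bad w x x′ y) _) (cong₂ _+_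
          (∑³-*ˡ (e * e) (bad w))
          (trans (∑³-*ˡ e _) (cong (e *_)
            (trans (∑³-cong (λ x x′ y → ∑-+ l (bad w x x′) (bad x x′ y)))
              (trans (∑³-+ (λ x x′ y → ∑ l (bad w x x′)) _) (cong (_+ B)
                (trans (∑-cong l λ x → ∑²-const l _) (trans (∑-*ˡ l m _) refl)))))))))
        (trans (∑³-cong λ x x′ y → trans
            (∑-cong l λ t → trans (∑-+ l (λ t′ → bad x x′ y t + bad x x′ y t′) _)
              (cong₂ _+_ (∑-+ l (λ t′ → bad x x′ y t) _) (∑-+ l (λ t′ → bad x x′ t t′) _)))
            (trans (∑-+ l (λ t → ∑ l (λ t′ → bad x x′ y t) + ∑ l (λ t′ → bad x x′ y t′)) _)
              (cong₂ _+_ (∑-+ l (λ t → ∑ l (λ t′ → bad x x′ y t)) _) (∑-+ l (λ t → ∑ l (λ t′ → bad x x′ t t′)) _))))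
          (trans (∑³-+ (λ x x′ y → ∑ l (λ t → ∑ l (λ t′ → bad x x′ y t)) + ∑ l (λ t → ∑ l (λ t′ → bad x x′ y t′))) _)
            (cong₂ _+_
              (trans (∑³-+ (λ x x′ y → ∑ l (λ t → ∑ l (λ t′ → bad x x′ y t))) _) (cong₂ _+_
                (trans (∑³-cong λ x x′ y → ∑²-const l _) (∑³-*ˡ m _))
                (trans (∑³-cong λ x x′ y → ∑-const l _) (∑³-*ˡ m _))))
              (trans (∑³-+ (λ x x′ y → ∑ l (λ t → ∑ l (λ t′ → bad x x′ t t′))) _) (cong₂ _+_
                (trans (∑-cong l λ x → trans (∑-cong l λ x′ → ∑-const l _) (∑-*ˡ l m _)) (∑-*ˡ l m _))
                (trans (∑-cong l λ x → trans (∑²-const l _) (cong (m *_) (∑-const l _)))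
                  (trans (∑-*ˡ l m _) (cong (m *_) (∑-*ˡ l m _))))))))))
        where
        ∑³-cong : ∀ {f g} → (∀ x y z → f x y z ≡ g x y z) → ∑³ f ≡ ∑³ g
        ∑³-cong h = ∑-cong l λ x → ∑-cong l λ y → ∑-cong l λ z → h x y z
        ∑²-const : ∀ (k : List A) (f : A → ℕ) → ∑[ x ∈ k ] ∑[ _ ∈ k ] f x ≡ length k * ∑ k f
        ∑²-const k f = trans (∑-cong k λ x → ∑-const k (f x)) (∑-*ˡ k (length k) f)

      Q S : ℕ
      Q = ∑³ λ x x′ y → ⟦ (W x ∧ W x′) ∧ (R y ∧ E x x′ y) ⟧
      S = ∑³ λ x y y′ → ⟦ W x ∧ ((R y ∧ R y′) ∧ E x y y′) ⟧

      W-L-edges : ℕ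
      W-L-edges = ∑[ x ∈ l ] ∑[ y ∈ l ] ⟦ (W x ∧ L y) ∧ G x y ⟧

      W-L-edges≤ : e * W-L-edges ≤ e * (# l L * σ) + B[w]
      W-L-edges≤ = begin
        e * W-L-edges                                ≤⟨ *-monoʳ-≤ e (∑-≤+ l λ x → ∑-≤+ l λ y → split x y) ⟩
        e * (_ + ∑[ x ∈ l ] ∑[ y ∈ l ] ⟦ ZL x y ⟧)  ≡⟨ *-distribˡ-+ e _ _ ⟩
        _                                            ≤⟨ +-mono-≤ (*-monoʳ-≤ e N-L-edges) Z-L-edges ⟩
        e * (# l L * σ) + B[w]                       ∎
        where
        open ≤-Reasoning
        split : ∀ x y → ⟦ (W x ∧ L y) ∧ G x y ⟧ ≤ ⟦ (N x ∧ L y) ∧ G x y ⟧ + ⟦ ZL x y ⟧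
        split x y = by-valuation 4 (λ { (n ∷ h ∷ o ∷ g ∷ []) → ⟦ ((n ∨ h) ∧ o) ∧ g ⟧ })
          (λ { (n ∷ h ∷ o ∷ g ∷ []) → ⟦ (n ∧ o) ∧ g ⟧ + ⟦ ((not n ∧ h) ∧ o) ∧ g ⟧ })
          (N x ∷ (τ ≤ᵇ c x) ∷ L y ∷ G x y ∷ [])

      Q≤core : Q ≤ m * (m * # l K) + m * W-L-edges + m * W-L-edges + ∑³ (λ x x′ y → ⟦ core x x′ y ⟧)
      Q≤core = ≤-trans
        (∑-≤+ l λ x → ∑-≤+ l λ x′ → ∑-≤+ l λ y → split x x′ y)
        (+-monoˡ-≤ _ (≤-reflexive (trans
          (∑³-+ (λ x x′ y → ⟦ K y ⟧ + ⟦ (W x ∧ L y) ∧ G x y ⟧) _) (cong₂ _+_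
            (trans (∑³-+ (λ x x′ y → ⟦ K y ⟧) _) (cong₂ _+_
              (trans (∑-const l _) (cong (m *_) (∑-const l _)))
              (trans (∑-cong l λ x → ∑-const l _) (∑-*ˡ l m _))))
            (∑-const l _)))))
        where
        split : ∀ x x′ y → ⟦ (W x ∧ W x′) ∧ (R y ∧ E x x′ y) ⟧ ≤
          ⟦ K y ⟧ + ⟦ (W x ∧ L y) ∧ G x y ⟧ + ⟦ (W x′ ∧ L y) ∧ G x′ y ⟧ + ⟦ core x x′ y ⟧
        split x x′ y = by-valuation 8
          (λ { (wx ∷ wx′ ∷ n ∷ h ∷ o ∷ g ∷ g′ ∷ t ∷ []) → ⟦ (wx ∧ wx′) ∧ (not (n ∨ h) ∧ t) ⟧ })
          (λ { (wx ∷ wx′ ∷ n ∷ h ∷ o ∷ g ∷ g′ ∷ t ∷ []) →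
            ⟦ not (n ∨ h) ∧ o ⟧ + ⟦ (wx ∧ (not n ∧ not o)) ∧ g ⟧ + ⟦ (wx′ ∧ (not n ∧ not o)) ∧ g′ ⟧
            + ⟦ ((wx ∧ wx′) ∧ (not n ∧ not o)) ∧ (not g ∧ not g′) ∧ t ⟧ })
          (W x ∷ W x′ ∷ N y ∷ (τ ≤ᵇ c y) ∷ (σ ≤ᵇ c y) ∷ G x y ∷ G x′ y ∷ E x x′ y ∷ [])

      -- The first bracket comes from K and from the link edges between N and L. Everything paid for
      -- by copies is collected in the second, where `e ≤ m` merges the different powers of `e`.
      Q-bound : e ≤ m → e * e * Q ≤
        e * e * (m * (m * # l K) + 2 * (m * (# l L * σ))) + (5 * (m * (m * B[w])) + 4 * (m * B))
      Q-bound e≤m = begin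
        e * e * Q
          ≤⟨ *-monoʳ-≤ (e * e) Q≤core ⟩
        e * e * (m * (m * # l K) + m * W-L-edges + m * W-L-edges + cores)
          ≡⟨ regroup e m (# l K) W-L-edges cores ⟩
        e * e * (m * (m * # l K)) + (e * m) * (2 * (e * W-L-edges)) + e * e * cores
          ≤⟨ +-mono-≤ (+-monoʳ-≤ (e * e * (m * (m * # l K))) (*-monoʳ-≤ (e * m) (*-monoʳ-≤ 2 W-L-edges≤))) cores≤ ⟩
        e * e * (m * (m * # l K)) + (e * m) * (2 * (e * (# l L * σ) + B[w]))
          + (e * e * B[w] + e * (m * B[w] + B) + ((m * B + m * B) + (m * B + m * (m * B[w]))))
          ≡⟨ regroup′ e m (# l K) (# l L * σ) B[w] B ⟩
        e * e * (m * (m * # l K) + 2 * (m * (# l L * σ)))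
          + (e * (3 * (m * B[w]) + B) + e * (e * B[w]) + (m * (m * B[w]) + 3 * (m * B)))
          ≤⟨ +-monoʳ-≤ (e * e * (m * (m * # l K) + 2 * (m * (# l L * σ))))
               (+-monoˡ-≤ (m * (m * B[w]) + 3 * (m * B))
                 (+-mono-≤ (*-monoˡ-≤ (3 * (m * B[w]) + B) e≤m) (*-mono-≤ e≤m (*-monoˡ-≤ B[w] e≤m)))) ⟩
        e * e * (m * (m * # l K) + 2 * (m * (# l L * σ)))
          + (m * (3 * (m * B[w]) + B) + m * (m * B[w]) + (m * (m * B[w]) + 3 * (m * B)))
          ≡⟨ cong (e * e * (m * (m * # l K) + 2 * (m * (# l L * σ))) +_) (collect m B[w] B) ⟩
        e * e * (m * (m * # l K) + 2 * (m * (# l L * σ))) + (5 * (m * (m * B[w])) + 4 * (m * B))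
          ∎
        where
        open ≤-Reasoning
        cores : ℕ
        cores = ∑³ λ x x′ y → ⟦ core x x′ y ⟧
        cores≤ : e * e * cores ≤
          e * e * B[w] + e * (m * B[w] + B) + ((m * B + m * B) + (m * B + m * (m * B[w])))
        cores≤ = ≤-trans
          (*∑-≤ l (e * e) λ x → *∑-≤ l (e * e) λ x′ → *∑-≤ l (e * e) λ y →
            *⟦⟧≤ (core x x′ y) (core≤witnesses x x′ y))
          (≤-reflexive ∑³-witnesses)
        regroup : ∀ e m k f u → e * e * (m * (m * k) + m * f + m * f + u) ≡
          e * e * (m * (m * k)) + (e * m) * (2 * (e * f)) + e * e * u
        regroup = solve-∀
        regroup′ : ∀ e m k s b d → e * e * (m * (m * k)) + (e * m) * (2 * (e * s + b))
          + (e * e * b + e * (m * b + d) + ((m * d + m * d) + (m * d + m * (m * b)))) ≡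
          e * e * (m * (m * k) + 2 * (m * s))
          + (e * (3 * (m * b) + d) + e * (e * b) + (m * (m * b) + 3 * (m * d)))
        regroup′ = solve-∀
        collect : ∀ m b d → m * (3 * (m * b) + d) + m * (m * b) + (m * (m * b) + 3 * (m * d)) ≡
          5 * (m * (m * b)) + 4 * (m * d)
        collect = solve-∀

      W-degree : A → A → ℕ
      W-degree y y′ = # l λ x → W x ∧ ((R y ∧ R y′) ∧ E x y y′)

      S≡ : S ≡ ∑[ y ∈ l ] ∑[ y′ ∈ l ] W-degree y y′
      S≡ = trans (∑-comm l l _) (∑-cong l λ y → ∑-comm l l _)

      -- A pair y , y′ ∈ R of W-degree f lies in f² quadruples x , x′ , y , y′ with two edges
      -- x y y′ and x′ y y′; unless there is a third edge, x x′ y or x x′ y′, such a quadruple is bad.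
      W-degree² : ∑[ y ∈ l ] ∑[ y′ ∈ l ] (W-degree y y′ * W-degree y y′) ≤ B + 2 * (# l R * Q)
      W-degree² = begin
        ∑[ y ∈ l ] ∑[ y′ ∈ l ] (W-degree y y′ * W-degree y y′)
          ≡⟨ ∑-cong l (λ y → ∑-cong l λ y′ → sym (∑-× l l _ _)) ⟩
        ∑[ y ∈ l ] ∑[ y′ ∈ l ] ∑[ x ∈ l ] ∑[ x′ ∈ l ] (g x y y′ * g x′ y y′)
          ≡⟨ ∑-cong l (λ y → trans (∑-comm l l _) (∑-cong l λ x → ∑-comm l l _)) ⟩
        ∑[ y ∈ l ] ∑[ x ∈ l ] ∑[ x′ ∈ l ] ∑[ y′ ∈ l ] (g x y y′ * g x′ y y′)
          ≡⟨ trans (∑-comm l l _) (∑-cong l λ x → ∑-comm l l _) ⟩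
        ∑[ x ∈ l ] ∑[ x′ ∈ l ] ∑[ y ∈ l ] ∑[ y′ ∈ l ] (g x y y′ * g x′ y y′)
          ≤⟨ (∑-≤+ l λ x → ∑-≤+ l λ x′ → ∑-≤+ l λ y → ∑-≤+ l λ y′ → split x x′ y y′) ⟩
        B + ∑³ (λ x x′ y → ∑[ y′ ∈ l ] (⟦ R y′ ⟧ * q x x′ y + ⟦ R y ⟧ * q x x′ y′))
          ≡⟨ cong (B +_) (∑-cong l λ x → ∑-cong l λ x′ → trans
               (∑-cong l λ y → trans (∑-+ l (λ y′ → ⟦ R y′ ⟧ * q x x′ y) _)
                 (cong₂ _+_ (∑-*ʳ l (q x x′ y) (⟦_⟧ ∘ R)) (∑-*ˡ l ⟦ R y ⟧ (q x x′))))
               (trans (∑-+ l (λ y → # l R * q x x′ y) _)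
                 (cong₂ _+_ (∑-*ˡ l (# l R) (q x x′)) (∑-*ʳ l _ (⟦_⟧ ∘ R))))) ⟩
        B + ∑[ x ∈ l ] ∑[ x′ ∈ l ] (# l R * ∑ l (q x x′) + # l R * ∑ l (q x x′))
          ≡⟨ cong (B +_) (trans
               (∑-cong l λ x → trans (∑-+ l (λ x′ → # l R * ∑ l (q x x′)) _)
                 (cong₂ _+_ (∑-*ˡ l (# l R) _) (∑-*ˡ l (# l R) _)))
               (trans (∑-+ l (λ x → # l R * ∑ l (λ x′ → ∑ l (q x x′))) _)
                 (cong₂ _+_ (∑-*ˡ l (# l R) _) (∑-*ˡ l (# l R) _)))) ⟩
        B + (# l R * Q + # l R * Q)
          ≡⟨ cong (λ k → B + (# l R * Q + k)) (+-identityʳ _) ⟨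
        B + 2 * (# l R * Q)
          ∎
        where
        open ≤-Reasoning
        g : A → A → A → ℕ
        g x y y′ = ⟦ W x ∧ ((R y ∧ R y′) ∧ E x y y′) ⟧
        q : A → A → A → ℕ
        q x x′ y = ⟦ (W x ∧ W x′) ∧ (R y ∧ E x x′ y) ⟧
        split : ∀ x x′ y y′ → g x y y′ * g x′ y y′ ≤
          bad x x′ y y′ + (⟦ R y′ ⟧ * q x x′ y + ⟦ R y ⟧ * q x x′ y′)
        split x x′ y y′ = ≤-trans
          (by-valuation 8
            (λ { (wx ∷ wx′ ∷ ry ∷ ry′ ∷ a ∷ b ∷ c ∷ d ∷ []) →
              ⟦ wx ∧ ((ry ∧ ry′) ∧ c) ⟧ * ⟦ wx′ ∧ ((ry ∧ ry′) ∧ d) ⟧ })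
            (λ { (wx ∷ wx′ ∷ ry ∷ ry′ ∷ a ∷ b ∷ c ∷ d ∷ []) →
              two a b c d + (⟦ ry′ ⟧ * ⟦ (wx ∧ wx′) ∧ (ry ∧ a) ⟧ + ⟦ ry ⟧ * ⟦ (wx ∧ wx′) ∧ (ry′ ∧ b) ⟧) })
            (W x ∷ W x′ ∷ R y ∷ R y′ ∷ E x x′ y ∷ E x x′ y′ ∷ E x y y′ ∷ E x′ y y′ ∷ []))
          (+-monoˡ-≤ _ (m≤n+m _ (D₂ E v x x′ y + D₂ E v x x′ y′ + D₂ E v x y y′ + D₂ E v x′ y y′)))

      -- Cauchy-Schwarz in the form 2 |W| (k f) ≤ |W|² + (k f)², summed over the pairs in R with `f`
      -- their W-degree; this avoids roots and division, and leaves `k` to be chosen by the caller.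
      S-bound : ∀ k → 2 * (k * (# l W * S)) ≤
        (# l R * # l R) * (# l W * # l W) + k * k * (B + 2 * (# l R * Q))
      S-bound k = begin
        2 * (k * (# l W * S))
          ≡⟨ trans (cong (λ s → 2 * (k * (# l W * s))) S≡) (assoc k (# l W) _) ⟩
        2 * (k * # l W) * (∑[ y ∈ l ] ∑[ y′ ∈ l ] W-degree y y′)
          ≤⟨ *∑-≤ l (2 * (k * # l W)) (λ y → *∑-≤ l (2 * (k * # l W)) λ y′ → am-gm y y′) ⟩
        ∑[ y ∈ l ] ∑[ y′ ∈ l ] (⟦ R y ⟧ * ⟦ R y′ ⟧ * (# l W * # l W) + k * k * (W-degree y y′ * W-degree y y′))
          ≡⟨ ∑-cong l (λ y → trans (∑-+ l (λ y′ → ⟦ R y ⟧ * ⟦ R y′ ⟧ * (# l W * # l W)) _)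
               (cong₂ _+_ (∑-*ʳ l _ _) (∑-*ˡ l (k * k) _))) ⟩
        ∑[ y ∈ l ] ((∑[ y′ ∈ l ] (⟦ R y ⟧ * ⟦ R y′ ⟧)) * (# l W * # l W) + k * k * (∑[ y′ ∈ l ] (W-degree y y′ * W-degree y y′)))
          ≡⟨ trans (∑-+ l (λ y → (∑[ y′ ∈ l ] (⟦ R y ⟧ * ⟦ R y′ ⟧)) * (# l W * # l W)) _)
               (cong₂ _+_ (trans (∑-*ʳ l _ _) (cong (_* (# l W * # l W)) (∑-× l l _ _))) (∑-*ˡ l (k * k) _)) ⟩
        (# l R * # l R) * (# l W * # l W) + k * k * (∑[ y ∈ l ] ∑[ y′ ∈ l ] (W-degree y y′ * W-degree y y′))
          ≤⟨ +-monoʳ-≤ ((# l R * # l R) * (# l W * # l W)) (*-monoʳ-≤ (k * k) W-degree²) ⟩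
        (# l R * # l R) * (# l W * # l W) + k * k * (B + 2 * (# l R * Q))
          ∎
        where
        open ≤-Reasoning
        assoc : ∀ k w s → 2 * (k * (w * s)) ≡ 2 * (k * w) * s
        assoc = solve-∀
        rearrange : ∀ k w f → 2 * (k * w) * f ≡ 2 * (w * (k * f))
        rearrange = solve-∀
        square : ∀ w k f → w * w + (k * f) * (k * f) ≡ 1 * 1 * (w * w) + k * k * (f * f)
        square = solve-∀
        am-gm : ∀ y y′ → 2 * (k * # l W) * W-degree y y′ ≤
          ⟦ R y ⟧ * ⟦ R y′ ⟧ * (# l W * # l W) + k * k * (W-degree y y′ * W-degree y y′)
        am-gm y y′ with R y | R y′
        ... | true  | true  = ≤-trans (≤-reflexive (rearrange k (# l W) _))
          (≤-trans (2ab≤a²+b² (# l W) _) (≤-reflexive (square (# l W) k _)))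
        ... | true  | false = ≤-trans (≤-reflexive (trans (cong (2 * (k * # l W) *_) zero-degree) (*-zeroʳ (2 * (k * # l W))))) z≤n
          where
          zero-degree : ∑[ x ∈ l ] ⟦ W x ∧ false ⟧ ≡ 0
          zero-degree = trans (∑-cong l λ x → cong ⟦_⟧ (∧-zeroʳ (W x))) (∑-0 l)
        ... | false | _     = ≤-trans (≤-reflexive (trans (cong (2 * (k * # l W) *_) zero-degree) (*-zeroʳ (2 * (k * # l W))))) z≤n
          where
          zero-degree : ∑[ x ∈ l ] ⟦ W x ∧ false ⟧ ≡ 0
          zero-degree = trans (∑-cong l λ x → cong ⟦_⟧ (∧-zeroʳ (W x))) (∑-0 l)

    -- Pigeonhole: the windows [ θ + i e , θ + (i + 1) e ) are disjoint.
    window : ∀ θ e g → 1 ≤ g → ∃[ i ] (i ≤ g × g * # l (Threshold.K (θ + i * e) e) ≤ m)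
    window θ e g 1≤g with search g
      where
      K : ℕ → A → Bool
      K i = Threshold.K (θ + i * e) e
      above : ℕ → ℕ
      above i = # l (λ y → θ + i * e ≤ᵇ c y)

      telescope : ∀ i → # l (K i) + above (suc i) ≤ above i
      telescope i = ≤-trans (≤-reflexive (sym (∑-+ l _ _))) (∑-mono l pointwise)
        where
        next : θ + (e + i * e) ≡ θ + i * e + e
        next = trans (cong (θ +_) (+-comm e (i * e))) (sym (+-assoc θ (i * e) e))
        pointwise : ∀ y → ⟦ K i y ⟧ + ⟦ θ + suc i * e ≤ᵇ c y ⟧ ≤ ⟦ θ + i * e ≤ᵇ c y ⟧
        pointwise y rewrite next with N y | θ + i * e + e ≤ᵇ c y in p | θ + i * e ≤ᵇ c y in q
        ... | false | false | false = z≤n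
        ... | false | false | true  = ≤-refl
        ... | true  | false | false = z≤n
        ... | true  | false | true  = z≤n
        ... | false | true  | true  = ≤-refl
        ... | true  | true  | true  = ≤-refl
        ... | _     | true  | false = ⊥-elim (<-irrefl refl
          (<-≤-trans (≤ᵇ-false {θ + i * e} {c y} q)
            (≤-trans (m≤m+n (θ + i * e) e) (≤ᵇ-true {θ + i * e + e} {c y} p))))

      -- A search that has failed `h` times has found more than m / g vertices in each of the first
      -- `h` disjoint windows; at `h = g` this exceeds the total.
      search : ∀ h → (∃[ i ] (i ≤ h × g * # l (K i) ≤ m)) ⊎ h * suc m + g * above h ≤ g * above 0
      search zero    = inj₂ ≤-refl
      search (suc h) with search h
      ... | inj₁ (i , i≤h , small) = inj₁ (i , m≤n⇒m≤1+n i≤h , small)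
      ... | inj₂ bound with g * # l (K h) ≤? m
      ...   | yes small = inj₁ (h , n≤1+n h , small)
      ...   | no  large = inj₂ (begin
        suc h * suc m + g * above (suc h)                  ≡⟨ regroup h (suc m) (g * above (suc h)) ⟩
        h * suc m + (suc m + g * above (suc h))            ≤⟨ +-monoʳ-≤ (h * suc m) (+-monoˡ-≤ _ (≰⇒> large)) ⟩
        h * suc m + (g * # l (K h) + g * above (suc h))    ≡⟨ cong (h * suc m +_) (*-distribˡ-+ g _ _) ⟨
        h * suc m + g * (# l (K h) + above (suc h))        ≤⟨ +-monoʳ-≤ (h * suc m) (*-monoʳ-≤ g (telescope h)) ⟩
        h * suc m + g * above h                            ≤⟨ bound ⟩
        g * above 0                                        ∎)
        where
        open ≤-Reasoning
        regroup : ∀ h k a → (k + h * k) + a ≡ h * k + (k + a)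
        regroup = solve-∀
    ... | inj₁ found = found
    ... | inj₂ bound = ⊥-elim (<-irrefl refl (<-≤-trans
      (*-monoʳ-< g {{>-nonZero 1≤g}} (n<1+n m))
      (≤-trans (m≤m+n (g * suc m) _) (≤-trans bound (*-monoʳ-≤ g (#≤length l _))))))

  -- Decompositions, and splitting off vertices with sparse links.

  complement : {A : Set} → (A → A → A → Bool) → A → A → A → Bool
  complement E x y z = not (E x y z)

  -- `b` is the prevailing value, since `xor b` marks the exceptions. In `cut` only triples with
  -- first vertex in `P` and second outside are counted; every crossing triple can be so ordered.
  -- Both sides are nonempty, so that a recursion makes progress.
  data Decomposition {A : Set} (l : List A) (E : A → A → A → Bool) (p : ℕ) : Set where
    leaf : ∀ b →
      p * (∑[ x ∈ l ] ∑[ y ∈ l ] ∑[ z ∈ l ] ⟦ E x y z xor b ⟧) ≤ length l * (length l * length l) →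
      Decomposition l E p
    cut  : ∀ b (P : A → Bool) → 1 ≤ # l P → 1 ≤ # l (not ∘ P) →
      p * (∑[ x ∈ l ] ∑[ y ∈ l ] ∑[ z ∈ l ] ⟦ (P x ∧ not (P y)) ∧ (E x y z xor b) ⟧) ≤
        # l P * # l (not ∘ P) * length l →
      Decomposition l E p

  module _ {A : Set} (l : List A) (E : A → A → A → Bool) where

    private
      m : ℕ
      m = length l

      not-xor : ∀ a b → not a xor b ≡ a xor not b
      not-xor a b = trans (sym (not-distribˡ-xor a b)) (not-distribʳ-xor a b)

      ∑³-cong : ∀ {f g : A → A → A → ℕ} → (∀ x y z → f x y z ≡ g x y z) →
        ∑[ x ∈ l ] ∑[ y ∈ l ] ∑[ z ∈ l ] f x y z ≡ ∑[ x ∈ l ] ∑[ y ∈ l ] ∑[ z ∈ l ] g x y z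
      ∑³-cong h = ∑-cong l λ x → ∑-cong l λ y → ∑-cong l λ z → h x y z

    decomposition-complement : ∀ {p} → Decomposition l (complement E) p → Decomposition l E p
    decomposition-complement {p} (leaf b bound) = leaf (not b)
      (≤-trans (≤-reflexive (cong (p *_) (∑³-cong λ x y z → cong ⟦_⟧ (sym (not-xor (E x y z) b))))) bound)
    decomposition-complement {p} (cut b P 1≤P 1≤¬P bound) = cut (not b) P 1≤P 1≤¬P
      (≤-trans (≤-reflexive (cong (p *_) (∑³-cong λ x y z →
        cong (λ e → ⟦ (P x ∧ not (P y)) ∧ e ⟧) (sym (not-xor (E x y z) b))))) bound)

    link-size : A → ℕ
    link-size x = ∑[ y ∈ l ] ∑[ z ∈ l ] ⟦ E x y z ⟧

    module _ (p : ℕ) where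

      sparse : A → Bool
      sparse x = p * p * p * link-size x ≤ᵇ m * m

      private
        sparse-links : p * p * p * (∑[ x ∈ l ] (⟦ sparse x ⟧ * link-size x)) ≤ # l sparse * (m * m)
        sparse-links = ≤-trans (*∑-≤ l (p * p * p) {g = λ x → ⟦ sparse x ⟧ * (m * m)} pointwise)
          (≤-reflexive (∑-*ʳ l (m * m) (⟦_⟧ ∘ sparse)))
          where
          pointwise : ∀ x → p * p * p * (⟦ sparse x ⟧ * link-size x) ≤ ⟦ sparse x ⟧ * (m * m)
          pointwise x with sparse x in s
          ... | false = ≤-reflexive (*-zeroʳ (p * p * p))
          ... | true  = ≤-trans (≤-reflexive (cong (p * p * p *_) (+-identityʳ (link-size x))))
            (≤-trans (≤ᵇ-true s) (≤-reflexive (sym (+-identityʳ (m * m)))))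

      -- An exceptional crossing triple lies in the link of its sparse first vertex, so there are at
      -- most |sparse| m² / p³ of them. This suffices for a cut if at least m / p² vertices are not
      -- sparse; otherwise so few vertices remain that the whole set spans few edges.
      sparse-decomposition : 2 ≤ p → 1 ≤ # l sparse → Decomposition l E p
      sparse-decomposition 2≤p 1≤s with m ≤? p * p * # l (not ∘ sparse)
      ... | yes m≤ = cut false sparse 1≤s
          (≮⇒≥ λ none → <-irrefl refl (<-≤-trans 1≤s (≤-trans (#≤length l sparse)
            (≤-trans m≤ (≤-reflexive (trans (cong (p * p *_) (n<1⇒n≡0 none)) (*-zeroʳ (p * p))))))))
          (*-cancelˡ-≤ (p * p) {{>-nonZero (*-mono-≤ (<⇒≤ 2≤p) (<⇒≤ 2≤p))}} (begin
            p * p * (p * crossing)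
              ≡⟨ *-assoc (p * p) p crossing ⟨
            p * p * p * crossing
              ≤⟨ *-monoʳ-≤ (p * p * p) crossing≤ ⟩
            p * p * p * (∑[ x ∈ l ] (⟦ sparse x ⟧ * link-size x))
              ≤⟨ sparse-links ⟩
            # l sparse * (m * m)
              ≤⟨ *-monoʳ-≤ (# l sparse) (*-monoˡ-≤ m m≤) ⟩
            # l sparse * (p * p * # l (not ∘ sparse) * m)
              ≡⟨ regroup (# l sparse) (p * p) (# l (not ∘ sparse)) m ⟩
            p * p * (# l sparse * # l (not ∘ sparse) * m)
              ∎))
        where
        open ≤-Reasoning
        regroup : ∀ s q r m → s * (q * r * m) ≡ q * (s * r * m)
        regroup = solve-∀
        crossing : ℕ
        crossing = ∑[ x ∈ l ] ∑[ y ∈ l ] ∑[ z ∈ l ] ⟦ (sparse x ∧ not (sparse y)) ∧ (E x y z xor false) ⟧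
        crossing≤ : crossing ≤ ∑[ x ∈ l ] (⟦ sparse x ⟧ * link-size x)
        crossing≤ = ∑-mono l λ x → ≤-trans
          (∑-mono l λ y → ≤-trans
            (∑-mono l λ z → by-valuation 3 (λ { (s ∷ s′ ∷ e ∷ []) → ⟦ (s ∧ not s′) ∧ (e xor false) ⟧ })
              (λ { (s ∷ s′ ∷ e ∷ []) → ⟦ s ⟧ * ⟦ e ⟧ }) (sparse x ∷ sparse y ∷ E x y z ∷ []))
            (≤-reflexive (∑-*ˡ l ⟦ sparse x ⟧ _)))
          (≤-reflexive (∑-*ˡ l ⟦ sparse x ⟧ _))
      ... | no m≰ = leaf false (*-cancelˡ-≤ (p * p) {{>-nonZero (*-mono-≤ (<⇒≤ 2≤p) (<⇒≤ 2≤p))}} (begin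
          p * p * (p * total)
            ≡⟨ *-assoc (p * p) p total ⟨
          p * p * p * total
            ≤⟨ *-monoʳ-≤ (p * p * p) total≤ ⟩
          p * p * p * (∑[ x ∈ l ] (⟦ sparse x ⟧ * link-size x) + # l (not ∘ sparse) * (m * m))
            ≡⟨ *-distribˡ-+ (p * p * p) _ _ ⟩
          p * p * p * (∑[ x ∈ l ] (⟦ sparse x ⟧ * link-size x)) + p * p * p * (# l (not ∘ sparse) * (m * m))
            ≤⟨ +-mono-≤ (≤-trans sparse-links (*-monoˡ-≤ (m * m) (#≤length l sparse)))
                 (≤-trans (≤-reflexive (regroup p (# l (not ∘ sparse)) (m * m)))
                   (*-monoʳ-≤ p (*-monoˡ-≤ (m * m) (<⇒≤ (≰⇒> m≰))))) ⟩
          m * (m * m) + p * (m * (m * m))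
            ≤⟨ *-monoˡ-≤ (m * (m * m)) (≤-trans (+-monoˡ-≤ p (<⇒≤ 2≤p))
                 (≤-trans (≤-reflexive (cong (p +_) (sym (+-identityʳ p)))) (*-monoˡ-≤ p 2≤p))) ⟩
          p * p * (m * (m * m))
            ∎))
        where
        open ≤-Reasoning
        regroup : ∀ p r k → p * p * p * (r * k) ≡ p * (p * p * r * k)
        regroup = solve-∀
        total : ℕ
        total = ∑[ x ∈ l ] ∑[ y ∈ l ] ∑[ z ∈ l ] ⟦ E x y z xor false ⟧
        total≤ : total ≤ ∑[ x ∈ l ] (⟦ sparse x ⟧ * link-size x) + # l (not ∘ sparse) * (m * m)
        total≤ = ≤-trans (∑-≤+ l λ x → ≤-trans
            (≤-reflexive (∑-cong l λ y → ∑-cong l λ z → cong ⟦_⟧ (xor-identityʳ (E x y z)))) (by-sparsity x))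
          (≤-reflexive (cong ((∑[ x ∈ l ] (⟦ sparse x ⟧ * link-size x)) +_) (∑-*ʳ l (m * m) _)))
          where
          by-sparsity : ∀ x → link-size x ≤ ⟦ sparse x ⟧ * link-size x + ⟦ not (sparse x) ⟧ * (m * m)
          by-sparsity x with sparse x
          ... | true  = ≤-trans (≤-reflexive (sym (+-identityʳ (link-size x)))) (m≤m+n _ 0)
          ... | false = ≤-trans (∑-≤const l m λ y → #≤length l (E x y)) (≤-reflexive (sym (+-identityʳ (m * m))))

  -- Vertices of intermediate degree in a graph that is neither sparse nor co-sparse.

  module Middle {A : Set} (l : List A) (G : A → A → Bool) (G-sym : ∀ x y → G x y ≡ G y x)
                (p : ℕ) (3≤p : 3 ≤ p) (1≤m : 1 ≤ length l)
                (κ : ℕ) (κ≡ : κ ≡ (p * p * p) * (p * p * p) * (p * p * p)) where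

    private
      m p³ p⁴ : ℕ
      m = length l
      p³ = p * p * p
      p⁴ = p³ * p

      1≤p : 1 ≤ p
      1≤p = ≤-trans (s≤s z≤n) 3≤p
      1≤p³ : 1 ≤ p³
      1≤p³ = *-mono-≤ (*-mono-≤ 1≤p 1≤p) 1≤p

    degree co-degree : A → ℕ
    degree    x = # l (G x)
    co-degree x = # l (not ∘ G x)

    middle few many : A → Bool
    middle x = (m ≤ᵇ κ * degree x) ∧ (m ≤ᵇ κ * co-degree x)
    few  x = not (m ≤ᵇ κ * degree x)
    many x = not (m ≤ᵇ κ * co-degree x)

    -- A pair from `few` and `many` is charged to the small degree of the first vertex if adjacent,
    -- and to the small co-degree of the second if not.
    few-or-many : # l few * # l many * κ ≤ 2 * (m * m)
    few-or-many = begin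
      # l few * # l many * κ
        ≡⟨ *-comm (# l few * # l many) κ ⟩
      κ * (# l few * # l many)
        ≡⟨ cong (κ *_) (∑-× l l _ _) ⟨
      κ * (∑[ x ∈ l ] ∑[ z ∈ l ] (⟦ few x ⟧ * ⟦ many z ⟧))
        ≤⟨ *-monoʳ-≤ κ (∑-≤+ l λ x → ∑-≤+ l λ z → pointwise x z) ⟩
      κ * (∑[ x ∈ l ] ∑[ z ∈ l ] (⟦ few x ⟧ * ⟦ G x z ⟧) + ∑[ x ∈ l ] ∑[ z ∈ l ] (⟦ many z ⟧ * ⟦ not (G z x) ⟧))
        ≡⟨ *-distribˡ-+ κ _ _ ⟩
      κ * (∑[ x ∈ l ] ∑[ z ∈ l ] (⟦ few x ⟧ * ⟦ G x z ⟧)) + κ * (∑[ x ∈ l ] ∑[ z ∈ l ] (⟦ many z ⟧ * ⟦ not (G z x) ⟧))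
        ≡⟨ cong₂ _+_ (cong (κ *_) (∑-cong l λ x → ∑-*ˡ l ⟦ few x ⟧ _))
             (cong (κ *_) (trans (∑-comm l l _) (∑-cong l λ z → ∑-*ˡ l ⟦ many z ⟧ _))) ⟩
      κ * (∑[ x ∈ l ] (⟦ few x ⟧ * degree x)) + κ * (∑[ z ∈ l ] (⟦ many z ⟧ * co-degree z))
        ≤⟨ +-mono-≤ (≤-trans (*∑-≤ l κ {g = λ _ → m} λ x → small (degree x)) (≤-reflexive (∑-const l m)))
             (≤-trans (*∑-≤ l κ {g = λ _ → m} λ x → small (co-degree x)) (≤-reflexive (∑-const l m))) ⟩
      m * m + m * m
        ≡⟨ cong (m * m +_) (+-identityʳ (m * m)) ⟨
      2 * (m * m)
        ∎
      where
      open ≤-Reasoning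
      small : ∀ d → κ * (⟦ not (m ≤ᵇ κ * d) ⟧ * d) ≤ m
      small d with m ≤ᵇ κ * d in eq
      ... | true  = ≤-trans (≤-reflexive (*-zeroʳ κ)) z≤n
      ... | false = ≤-trans (≤-reflexive (cong (κ *_) (+-identityʳ d))) (<⇒≤ (≤ᵇ-false {m} eq))
      pointwise : ∀ x z → ⟦ few x ⟧ * ⟦ many z ⟧ ≤ ⟦ few x ⟧ * ⟦ G x z ⟧ + ⟦ many z ⟧ * ⟦ not (G z x) ⟧
      pointwise x z rewrite G-sym z x = by-valuation 3 (λ { (a ∷ b ∷ g ∷ []) → ⟦ a ⟧ * ⟦ b ⟧ })
        (λ { (a ∷ b ∷ g ∷ []) → ⟦ a ⟧ * ⟦ g ⟧ + ⟦ b ⟧ * ⟦ not g ⟧ }) (few x ∷ many z ∷ G x z ∷ [])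

    private
      -- f and g are the two degree functions, in either order.
      sparse-if : ∀ (f g : A → ℕ) → (∀ x → f x ≤ m) →
        (∀ x → middle x ≡ false → κ * f x < m ⊎ (m ≤ᵇ κ * g x) ≡ false) →
        κ * # l middle < m → p⁴ * # l (λ x → not (m ≤ᵇ κ * g x)) ≤ m → p³ * ∑ l f ≤ m * m
      sparse-if f g f≤m cover few-middle few-g = *-cancelˡ-≤ (p³ * p³) {{>-nonZero (*-mono-≤ 1≤p³ 1≤p³)}} (begin
        p³ * p³ * (p³ * ∑ l f)
          ≡⟨ trans (cong (_* ∑ l f) κ≡) (*-assoc (p³ * p³) p³ (∑ l f)) ⟨
        κ * ∑ l f
          ≤⟨ *∑-≤ l κ {g = λ x → κ * ⟦ middle x ⟧ * m + κ * ⟦ bad x ⟧ * m + m} pointwise ⟩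
        ∑[ x ∈ l ] (κ * ⟦ middle x ⟧ * m + κ * ⟦ bad x ⟧ * m + m)
          ≡⟨ trans (∑-+ l (λ x → κ * ⟦ middle x ⟧ * m + κ * ⟦ bad x ⟧ * m) (λ _ → m)) (cong₂ _+_
               (trans (∑-+ l (λ x → κ * ⟦ middle x ⟧ * m) _) (cong₂ _+_
                 (trans (∑-*ʳ l m _) (cong (_* m) (∑-*ˡ l κ _)))
                 (trans (∑-*ʳ l m _) (cong (_* m) (∑-*ˡ l κ _)))))
               (∑-const l m)) ⟩
        κ * # l middle * m + κ * # l bad * m + m * m
          ≤⟨ +-monoˡ-≤ (m * m) (+-mono-≤ (*-monoˡ-≤ m (<⇒≤ few-middle))
               (≤-trans (≤-reflexive (trans (cong (λ k → k * # l bad * m) κ≡) (regroup p (# l bad) m))) (*-monoʳ-≤ (p³ * (p * p)) (*-monoˡ-≤ m few-g)))) ⟩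
        m * m + p³ * (p * p) * (m * m) + m * m
          ≡⟨ collect (p³ * (p * p)) (m * m) ⟩
        (2 + p³ * (p * p)) * (m * m)
          ≤⟨ *-monoˡ-≤ (m * m) powers ⟩
        p³ * p³ * (m * m)
          ∎)
        where
        open ≤-Reasoning
        bad : A → Bool
        bad x = not (m ≤ᵇ κ * g x)
        regroup : ∀ p r m → (p * p * p) * (p * p * p) * (p * p * p) * r * m ≡
          (p * p * p) * (p * p) * ((p * p * p) * p * r * m)
        regroup = solve-∀
        collect : ∀ q k → k + q * k + k ≡ (2 + q) * k
        collect = solve-∀
        1≤p⁵ : 1 ≤ p³ * (p * p)
        1≤p⁵ = *-mono-≤ 1≤p³ (*-mono-≤ 1≤p 1≤p)
        powers : 2 + p³ * (p * p) ≤ p³ * p³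
        powers = begin
          2 + p³ * (p * p)                               ≤⟨ +-monoˡ-≤ _ (*-monoʳ-≤ 2 1≤p⁵) ⟩
          2 * (p³ * (p * p)) + p³ * (p * p)              ≡⟨ thrice (p³ * (p * p)) ⟩
          3 * (p³ * (p * p))                             ≤⟨ *-monoˡ-≤ (p³ * (p * p)) 3≤p ⟩
          p * (p³ * (p * p))                             ≡⟨ sixth p ⟩
          p³ * p³                                        ∎
          where
          thrice : ∀ k → 2 * k + k ≡ 3 * k
          thrice = solve-∀
          sixth : ∀ p → p * (p * p * p * (p * p)) ≡ p * p * p * (p * p * p)
          sixth = solve-∀
        pointwise : ∀ x → κ * f x ≤ κ * ⟦ middle x ⟧ * m + κ * ⟦ bad x ⟧ * m + m
        pointwise x with decide (middle x)
        ... | inj₁ mid rewrite mid = begin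
          κ * f x                                ≤⟨ *-monoʳ-≤ κ (f≤m x) ⟩
          κ * m                                  ≡⟨ cong (_* m) (*-identityʳ κ) ⟨
          κ * 1 * m                              ≤⟨ m≤m+n _ (κ * ⟦ bad x ⟧ * m) ⟩
          κ * 1 * m + κ * ⟦ bad x ⟧ * m          ≤⟨ m≤m+n _ m ⟩
          κ * 1 * m + κ * ⟦ bad x ⟧ * m + m      ∎
        ... | inj₂ ¬mid with cover x ¬mid
        ...   | inj₁ κf<m = ≤-trans (<⇒≤ κf<m) (m≤n+m m _)
        ...   | inj₂ g-small rewrite g-small = begin
          κ * f x                                ≤⟨ *-monoʳ-≤ κ (f≤m x) ⟩
          κ * m                                  ≡⟨ cong (_* m) (*-identityʳ κ) ⟨
          κ * 1 * m                              ≤⟨ m≤n+m _ (κ * ⟦ middle x ⟧ * m) ⟩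
          κ * ⟦ middle x ⟧ * m + κ * 1 * m       ≤⟨ m≤m+n _ m ⟩
          κ * ⟦ middle x ⟧ * m + κ * 1 * m + m   ∎

    -- With few middle vertices almost every vertex is in `few` or `many`. If one of these classes
    -- has at most m / p⁴ members, the density or the co-density is below 1 / p³. If both are
    -- larger, `few-or-many` fails, because κ = p · p⁴ · p⁴ and p > 2; hence the ninth power.
    many-middle : m * m < p³ * ∑ l degree → m * m < p³ * ∑ l co-degree → m ≤ κ * # l middle
    many-middle dense co-dense = ≮⇒≥ absurd
      where
      open ≤-Reasoning
      many-cover : ∀ x → middle x ≡ false → κ * degree x < m ⊎ (m ≤ᵇ κ * co-degree x) ≡ false
      many-cover x ¬mid with m ≤ᵇ κ * degree x in d | m ≤ᵇ κ * co-degree x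
      ... | false | _     = inj₁ (≤ᵇ-false {m} {κ * degree x} d)
      ... | true  | false = inj₂ refl
      few-cover : ∀ x → middle x ≡ false → κ * co-degree x < m ⊎ (m ≤ᵇ κ * degree x) ≡ false
      few-cover x ¬mid with m ≤ᵇ κ * degree x | m ≤ᵇ κ * co-degree x in d
      ... | false | _     = inj₂ refl
      ... | true  | false = inj₁ (≤ᵇ-false {m} {κ * co-degree x} d)
      absurd : κ * # l middle < m → _
      absurd few-middle with p⁴ * # l many ≤? m | p⁴ * # l few ≤? m
      ... | yes ≤m | _ = <-irrefl refl (<-≤-trans dense
        (sparse-if degree co-degree (λ x → #≤length l (G x)) many-cover few-middle ≤m))
      ... | no _ | yes ≤m = <-irrefl refl (<-≤-trans co-dense
        (sparse-if co-degree degree (λ x → #≤length l (not ∘ G x)) few-cover few-middle ≤m))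
      ... | no ≰m | no ≰m′ = <-irrefl refl (begin-strict
        2 * (m * m)
          <⟨ *-monoˡ-< (m * m) {{>-nonZero (*-mono-≤ 1≤m 1≤m)}} 3≤p ⟩
        p * (m * m)
          ≤⟨ *-monoʳ-≤ p (*-mono-≤ (<⇒≤ (≰⇒> ≰m′)) (<⇒≤ (≰⇒> ≰m))) ⟩
        p * ((p⁴ * # l few) * (p⁴ * # l many))
          ≡⟨ trans (regroup p (# l few) (# l many)) (cong (# l few * # l many *_) (sym κ≡)) ⟩
        # l few * # l many * κ
          ≤⟨ few-or-many ⟩
        2 * (m * m)
          ∎)
        where
        regroup : ∀ p a b → p * ((p * p * p * p * a) * (p * p * p * p * b)) ≡
          a * b * ((p * p * p) * (p * p * p) * (p * p * p))
        regroup = solve-∀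

  -- Here w and r are the sizes of W and R, and q, s, d the values of Q, S, B.
  cut-arithmetic : ∀ p κ b m w r q s d → 1 ≤ p → 1 ≤ w → 1 ≤ κ → r ≤ m →
    m ≤ κ * w → 112 * (κ * κ * (p * p)) ≤ b →
    b * q ≤ 7 * (r * (m * m)) → b * d ≤ r * (m * (m * m)) →
    2 * ((2 * p) * (w * s)) ≤ (r * r) * (w * w) + (2 * p) * (2 * p) * (d + 2 * (r * q)) →
    p * (s + q) ≤ w * r * m
  cut-arithmetic p κ b m w r q s d 1≤p 1≤w 1≤κ r≤m m≤κw b-large bq bd s-bound =
    *-cancelˡ-≤ 2 (begin
      2 * (p * (s + q))            ≡⟨ expand p s q ⟩
      2 * p * s + 2 * p * q        ≤⟨ +-mono-≤ s≤ q≤ ⟩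
      w * r * m + w * r * m        ≡⟨ cong (w * r * m +_) (+-identityʳ (w * r * m)) ⟨
      2 * (w * r * m)              ∎)
    where
    expand : ∀ p s q → 2 * (p * (s + q)) ≡ 2 * p * s + 2 * p * q
    expand = solve-∀
    instance
      w≢0 : NonZero w
      w≢0 = >-nonZero 1≤w
      κκ≢0 : NonZero (κ * κ)
      κκ≢0 = >-nonZero (*-mono-≤ 1≤κ 1≤κ)
      7κ≢0 : NonZero (7 * κ)
      7κ≢0 = >-nonZero (*-mono-≤ {1} {7} (s≤s z≤n) 1≤κ)
      7κκ≢0 : NonZero (7 * (κ * κ))
      7κκ≢0 = >-nonZero (*-mono-≤ {1} {7} (s≤s z≤n) (*-mono-≤ 1≤κ 1≤κ))
    X : ℕ
    X = w * (w * r * m)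
    square : ∀ k w r m → k * w * (k * w) * (r * m) ≡ k * k * (w * (w * r * m))
    square = solve-∀
    m²rm≤ : m * m * (r * m) ≤ κ * κ * X
    m²rm≤ = ≤-trans (*-monoˡ-≤ (r * m) (*-mono-≤ m≤κw m≤κw)) (≤-reflexive (square κ w r m))
    term₁ : (r * r) * (w * w) ≤ X
    term₁ = ≤-trans (*-monoˡ-≤ (w * w) (*-monoʳ-≤ r r≤m)) (≤-reflexive (shape w r m))
      where
      shape : ∀ w r m → r * m * (w * w) ≡ w * (w * r * m)
      shape = solve-∀
    term₂ : 8 * (p * p * d) ≤ X
    term₂ = *-cancelˡ-≤ (κ * κ) (begin
      κ * κ * (8 * (p * p * d))          ≡⟨ shape κ p d ⟩
      8 * (κ * κ * (p * p)) * d          ≤⟨ *-monoˡ-≤ d (≤-trans (*-monoˡ-≤ (κ * κ * (p * p)) {8} {112} (≤ᵇ⇒≤ 8 112 _)) b-large) ⟩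
      b * d                              ≤⟨ bd ⟩
      r * (m * (m * m))                  ≡⟨ shape′ r m ⟩
      m * m * (r * m)                    ≤⟨ m²rm≤ ⟩
      κ * κ * X                          ∎)
      where
      shape : ∀ k p d → k * k * (8 * (p * p * d)) ≡ 8 * (k * k * (p * p)) * d
      shape = solve-∀
      shape′ : ∀ r m → r * (m * (m * m)) ≡ m * m * (r * m)
      shape′ = solve-∀
    -- This term dictates 112 = 16 · 7 in `b-large`: the 16 arises from doubling the last summand of
    -- `s-bound`, the 7 from the bound on `q`.
    term₃ : 16 * (p * p * (r * q)) ≤ X
    term₃ = *-cancelˡ-≤ (7 * (κ * κ)) (begin
      7 * (κ * κ) * (16 * (p * p * (r * q)))  ≡⟨ shape κ p r q ⟩
      112 * (κ * κ * (p * p)) * (r * q)       ≤⟨ *-monoˡ-≤ (r * q) b-large ⟩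
      b * (r * q)                             ≡⟨ shape₁ b r q ⟩
      r * (b * q)                             ≤⟨ *-mono-≤ r≤m bq ⟩
      m * (7 * (r * (m * m)))                 ≡⟨ shape₂ m r ⟩
      7 * (m * m * (r * m))                   ≤⟨ *-monoʳ-≤ 7 m²rm≤ ⟩
      7 * (κ * κ * X)                         ≡⟨ *-assoc 7 (κ * κ) X ⟨
      7 * (κ * κ) * X                         ∎)
      where
      shape : ∀ k p r q → 7 * (k * k) * (16 * (p * p * (r * q))) ≡ 112 * (k * k * (p * p)) * (r * q)
      shape = solve-∀
      shape₁ : ∀ b r q → b * (r * q) ≡ r * (b * q)
      shape₁ = solve-∀
      shape₂ : ∀ m r → m * (7 * (r * (m * m))) ≡ 7 * (m * m * (r * m))
      shape₂ = solve-∀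
    s≤ : 2 * p * s ≤ w * r * m
    s≤ = *-cancelˡ-≤ w (*-cancelˡ-≤ 4 (begin
      4 * (w * (2 * p * s))
        ≡⟨ shape p w s ⟩
      2 * (2 * ((2 * p) * (w * s)))
        ≤⟨ *-monoʳ-≤ 2 s-bound ⟩
      2 * ((r * r) * (w * w) + (2 * p) * (2 * p) * (d + 2 * (r * q)))
        ≡⟨ shape′ p ((r * r) * (w * w)) d (r * q) ⟩
      2 * ((r * r) * (w * w)) + 8 * (p * p * d) + 16 * (p * p * (r * q))
        ≤⟨ +-mono-≤ (+-mono-≤ (*-monoʳ-≤ 2 term₁) term₂) term₃ ⟩
      2 * X + X + X
        ≡⟨ four X ⟩
      4 * X
        ∎))
      where
      shape : ∀ p w s → 4 * (w * (2 * p * s)) ≡ 2 * (2 * ((2 * p) * (w * s)))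
      shape = solve-∀
      shape′ : ∀ p a d f → 2 * (a + (2 * p) * (2 * p) * (d + 2 * f)) ≡ 2 * a + 8 * (p * p * d) + 16 * (p * p * f)
      shape′ = solve-∀
      four : ∀ x → 2 * x + x + x ≡ 4 * x
      four = solve-∀
    q≤ : 2 * p * q ≤ w * r * m
    q≤ = *-cancelˡ-≤ (7 * κ) (begin
      7 * κ * (2 * p * q)                 ≡⟨ shape κ p q ⟩
      14 * (κ * p) * q                    ≤⟨ *-monoˡ-≤ q (≤-trans (*-mono-≤ {14} {112} (≤ᵇ⇒≤ 14 112 _) κp≤) b-large) ⟩
      b * q                               ≤⟨ bq ⟩
      7 * (r * (m * m))                   ≤⟨ *-monoʳ-≤ 7 (*-monoʳ-≤ r (*-monoˡ-≤ m m≤κw)) ⟩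
      7 * (r * (κ * w * m))               ≡⟨ shape′ κ w r m ⟩
      7 * κ * (w * r * m)                 ∎)
      where
      shape : ∀ k p q → 7 * k * (2 * p * q) ≡ 14 * (k * p) * q
      shape = solve-∀
      shape′ : ∀ k w r m → 7 * (r * (k * w * m)) ≡ 7 * k * (w * r * m)
      shape′ = solve-∀
      κp≤ : κ * p ≤ κ * κ * (p * p)
      κp≤ = *-mono-≤ (≤-trans (≤-reflexive (sym (*-identityʳ κ))) (*-monoʳ-≤ κ 1≤κ))
        (≤-trans (≤-reflexive (sym (*-identityʳ p))) (*-monoʳ-≤ p 1≤p))

  -- The 7 is made up of one unit from K, four from the link edges between N and L through
  -- `σ ≤ 2 * θ`, and one each from `Bw` and `B`. The copies too become proportional to `r`, however
  -- small, because `e ≤ r`.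
  Q-arithmetic : ∀ b e m r k λ′ σ θ q Bw B → 5 ≤ b → 1 ≤ e → e ≤ m → e ≤ r →
    b * k ≤ r → λ′ ≤ r → σ ≤ 2 * θ → b * θ ≤ m →
    b * (b * Bw) ≤ e * (e * e) → b * (b * B) ≤ e * (e * (e * e)) →
    e * e * q ≤ e * e * (m * (m * k) + 2 * (m * (λ′ * σ))) + (5 * (m * (m * Bw)) + 4 * (m * B)) →
    b * q ≤ 7 * (r * (m * m))
  Q-arithmetic b e m r k λ′ σ θ q Bw B 5≤b 1≤e e≤m e≤r bk λ≤r σ≤ bθ bBw bB q-bound =
    *-cancelˡ-≤ (e * e) {{>-nonZero (*-mono-≤ 1≤e 1≤e)}} (begin
      e * e * (b * q)
        ≡⟨ swap (e * e) b q ⟩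
      b * (e * e * q)
        ≤⟨ *-monoʳ-≤ b q-bound ⟩
      b * (e * e * (m * (m * k) + 2 * (m * (λ′ * σ))) + (5 * (m * (m * Bw)) + 4 * (m * B)))
        ≡⟨ distribute b e m k λ′ σ Bw B ⟩
      e * e * (m * m * (b * k) + 2 * (m * (λ′ * (b * σ)))) + (m * m * (5 * (b * Bw)) + m * (4 * (b * B)))
        ≤⟨ +-mono-≤ (*-monoʳ-≤ (e * e) (+-mono-≤ (*-monoʳ-≤ (m * m) bk) (*-monoʳ-≤ 2 (*-monoʳ-≤ m (*-mono-≤ λ≤r bσ)))))
             (+-mono-≤ (*-monoʳ-≤ (m * m) (≤-trans (*-monoˡ-≤ (b * Bw) 5≤b) bBw))
               (*-monoʳ-≤ m (≤-trans (*-monoˡ-≤ (b * B) (≤-trans (n≤1+n 4) 5≤b)) bB))) ⟩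
      e * e * (m * m * r + 2 * (m * (r * (2 * m)))) + (m * m * (e * (e * e)) + m * (e * (e * (e * e))))
        ≤⟨ +-monoʳ-≤ (e * e * (m * m * r + 2 * (m * (r * (2 * m)))))
             (+-mono-≤ (*-monoʳ-≤ (m * m) (*-monoˡ-≤ (e * e) e≤r)) (*-monoʳ-≤ m (*-mono-≤ e≤m (*-monoˡ-≤ (e * e) e≤r)))) ⟩
      e * e * (m * m * r + 2 * (m * (r * (2 * m)))) + (m * m * (r * (e * e)) + m * (m * (r * (e * e))))
        ≡⟨ collect e m r ⟩
      e * e * (7 * (r * (m * m)))
        ∎)
    where
    swap : ∀ a b q → a * (b * q) ≡ b * (a * q)
    swap = solve-∀
    distribute : ∀ b e m k l σ u v →
      b * (e * e * (m * (m * k) + 2 * (m * (l * σ))) + (5 * (m * (m * u)) + 4 * (m * v))) ≡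
      e * e * (m * m * (b * k) + 2 * (m * (l * (b * σ)))) + (m * m * (5 * (b * u)) + m * (4 * (b * v)))
    distribute = solve-∀
    collect : ∀ e m r →
      e * e * (m * m * r + 2 * (m * (r * (2 * m)))) + (m * m * (r * (e * e)) + m * (m * (r * (e * e)))) ≡
      e * e * (7 * (r * (m * m)))
    collect = solve-∀
    bσ : b * σ ≤ 2 * m
    bσ = ≤-trans (*-monoʳ-≤ b σ≤) (≤-trans (≤-reflexive (swap b 2 θ)) (*-monoʳ-≤ 2 bθ))

  -- The choice of constants and scales.

  module Base (p : ℕ) (16≤p : 16 ≤ p) where

    -- The degrees of middle vertices are at least m / κ, and b absorbs all numerical constants.
    -- The scales e ≪ u ≪ θ ≪ m below are e, b³ e, b⁶ e and roughly b⁷ e.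
    opaque

      κ b : ℕ
      κ = (p * p * p) * (p * p * p) * (p * p * p)
      b = κ * κ * (p * p) * (p * p)

      κ≡ : κ ≡ (p * p * p) * (p * p * p) * (p * p * p)
      κ≡ = refl

      b≡ : b ≡ κ * κ * (p * p) * (p * p)
      b≡ = refl

    1≤p : 1 ≤ p
    1≤p = ≤-trans (s≤s z≤n) 16≤p

    private
      1≤p³ : 1 ≤ p * p * p
      1≤p³ = *-mono-≤ (*-mono-≤ 1≤p 1≤p) 1≤p

      256≤p² : 256 ≤ p * p
      256≤p² = *-mono-≤ 16≤p 16≤p

    1≤κ : 1 ≤ κ
    1≤κ = ≤-trans (*-mono-≤ (*-mono-≤ 1≤p³ 1≤p³) 1≤p³) (≤-reflexive (sym κ≡))

    -- The last factor p² of `b` is there for this: it is at least 16², which exceeds 112.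
    b-large : 112 * (κ * κ * (p * p)) ≤ b
    b-large = ≤-trans (*-monoˡ-≤ (κ * κ * (p * p)) (≤-trans (≤ᵇ⇒≤ 112 256 _) 256≤p²))
      (≤-reflexive (trans (*-comm (p * p) _) (sym b≡)))

    256κ≤b : 256 * κ ≤ b
    256κ≤b = begin
      256 * κ                        ≤⟨ *-mono-≤ 256≤p² (≤-trans (≤-reflexive (sym (*-identityʳ κ))) (*-monoʳ-≤ κ 1≤κp²)) ⟩
      p * p * (κ * (κ * (p * p)))    ≡⟨ trans (shape p κ) (sym b≡) ⟩
      b                              ∎
      where
      1≤κp² : 1 ≤ κ * (p * p)
      1≤κp² = *-mono-≤ 1≤κ (*-mono-≤ 1≤p 1≤p)
      shape : ∀ p k → p * p * (k * (k * (p * p))) ≡ k * k * (p * p) * (p * p)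
      shape = solve-∀

    256≤b : 256 ≤ b
    256≤b = ≤-trans (*-monoʳ-≤ 256 1≤κ) 256κ≤b

    1≤b : 1 ≤ b
    1≤b = ≤-trans (s≤s z≤n) 256≤b

    instance
      b≢0 : NonZero b
      b≢0 = >-nonZero 1≤b

    1≤b³ : 1 ≤ b * b * b
    1≤b³ = *-mono-≤ (*-mono-≤ 1≤b 1≤b) 1≤b

  module Parameters (p : ℕ) (16≤p : 16 ≤ p) (m e : ℕ) (1≤e : 1 ≤ e) where

    open Base p 16≤p

    opaque

      -- Below, m is between `b * θ` and b² θ. The ratio b³ of θ to `u` makes 2 u θ² exceed m u² by
      -- a factor 2 b, which contradicts near-nestedness. The ratio b⁶ of θ to `e` lets b⁶ windows
      -- of length `e` fit between θ and 2 θ; as m ≤ b⁵ u, the thinnest then holds at most u / b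
      -- vertices.
      u θ : ℕ
      u = b * b * b * e
      θ = b * b * b * u

      u≡ : u ≡ b * b * b * e
      u≡ = refl

      θ≡ : θ ≡ b * b * b * u
      θ≡ = refl

    e≤u : e ≤ u
    e≤u = ≤-trans (≤-trans (≤-reflexive (sym (+-identityʳ e))) (*-monoˡ-≤ e 1≤b³)) (≤-reflexive (sym u≡))

    1≤u : 1 ≤ u
    1≤u = ≤-trans 1≤e e≤u

    u≤θ : u ≤ θ
    u≤θ = ≤-trans (≤-trans (≤-reflexive (sym (+-identityʳ u))) (*-monoˡ-≤ u 1≤b³)) (≤-reflexive (sym θ≡))

    module Range (bθ≤m : b * θ ≤ m) (m≤b²θ : m ≤ b * (b * θ)) where

      θ≤m : θ ≤ m
      θ≤m = ≤-trans (≤-reflexive (sym (+-identityʳ θ))) (≤-trans (*-monoˡ-≤ θ 1≤b) bθ≤m)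

      e≤m : e ≤ m
      e≤m = ≤-trans e≤u (≤-trans u≤θ θ≤m)

      opaque
        unfolding u

        -- Each of the three terms on the right is at most Y = b⁶ e⁴, whereas u⁴ = b⁶ Y.
        few-atypical : ∀ a Bw B → b * (b * Bw) ≤ e * (e * e) → b * (b * B) ≤ e * (e * (e * e)) →
          suc (u * (u * u)) * a ≤ m * Bw + B + m * Bw → a ≤ u
        few-atypical a Bw B bBw bB bound = ≮⇒≥ λ u<a → <-irrefl refl (begin-strict
          u * (u * u) * u              <⟨ *-monoˡ-< u {{>-nonZero 1≤u}} (n<1+n (u * (u * u))) ⟩
          suc (u * (u * u)) * u        ≤⟨ *-monoʳ-≤ (suc (u * (u * u))) (<⇒≤ u<a) ⟩
          suc (u * (u * u)) * a        ≤⟨ bound ⟩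
          m * Bw + B + m * Bw          ≤⟨ +-mono-≤ (+-mono-≤ mBw B≤) mBw ⟩
          Y + Y + Y                    ≡⟨ thrice Y ⟩
          3 * Y                        ≤⟨ *-monoˡ-≤ Y (≤-trans (≤ᵇ⇒≤ 3 256 _) (≤-trans 256≤b (≤-trans (≤-reflexive (sym (*-identityʳ b))) (*-monoʳ-≤ b (*-mono-≤ 1≤b³ (*-mono-≤ 1≤b 1≤b)))))) ⟩
          b * (b * b * b * (b * b)) * Y ≡⟨ shape b e ⟩
          u * (u * u) * u              ∎)
          where
          Y : ℕ
          Y = (b * b * b) * (b * b * b) * (e * (e * (e * e)))
          thrice : ∀ y → y + y + y ≡ 3 * y
          thrice = solve-∀
          shape : ∀ b e → b * (b * b * b * (b * b)) * ((b * b * b) * (b * b * b) * (e * (e * (e * e)))) ≡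
            (b * b * b * e) * ((b * b * b * e) * (b * b * b * e)) * (b * b * b * e)
          shape = solve-∀
          shape′ : ∀ b e w → b * (b * (b * b * b * (b * b * b * e))) * w ≡ (b * b * b) * (b * b * b) * e * (b * (b * w))
          shape′ = solve-∀
          shape″ : ∀ b e → (b * b * b) * (b * b * b) * e * (e * (e * e)) ≡ (b * b * b) * (b * b * b) * (e * (e * (e * e)))
          shape″ = solve-∀
          mBw : m * Bw ≤ Y
          mBw = begin
            m * Bw                                              ≤⟨ *-monoˡ-≤ Bw m≤b²θ ⟩
            b * (b * θ) * Bw                                    ≡⟨ shape′ b e Bw ⟩
            (b * b * b) * (b * b * b) * e * (b * (b * Bw))      ≤⟨ *-monoʳ-≤ ((b * b * b) * (b * b * b) * e) bBw ⟩
            (b * b * b) * (b * b * b) * e * (e * (e * e))       ≡⟨ shape″ b e ⟩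
            Y                                                   ∎
          B≤ : B ≤ Y
          B≤ = begin
            B                                ≡⟨ *-identityˡ B ⟨
            1 * B                            ≤⟨ *-monoˡ-≤ B (*-mono-≤ 1≤b 1≤b) ⟩
            b * b * B                        ≡⟨ *-assoc b b B ⟩
            b * (b * B)                      ≤⟨ bB ⟩
            e * (e * (e * e))                ≡⟨ *-identityˡ _ ⟨
            1 * (e * (e * (e * e)))          ≤⟨ *-monoˡ-≤ _ (*-mono-≤ 1≤b³ 1≤b³) ⟩
            Y                                ∎

        -- Refutes the first alternative of `dichotomy`: 2 u is far below m / κ.
        few-outside : ∀ n low a → m ≤ κ * n → low ≤ u → a ≤ u → n ≤ low + a → ⊥
        few-outside n low a m≤κn low≤u a≤u n≤ = <-irrefl refl (begin-strict
          b * u                        <⟨ *-monoʳ-< b (≤-trans (≤-reflexive (+-comm 1 u)) (≤-trans (+-monoʳ-≤ u 1≤u) (≤-reflexive (cong (u +_) (sym (+-identityʳ u)))))) ⟩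
          b * (2 * u)                  ≤⟨ *-monoʳ-≤ b (*-monoˡ-≤ u (≤-trans (≤ᵇ⇒≤ 2 256 _) (≤-trans 256≤b (≤-trans (≤-reflexive (sym (*-identityʳ b))) (≤-trans (*-monoʳ-≤ b (*-mono-≤ 1≤b 1≤b)) (≤-reflexive (sym (*-assoc b b b)))))))) ⟩
          b * θ                        ≤⟨ bθ≤m ⟩
          m                            ≤⟨ m≤κn ⟩
          κ * n                        ≤⟨ *-monoʳ-≤ κ (≤-trans n≤ (+-mono-≤ low≤u a≤u)) ⟩
          κ * (u + u)                  ≡⟨ shape κ u ⟩
          2 * κ * u                    ≤⟨ *-monoˡ-≤ u (≤-trans (*-monoˡ-≤ κ (≤ᵇ⇒≤ 2 256 _)) 256κ≤b) ⟩
          b * u                        ∎)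
          where
          shape : ∀ k u → k * (u + u) ≡ 2 * k * u
          shape = solve-∀

        -- Refutes the second alternative of `dichotomy` for `h = u` and β = u³: the right side is
        -- at most (1 + 1 + 4 + 2) m u², and the left side is 2 b · b² θ u² ≥ 2 b · m u².
        not-nested : ∀ low low̄ a → low ≤ u → low̄ ≤ u → a ≤ u →
          2 * (u * (θ * θ)) ≤ m * (u * u) + u * (u * u) + 2 * (u * (m * (low + a))) + 2 * (u * (θ * low̄)) → ⊥
        not-nested low low̄ a low≤u low̄≤u a≤u bound = <-irrefl refl (begin-strict
          8 * Y
            <⟨ *-monoˡ-< Y {{>-nonZero 1≤Y}} (≤-trans (≤ᵇ⇒≤ 9 512 _) (*-monoʳ-≤ 2 256≤b)) ⟩
          2 * b * Y
            ≡⟨ shape b e ⟩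
          2 * (u * (θ * θ))
            ≤⟨ bound ⟩
          m * (u * u) + u * (u * u) + 2 * (u * (m * (low + a))) + 2 * (u * (θ * low̄))
            ≤⟨ +-mono-≤ (+-mono-≤ (+-monoʳ-≤ (m * (u * u)) (*-monoˡ-≤ (u * u) (≤-trans u≤θ θ≤m)))
                 (*-monoʳ-≤ 2 (*-monoʳ-≤ u (*-monoʳ-≤ m (+-mono-≤ low≤u a≤u)))))
                 (*-monoʳ-≤ 2 (*-monoʳ-≤ u (*-mono-≤ θ≤m low̄≤u))) ⟩
          m * (u * u) + m * (u * u) + 2 * (u * (m * (u + u))) + 2 * (u * (m * u))
            ≡⟨ collect m u ⟩
          8 * (m * (u * u))
            ≤⟨ *-monoʳ-≤ 8 (*-monoˡ-≤ (u * u) m≤b²θ) ⟩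
          8 * Y
            ∎)
          where
          Y : ℕ
          Y = b * (b * θ) * (u * u)
          1≤Y : 1 ≤ Y
          1≤Y = *-mono-≤ (*-mono-≤ 1≤b (*-mono-≤ 1≤b (≤-trans 1≤u u≤θ))) (*-mono-≤ 1≤u 1≤u)
          shape : ∀ b e → 2 * b * (b * (b * (b * b * b * (b * b * b * e))) * ((b * b * b * e) * (b * b * b * e))) ≡
            2 * ((b * b * b * e) * ((b * b * b * (b * b * b * e)) * (b * b * b * (b * b * b * e))))
          shape = solve-∀
          collect : ∀ m u → m * (u * u) + m * (u * u) + 2 * (u * (m * (u + u))) + 2 * (u * (m * u)) ≡ 8 * (m * (u * u))
          collect = solve-∀

  complement-sym : ∀ {A} {E : A → A → A → Bool} → Symmetric₃ E → Symmetric₃ (complement E)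
  complement-sym E-sym = record
    { swap₁₂ = λ x y z → cong not (swap₁₂ x y z)
    ; swap₂₃ = λ x y z → cong not (swap₂₃ x y z)
    }
    where open Symmetric₃ E-sym

  two-not : ∀ a b c d → two (not a) (not b) (not c) (not d) ≡ two a b c d
  two-not a b c d = ≤-antisym
    (by-valuation 4 (λ { (a ∷ b ∷ c ∷ d ∷ []) → two (not a) (not b) (not c) (not d) })
      (λ { (a ∷ b ∷ c ∷ d ∷ []) → two a b c d }) (a ∷ b ∷ c ∷ d ∷ []))
    (by-valuation 4 (λ { (a ∷ b ∷ c ∷ d ∷ []) → two a b c d })
      (λ { (a ∷ b ∷ c ∷ d ∷ []) → two (not a) (not b) (not c) (not d) }) (a ∷ b ∷ c ∷ d ∷ []))

  D₂⁵-complement : ∀ {A} (E : A → A → A → Bool) v a b c d → D₂⁵ (complement E) v a b c d ≡ D₂⁵ E v a b c d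
  D₂⁵-complement E v a b c d = cong₂ _+_ (cong₂ _+_ (cong₂ _+_ (cong₂ _+_
    (two-not (E v a b) (E v a c) (E v b c) (E a b c))
    (two-not (E v a b) (E v a d) (E v b d) (E a b d)))
    (two-not (E v a c) (E v a d) (E v c d) (E a c d)))
    (two-not (E v b c) (E v b d) (E v c d) (E b c d)))
    (two-not (E a b c) (E a b d) (E a c d) (E b c d))

  ∑-D₂ : {A : Set} → List A → (A → A → A → Bool) → ℕ
  ∑-D₂ l E = ∑[ a ∈ l ] ∑[ b ∈ l ] ∑[ c ∈ l ] ∑[ d ∈ l ] D₂ E a b c d

  -- Existence of a decomposition.

  module _ {A : Set} (l : List A) (p : ℕ) (16≤p : 16 ≤ p) (e : ℕ) (1≤e : 1 ≤ e) where

    private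
      m : ℕ
      m = length l

    open Base p 16≤p
    open Parameters p 16≤p m e 1≤e

    module _ (bθ≤m : b * θ ≤ m) (m≤b²θ : m ≤ b * (b * θ)) where

      open Range bθ≤m m≤b²θ

      cut-at-window : ∀ E (E-sym : Symmetric₃ E) v w → let open Cut l E E-sym v w in
        ∃[ i ] (i ≤ b * b * b * (b * b * b) ×
                b * b * b * (b * b * b) * # l (Threshold.K (θ + i * e) e) ≤ m) →
        b * (b * B[w]) ≤ e * (e * e) → b * (b * B) ≤ e * (e * (e * e)) →
        m ≤ κ * # l N → u ≤ # l (λ y → not (N y) ∧ not (θ ≤ᵇ c y)) →
        Decomposition l E p
      cut-at-window E E-sym v w (i , i≤ , few-K) bBw bB m≤κN u≤low =
        cut false W 1≤W (≤-trans 1≤u u≤R) (begin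
          p * (∑[ x ∈ l ] ∑[ y ∈ l ] ∑[ z ∈ l ] ⟦ (W x ∧ not (W y)) ∧ (E x y z xor false) ⟧)
            ≤⟨ *-monoʳ-≤ p crossing≤ ⟩
          p * (S + Q)
            -- With `k = 2 * p` the main term of `S-bound` contributes at most |W| |R| m / (4 p) to
            -- S.
            ≤⟨ cut-arithmetic p κ b m (# l W) (# l R) Q S B 1≤p 1≤W 1≤κ (#≤length l R)
                 (≤-trans m≤κN (*-monoʳ-≤ κ N≤W)) b-large bQ bB≤ (S-bound (2 * p)) ⟩
          # l W * # l R * m
            ∎)
        where
        σ : ℕ
        σ = θ + i * e
        open Cut l E E-sym v w
        open Threshold σ e

        N≤W : # l N ≤ # l W
        N≤W = ∑-mono l λ x → by-valuation 2 (λ { (n ∷ h ∷ []) → ⟦ n ⟧ }) (λ { (n ∷ h ∷ []) → ⟦ n ∨ h ⟧ })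
          (N x ∷ (τ ≤ᵇ c x) ∷ [])

        1≤W : 1 ≤ # l W
        1≤W = ≮⇒≥ λ W<1 → <-irrefl refl (begin-strict
          0                 <⟨ ≤-trans 1≤e e≤m ⟩
          m                 ≤⟨ m≤κN ⟩
          κ * # l N         ≤⟨ *-monoʳ-≤ κ (≤-trans N≤W (≤-pred W<1)) ⟩
          κ * 0             ≡⟨ *-zeroʳ κ ⟩
          0                 ∎)

        below-R : ∀ t → t ≤ τ → # l (λ y → not (N y) ∧ not (t ≤ᵇ c y)) ≤ # l R
        below-R t t≤τ = ∑-mono l pointwise
          where
          pointwise : ∀ y → ⟦ not (N y) ∧ not (t ≤ᵇ c y) ⟧ ≤ ⟦ not (N y ∨ (τ ≤ᵇ c y)) ⟧
          pointwise y with N y | t ≤ᵇ c y in lo | τ ≤ᵇ c y in hi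
          ... | true  | _     | _     = z≤n
          ... | false | true  | _     = z≤n
          ... | false | false | false = ≤-refl
          ... | false | false | true  = ⊥-elim (<-irrefl refl
            (<-≤-trans (≤ᵇ-false {t} {c y} lo) (≤-trans t≤τ (≤ᵇ-true {τ} {c y} hi))))

        L≤R : # l L ≤ # l R
        L≤R = below-R σ (m≤m+n σ e)

        u≤R : u ≤ # l R
        u≤R = ≤-trans u≤low (below-R θ (≤-trans (m≤m+n θ (i * e)) (m≤m+n σ e)))

        σ≤2θ : σ ≤ 2 * θ
        σ≤2θ = begin
          θ + i * e                              ≤⟨ +-monoʳ-≤ θ (*-monoˡ-≤ e i≤) ⟩
          θ + b * b * b * (b * b * b) * e        ≡⟨ cong (θ +_) (trans (shape b e) (cong (_+ 0) (sym (trans θ≡ (cong (b * b * b *_) u≡))))) ⟩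
          2 * θ                                  ∎
          where
          shape : ∀ b e → b * b * b * (b * b * b) * e ≡ b * b * b * (b * b * b * e) + 0
          shape = solve-∀

        bK : b * # l K ≤ # l R
        bK = ≤-trans (*-cancelˡ-≤ (b * b * b * (b * b)) {{>-nonZero (*-mono-≤ 1≤b³ (*-mono-≤ 1≤b 1≤b))}} (begin
          b * b * b * (b * b) * (b * # l K)      ≡⟨ shape b (# l K) ⟩
          b * b * b * (b * b * b) * # l K        ≤⟨ few-K ⟩
          m                                      ≤⟨ m≤b²θ ⟩
          b * (b * θ)                            ≡⟨ trans (cong (λ t → b * (b * t)) θ≡) (shape′ b u) ⟩
          b * b * b * (b * b) * u                ∎)) u≤R
          where
          shape : ∀ b k → b * b * b * (b * b) * (b * k) ≡ b * b * b * (b * b * b) * k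
          shape = solve-∀
          shape′ : ∀ b u → b * (b * (b * b * b * u)) ≡ b * b * b * (b * b) * u
          shape′ = solve-∀

        bQ : b * Q ≤ 7 * (# l R * (m * m))
        bQ = Q-arithmetic b e m (# l R) (# l K) (# l L) σ θ Q B[w] B (≤-trans (≤ᵇ⇒≤ 5 256 _) 256≤b)
          1≤e e≤m (≤-trans e≤u u≤R) bK L≤R σ≤2θ bθ≤m bBw bB (Q-bound e≤m)

        bB≤ : b * B ≤ # l R * (m * (m * m))
        bB≤ = begin
          b * B                            ≡⟨ *-identityˡ (b * B) ⟨
          1 * (b * B)                      ≤⟨ *-monoˡ-≤ (b * B) 1≤b ⟩
          b * (b * B)                      ≤⟨ bB ⟩
          e * (e * (e * e))                ≤⟨ *-mono-≤ (≤-trans e≤u u≤R) (*-mono-≤ e≤m (*-mono-≤ e≤m e≤m)) ⟩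
          # l R * (m * (m * m))            ∎

        -- The third vertex decides between type WRR, counted by `S`, and type WWR, counted by `Q`.
        crossing≤ : ∑[ x ∈ l ] ∑[ y ∈ l ] ∑[ z ∈ l ] ⟦ (W x ∧ not (W y)) ∧ (E x y z xor false) ⟧ ≤ S + Q
        crossing≤ = ≤-trans
          (∑-≤+ l λ x → ∑-≤+ l λ y → ∑-≤+ l λ z → pointwise x y z)
          (≤-reflexive (cong (S +_) (∑-cong l λ x → ∑-comm l l _)))
          where
          pointwise : ∀ x y z → ⟦ (W x ∧ R y) ∧ (E x y z xor false) ⟧ ≤
            ⟦ W x ∧ ((R y ∧ R z) ∧ E x y z) ⟧ + ⟦ (W x ∧ W z) ∧ (R y ∧ E x z y) ⟧
          pointwise x y z rewrite Symmetric₃.swap₂₃ E-sym x z y = by-valuation 4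
            (λ { (a ∷ b ∷ c ∷ d ∷ []) → ⟦ (a ∧ not b) ∧ (d xor false) ⟧ })
            (λ { (a ∷ b ∷ c ∷ d ∷ []) → ⟦ a ∧ ((not b ∧ not c) ∧ d) ⟧ + ⟦ (a ∧ c) ∧ (not b ∧ d) ⟧ })
            (W x ∷ W y ∷ W z ∷ E x y z ∷ [])

      cut-decomposition : ∀ E (E-sym : Symmetric₃ E) v w → let open Cut l E E-sym v w in
        b * (b * B[w]) ≤ e * (e * e) → b * (b * B) ≤ e * (e * (e * e)) →
        m ≤ κ * # l N → u ≤ # l (λ y → not (N y) ∧ not (θ ≤ᵇ c y)) →
        Decomposition l E p
      cut-decomposition E E-sym v w = cut-at-window E E-sym v w
        (Cut.window l E E-sym v w θ e (b * b * b * (b * b * b)) (*-mono-≤ 1≤b³ 1≤b³))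

      -- At least `u` low vertices in G or in its complement give a cut there, since they all lie in
      -- R. If neither happens, both alternatives of `dichotomy` are contradictory.
      middle-decomposition : ∀ E (E-sym : Symmetric₃ E) v w → let open Cut l E E-sym v w in
        b * (b * B[w]) ≤ e * (e * e) → b * (b * B) ≤ e * (e * (e * e)) →
        m ≤ κ * # l N → m ≤ κ * # l (not ∘ N) →
        Decomposition l E p
      middle-decomposition E E-sym v w bBw bB m≤κN m≤κN̄
        with u ≤? # l (Cut.Dichotomy.low l E E-sym v w θ u (u * (u * u)))
           | u ≤? # l (Cut.Dichotomy.low̄ l E E-sym v w θ u (u * (u * u)))
      ... | yes u≤low | _ = cut-decomposition E E-sym v w bBw bB m≤κN u≤low
      ... | no _ | yes u≤low̄ = decomposition-complement l E
        (cut-decomposition (complement E) (complement-sym E-sym) v w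
          (≤-trans (≤-reflexive (cong (λ k → b * (b * k)) B[w]-complement)) bBw)
          (≤-trans (≤-reflexive (cong (λ k → b * (b * k))
            (∑-cong l λ a → ∑-cong l λ b → ∑-cong l λ c → ∑-cong l λ d → D₂⁵-complement E v a b c d))) bB)
          m≤κN̄
          (≤-trans u≤low̄ (≤-reflexive (∑-cong l λ y →
            cong (λ a → ⟦ a ∧ not (θ ≤ᵇ Cut.c̄ l E E-sym v w y) ⟧) (sym (not-involutive (E v w y)))))))
        where
        B[w]-complement : Cut.B[w] l (complement E) (complement-sym E-sym) v w ≡ Cut.B[w] l E E-sym v w
        B[w]-complement = ∑-cong l λ b → ∑-cong l λ c → ∑-cong l λ d → D₂⁵-complement E v w b c d
      ... | no low<u | no low̄<u = ⊥-elim (absurd dichotomy)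
        where
        open Cut l E E-sym v w
        open Dichotomy θ u (u * (u * u))
        a≤u : # l atypical ≤ u
        a≤u = few-atypical (# l atypical) B[w] B bBw bB atypical-bound
        absurd : _ → ⊥
        absurd (inj₁ outside) = few-outside (# l (not ∘ N)) (# l low) (# l atypical) m≤κN̄
          (<⇒≤ (≰⇒> low<u)) a≤u outside
        absurd (inj₂ bound) = not-nested (# l low) (# l low̄) (# l atypical)
          (<⇒≤ (≰⇒> low<u)) (<⇒≤ (≰⇒> low̄<u)) a≤u bound

      module _ (E : A → A → A → Bool) (E-sym : Symmetric₃ E) where

        private
          D[_] : A → ℕ
          D[ v ] = ∑[ b ∈ l ] ∑[ c ∈ l ] ∑[ d ∈ l ] D₂ E v b c d

          B-total : ∀ v → ∑[ a ∈ l ] ∑[ b ∈ l ] ∑[ c ∈ l ] ∑[ d ∈ l ] D₂⁵ E v a b c d ≡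
            m * D[ v ] + m * D[ v ] + m * D[ v ] + m * D[ v ] + ∑-D₂ l E
          B-total v = trans (∑⁴-+ (λ a b c d → D₂ E v a b c + D₂ E v a b d + D₂ E v a c d + D₂ E v b c d) _)
            (cong (_+ ∑-D₂ l E) (trans (∑⁴-+ (λ a b c d → D₂ E v a b c + D₂ E v a b d + D₂ E v a c d) _)
              (cong₂ _+_ (trans (∑⁴-+ (λ a b c d → D₂ E v a b c + D₂ E v a b d) _)
                (cong₂ _+_ (trans (∑⁴-+ (λ a b c d → D₂ E v a b c) _)
                  (cong₂ _+_
                    (trans (∑-cong l λ a → trans (∑-cong l λ b → trans (∑-cong l λ c → ∑-const l _) (∑-*ˡ l m _)) (∑-*ˡ l m _)) (∑-*ˡ l m _))
                    (trans (∑-cong l λ a → trans (∑-cong l λ b → ∑-const l _) (∑-*ˡ l m _)) (∑-*ˡ l m _))))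
                  (trans (∑-cong l λ a → ∑-const l _) (∑-*ˡ l m _))))
                (∑-const l _))))
            where
            ∑⁴-+ : ∀ (f g : A → A → A → A → ℕ) →
              ∑[ a ∈ l ] ∑[ b ∈ l ] ∑[ c ∈ l ] ∑[ d ∈ l ] (f a b c d + g a b c d) ≡
              ∑[ a ∈ l ] ∑[ b ∈ l ] ∑[ c ∈ l ] ∑[ d ∈ l ] f a b c d +
              ∑[ a ∈ l ] ∑[ b ∈ l ] ∑[ c ∈ l ] ∑[ d ∈ l ] g a b c d
            ∑⁴-+ f g = trans (∑-cong l λ a → trans (∑-cong l λ b → trans (∑-cong l λ c →
              ∑-+ l (f a b c) (g a b c)) (∑-+ l _ _)) (∑-+ l _ _)) (∑-+ l _ _)

        -- Once no vertex is sparse or co-sparse, all `m` vertices compete for `v`, so averaging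
        -- makes each of the four kinds of quadruples through `v` cost at most `∑-D₂`; the fifth
        -- omits `v`. Averaging again over at least `e` middle vertices `w` turns the bound e⁴ for
        -- `B` into e³ for `B[w]`.
        decomposition : b * (b * (5 * ∑-D₂ l E)) ≤ e * (e * (e * e)) → Decomposition l E p
        decomposition bD with 1 ≤? # l (sparse l E p) | 1 ≤? # l (sparse l (complement E) p)
        ... | yes some | _ = sparse-decomposition l E p (≤-trans (s≤s (s≤s z≤n)) 16≤p) some
        ... | no _ | yes some = decomposition-complement l E
          (sparse-decomposition l (complement E) p (≤-trans (s≤s (s≤s z≤n)) 16≤p) some)
        ... | no none | no none′ = middle-decomposition E E-sym v w bBw bB
            (≤ᵇ-true (proj₁ (∧-true {m ≤ᵇ κ * degree w} w-middle)))
            (≤ᵇ-true (proj₂ (∧-true {m ≤ᵇ κ * degree w} w-middle)))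
          where
          1≤m : 1 ≤ m
          1≤m = ≤-trans 1≤e e≤m

          medium : A → Bool
          medium v = not (sparse l E p v) ∧ not (sparse l (complement E) p v)

          m≤medium : m ≤ # l medium
          m≤medium = begin
            m
              ≡⟨ trans (∑-const l 1) (*-identityʳ m) ⟨
            ∑[ _ ∈ l ] 1
              ≤⟨ (∑-≤+ l λ v → ≤-trans (by-valuation 2 (λ { (s ∷ t ∷ []) → 1 })
                   (λ { (s ∷ t ∷ []) → ⟦ s ⟧ + ⟦ t ⟧ + ⟦ not s ∧ not t ⟧ })
                   (sparse l E p v ∷ sparse l (complement E) p v ∷ [])) ≤-refl) ⟩
            ∑[ v ∈ l ] (⟦ sparse l E p v ⟧ + ⟦ sparse l (complement E) p v ⟧) + # l medium
              ≡⟨ cong (_+ # l medium) (trans (∑-+ l _ _)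
                   (cong₂ _+_ (n<1⇒n≡0 (≰⇒> none)) (n<1⇒n≡0 (≰⇒> none′)))) ⟩
            # l medium
              ∎

          chosen-v = below-average l medium D[_] (≤-trans 1≤m m≤medium)
          v = proj₁ chosen-v

          mD≤ : m * D[ v ] ≤ ∑-D₂ l E
          mD≤ = ≤-trans (*-monoˡ-≤ D[ v ] m≤medium) (proj₂ (proj₂ chosen-v))

          open Middle l (E v) (Symmetric₃.swap₂₃ E-sym v) p (≤-trans (≤ᵇ⇒≤ 3 16 _) 16≤p) 1≤m κ κ≡

          v-medium = ∧-true {not (sparse l E p v)} (proj₁ (proj₂ chosen-v))

          m≤middle : m ≤ κ * # l middle
          m≤middle = many-middle
            (≤ᵇ-false (not-true (proj₁ v-medium)))
            (≤ᵇ-false (not-true (proj₂ v-medium)))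

          κe≤m : κ * e ≤ m
          κe≤m = begin
            κ * e      ≤⟨ *-mono-≤ (≤-trans (≤-reflexive (sym (+-identityʳ κ))) (≤-trans (*-monoˡ-≤ κ (≤ᵇ⇒≤ 1 256 _)) 256κ≤b)) (≤-trans e≤u u≤θ) ⟩
            b * θ      ≤⟨ bθ≤m ⟩
            m          ∎

          e≤middle : e ≤ # l middle
          e≤middle = *-cancelˡ-≤ κ {{>-nonZero 1≤κ}} (≤-trans κe≤m m≤middle)

          chosen-w = below-average l middle (λ w → Cut.B[w] l E E-sym v w) (≤-trans 1≤e e≤middle)
          w = proj₁ chosen-w
          w-middle = proj₁ (proj₂ chosen-w)

          open Cut l E E-sym v w using (B; B[w])

          bB : b * (b * B) ≤ e * (e * (e * e))
          bB = ≤-trans (*-monoʳ-≤ b (*-monoʳ-≤ b (begin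
            B
              ≡⟨ B-total v ⟩
            m * D[ v ] + m * D[ v ] + m * D[ v ] + m * D[ v ] + ∑-D₂ l E
              ≤⟨ +-monoˡ-≤ (∑-D₂ l E) (+-mono-≤ (+-mono-≤ (+-mono-≤ mD≤ mD≤) mD≤) mD≤) ⟩
            ∑-D₂ l E + ∑-D₂ l E + ∑-D₂ l E + ∑-D₂ l E + ∑-D₂ l E
              ≡⟨ five (∑-D₂ l E) ⟩
            5 * ∑-D₂ l E
              ∎))) bD
            where
            five : ∀ d → d + d + d + d + d ≡ 5 * d
            five = solve-∀

          bBw : b * (b * B[w]) ≤ e * (e * e)
          bBw = *-cancelˡ-≤ e {{>-nonZero 1≤e}} (begin
            e * (b * (b * B[w]))      ≡⟨ shape e b B[w] ⟩
            b * (b * (e * B[w]))      ≤⟨ *-monoʳ-≤ b (*-monoʳ-≤ b (≤-trans (*-monoˡ-≤ B[w] e≤middle) (proj₂ (proj₂ chosen-w)))) ⟩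
            b * (b * B)               ≤⟨ bB ⟩
            e * (e * (e * e))         ∎)
            where
            shape : ∀ e b k → e * (b * (b * k)) ≡ b * (b * (e * k))
            shape = solve-∀

module Hypergraphs where

  open Counting
  open Cuts
  open import Defs hiding (_^_)
  open import Data.Bool using (Bool; true; false; T; T?; not; _∧_; _xor_; if_then_else_)
  open import Data.Bool.Properties using (T-≡)
  open import Data.Empty using (⊥; ⊥-elim)
  open import Data.Fin using (Fin; zero; suc)
  open import Data.Fin.Properties using (_≟_)
  open import Data.Fin.Subset using (Subset; ⁅_⁆; _∪_; _⊆_; inside; outside; ∣_∣)
    renaming (_∈_ to _∈ₛ_; _∉_ to _∉ₛ_)
  open import Data.Fin.Subset.Properties
    using (_⊆?_; _∈?_; ⊆-antisym; p⊂q⇒∣p∣<∣q∣; p⊆q⇒∣p∣≤∣q∣; ∪-comm; ∪-assoc; x∈p∪q⁻; x∈p∪q⁺;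
           x∈⁅y⁆⇒x≡y; x∈⁅x⁆; ∣⁅x⁆∣≡1)
  open import Data.List
    using (List; []; _∷_; _++_; length; map; filter; filterᵇ; allFin; cartesianProductWith)
  open import Data.List.Membership.Propositional using (_∈_)
  open import Data.List.Membership.Propositional.Properties
    using (∈-∃++; ∈-++⁻; ∈-++⁺ˡ; ∈-++⁺ʳ; ∈-map⁺; ∈-map⁻; ∈-filter⁺; ∈-filter⁻; ∈-allFin;
           ∈-cartesianProductWith⁺)
  open import Data.List.Properties using (length-++; length-tabulate; map-tabulate)
  open import Data.List.Relation.Unary.All as All using ([]; _∷_)
  open import Data.List.Relation.Unary.AllPairs using ([]; _∷_)
  open import Data.List.Relation.Unary.Any using (here; there)
  open import Data.List.Relation.Unary.Unique.Propositional using (Unique)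
  open import Data.List.Relation.Unary.Unique.Propositional.Properties
    using (filter⁺; allFin⁺; map⁺; ++⁺)
  open import Data.Nat hiding (_≟_)
  open import Data.Nat.DivMod using (m≡m%n+[m/n]*n; m%n<n; m/n*n≤m; m≥n⇒m/n>0)
  open import Data.Nat.Properties hiding (_≟_)
  open import Data.Nat.Tactic.RingSolver using (solve-∀)
  open import Data.Product using (_×_; _,_; ∃-syntax; proj₁; proj₂)
  open import Data.Sum using (_⊎_; inj₁; inj₂)
  open import Data.Vec using ([]; _∷_; lookup; tabulate)
  open import Data.Vec.Properties using (lookup∘tabulate; lookup⇒[]=; []=⇒lookup; ∷-injectiveʳ)
  open import Function using (_∘_; case_of_; id; Equivalence)
  open import Relation.Binary.PropositionalEquality
  open import Relation.Nullary using (yes; no; does)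
  open import Relation.Nullary.Decidable using (dec-true; dec-false)

  open ≤-Reasoning

  -- Gluing D₂-free structures along a cut.

  module _ {n : ℕ} where

    triple : Fin n → Fin n → Fin n → Subset n
    triple a b c = ⁅ a ⁆ ∪ (⁅ b ⁆ ∪ ⁅ c ⁆)

    -- Symmetry is automatic. Coinciding arguments evaluate `F` on sets of fewer than three
    -- elements; such values are finally discarded by `3-part`.
    induced : (Subset n → Bool) → Fin n → Fin n → Fin n → Bool
    induced F a b c = F (triple a b c)

    induced-sym : ∀ F → Symmetric₃ (induced F)
    induced-sym F = record
      { swap₁₂ = λ x y z → cong F (trans (sym (∪-assoc ⁅ x ⁆ ⁅ y ⁆ ⁅ z ⁆))
          (trans (cong (_∪ ⁅ z ⁆) (∪-comm ⁅ x ⁆ ⁅ y ⁆)) (∪-assoc ⁅ y ⁆ ⁅ x ⁆ ⁅ z ⁆)))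
      ; swap₂₃ = λ x y z → cong (λ s → F (⁅ x ⁆ ∪ s)) (∪-comm ⁅ y ⁆ ⁅ z ⁆)
      }

    ∈-triple : ∀ {x a b c} → x ∈ₛ triple a b c → x ≡ a ⊎ x ≡ b ⊎ x ≡ c
    ∈-triple {a = a} {b} {c} x∈ with x∈p∪q⁻ ⁅ a ⁆ _ x∈
    ... | inj₁ x∈a = inj₁ (x∈⁅y⁆⇒x≡y a x∈a)
    ... | inj₂ x∈bc with x∈p∪q⁻ ⁅ b ⁆ _ x∈bc
    ...   | inj₁ x∈b = inj₂ (inj₁ (x∈⁅y⁆⇒x≡y b x∈b))
    ...   | inj₂ x∈c = inj₂ (inj₂ (x∈⁅y⁆⇒x≡y c x∈c))

    a∈triple : ∀ a b c → a ∈ₛ triple a b c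
    a∈triple a b c = x∈p∪q⁺ (inj₁ (x∈⁅x⁆ a))
    b∈triple : ∀ a b c → b ∈ₛ triple a b c
    b∈triple a b c = x∈p∪q⁺ (inj₂ (x∈p∪q⁺ (inj₁ (x∈⁅x⁆ b))))
    c∈triple : ∀ a b c → c ∈ₛ triple a b c
    c∈triple a b c = x∈p∪q⁺ (inj₂ (x∈p∪q⁺ (inj₂ (x∈⁅x⁆ c))))

    module _ (P : Fin n → Bool) where

      ∈-tabulate : ∀ {x} → P x ≡ true → x ∈ₛ tabulate P
      ∈-tabulate {x} Px = lookup⇒[]= x (tabulate P) (trans (lookup∘tabulate P x) Px)

      ∈-tabulate⁻ : ∀ {x} → x ∈ₛ tabulate P → P x ≡ true
      ∈-tabulate⁻ {x} x∈ = trans (sym (lookup∘tabulate P x)) ([]=⇒lookup x∈)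

      false≢true : ∀ {p} → p ≡ false → p ≡ true → ⊥
      false≢true refl ()

      triple-⊆ : ∀ a b c → does (triple a b c ⊆? tabulate P) ≡ (P a ∧ P b) ∧ P c
      triple-⊆ a b c with decide (P a) | decide (P b) | decide (P c)
      ... | inj₁ Pa | inj₁ Pb | inj₁ Pc = trans
        (dec-true (triple a b c ⊆? tabulate P) λ x∈ → ∈-tabulate (case ∈-triple x∈ of λ where
          (inj₁ refl) → Pa
          (inj₂ (inj₁ refl)) → Pb
          (inj₂ (inj₂ refl)) → Pc))
        (sym (cong₂ _∧_ (cong₂ _∧_ Pa Pb) Pc))
      ... | inj₂ ¬Pa | _ | _ = trans
        (dec-false (triple a b c ⊆? tabulate P) λ sub → false≢true ¬Pa (∈-tabulate⁻ (sub (a∈triple a b c))))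
        (sym (cong (λ p → (p ∧ P b) ∧ P c) ¬Pa))
      ... | inj₁ Pa | inj₂ ¬Pb | _ = trans
        (dec-false (triple a b c ⊆? tabulate P) λ sub → false≢true ¬Pb (∈-tabulate⁻ (sub (b∈triple a b c))))
        (sym (cong₂ (λ p q → (p ∧ q) ∧ P c) Pa ¬Pb))
      ... | inj₁ Pa | inj₁ Pb | inj₂ ¬Pc = trans
        (dec-false (triple a b c ⊆? tabulate P) λ sub → false≢true ¬Pc (∈-tabulate⁻ (sub (c∈triple a b c))))
        (sym (cong₂ _∧_ (cong₂ _∧_ Pa Pb) ¬Pc))

    join : (Fin n → Bool) → Bool → (F₁ F₂ : Subset n → Bool) → Subset n → Bool
    join P b F₁ F₂ s =
      if does (s ⊆? tabulate P) then F₁ s else if does (s ⊆? tabulate (not ∘ P)) then F₂ s else b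

    node : (p q r f g b : Bool) → Bool
    node p q r f g b = if (p ∧ q) ∧ r then f else if (not p ∧ not q) ∧ not r then g else b

    induced-join : ∀ P b F₁ F₂ x y z →
      induced (join P b F₁ F₂) x y z ≡ node (P x) (P y) (P z) (induced F₁ x y z) (induced F₂ x y z) b
    induced-join P b F₁ F₂ x y z = cong₂
      (λ s t → if s then induced F₁ x y z else if t then induced F₂ x y z else b)
      (triple-⊆ P x y z) (triple-⊆ (not ∘ P) x y z)

    -- Degenerate quadruples are included: constants satisfy this and `join` preserves it, so
    -- distinctness need not be carried along.
    D₂-free : (Subset n → Bool) → Set
    D₂-free F = ∀ a b c d → D₂ (induced F) a b c d ≡ 0

    two-const : ∀ b → two b b b b ≡ 0
    two-const false = refl
    two-const true  = refl

    -- A quadruple meeting both sides has at least three crossing triples, all of value `b`; with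
    -- three equal values the number of true ones is never two.
    two-node : ∀ p q r s f₁ f₂ f₃ f₄ g₁ g₂ g₃ g₄ b →
      two f₁ f₂ f₃ f₄ ≡ 0 → two g₁ g₂ g₃ g₄ ≡ 0 →
      two (node p q r f₁ g₁ b) (node p q s f₂ g₂ b) (node p r s f₃ g₃ b) (node q r s f₄ g₄ b) ≡ 0
    two-node p q r s f₁ f₂ f₃ f₄ g₁ g₂ g₃ g₄ b hf hg = by-side p q r s
      where
      at₁ : ∀ x b → two x b b b ≡ 0
      at₁ false false = refl
      at₁ false true  = refl
      at₁ true  false = refl
      at₁ true  true  = refl
      at₂ : ∀ x b → two b x b b ≡ 0
      at₂ false false = refl
      at₂ false true  = refl
      at₂ true  false = refl
      at₂ true  true  = refl
      at₃ : ∀ x b → two b b x b ≡ 0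
      at₃ false false = refl
      at₃ false true  = refl
      at₃ true  false = refl
      at₃ true  true  = refl
      at₄ : ∀ x b → two b b b x ≡ 0
      at₄ false false = refl
      at₄ false true  = refl
      at₄ true  false = refl
      at₄ true  true  = refl
      by-side : ∀ p q r s →
        two (node p q r f₁ g₁ b) (node p q s f₂ g₂ b) (node p r s f₃ g₃ b) (node q r s f₄ g₄ b) ≡ 0
      by-side true  true  true  true  = hf
      by-side true  true  true  false = at₁ f₁ b
      by-side true  true  false true  = at₂ f₂ b
      by-side true  false true  true  = at₃ f₃ b
      by-side false true  true  true  = at₄ f₄ b
      by-side true  true  false false = two-const b
      by-side true  false true  false = two-const b
      by-side true  false false true  = two-const b
      by-side false true  true  false = two-const b
      by-side false true  false true  = two-const b
      by-side false false true  true  = two-const b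
      by-side false false false true  = at₁ g₁ b
      by-side false false true  false = at₂ g₂ b
      by-side false true  false false = at₃ g₃ b
      by-side true  false false false = at₄ g₄ b
      by-side false false false false = hg

    join-D₂-free : ∀ P b F₁ F₂ → D₂-free F₁ → D₂-free F₂ → D₂-free (join P b F₁ F₂)
    join-D₂-free P β F₁ F₂ free₁ free₂ a b c d
      rewrite induced-join P β F₁ F₂ a b c | induced-join P β F₁ F₂ a b d
            | induced-join P β F₁ F₂ a c d | induced-join P β F₁ F₂ b c d =
      two-node (P a) (P b) (P c) (P d) _ _ _ _ _ _ _ _ β (free₁ a b c d) (free₂ a b c d)

    distance : List (Fin n) → (E E′ : Fin n → Fin n → Fin n → Bool) → ℕ
    distance l E E′ = ∑[ x ∈ l ] ∑[ y ∈ l ] ∑[ z ∈ l ] ⟦ E x y z xor E′ x y z ⟧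

    distance≤m³ : ∀ l E E′ → distance l E E′ ≤ length l * (length l * length l)
    distance≤m³ l E E′ = ∑-≤const l _ λ x → ∑-≤const l _ λ y → #≤length l _

    module _ (E : Fin n → Fin n → Fin n → Bool) (E-sym : Symmetric₃ E) where

      open Symmetric₃ E-sym

      -- A crossing triple has a vertex in `P` and one outside at some ordered pair of positions.
      -- Symmetry moves these to the front, and the six possible pairs give six times the one-sided
      -- count of `cut`.
      join-distance : ∀ l P b F₁ F₂ →
        distance l E (induced (join P b F₁ F₂)) ≤
        distance (filterᵇ P l) E (induced F₁) + distance (filterᵇ (not ∘ P) l) E (induced F₂)
        + 6 * (∑[ x ∈ l ] ∑[ y ∈ l ] ∑[ z ∈ l ] ⟦ (P x ∧ not (P y)) ∧ (E x y z xor b) ⟧)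
      join-distance l P b F₁ F₂ = begin
        distance l E (induced (join P b F₁ F₂))
          ≤⟨ (∑-≤+ l λ x → ∑-≤+ l λ y → ∑-≤+ l λ z → pointwise x y z) ⟩
        ∑³ (λ x y z → weighted P F₁ x y z + weighted (not ∘ P) F₂ x y z)
          + ∑³ (λ x y z → (k x y z + k x z y + k y x z) + (k z x y + k y z x + k z y x))
          ≡⟨ cong₂ _+_
               (trans (∑³-+ (weighted P F₁) _) (cong₂ _+_ (sym (distance-filter P F₁)) (sym (distance-filter (not ∘ P) F₂))))
               (trans (∑³-+ (λ x y z → k x y z + k x z y + k y x z) _) (cong₂ _+_
                 (trans (∑³-+ (λ x y z → k x y z + k x z y) _) (cong₂ _+_
                   (trans (∑³-+ k _) (cong (∑³ k +_) swap-yz))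
                   (∑-comm l l _)))
                 (trans (∑³-+ (λ x y z → k z x y + k y z x) _) (cong₂ _+_
                   (trans (∑³-+ (λ x y z → k z x y) _) (cong₂ _+_
                     (trans (∑-cong l λ x → ∑-comm l l _) (∑-comm l l _))
                     (trans (∑-comm l l _) (∑-cong l λ y → ∑-comm l l _))))
                   (trans (∑-cong l λ x → ∑-comm l l _)
                     (trans (∑-comm l l _) (∑-cong l λ z → ∑-comm l l _))))))) ⟩
        distance (filterᵇ P l) E (induced F₁) + distance (filterᵇ (not ∘ P) l) E (induced F₂)
          + ((∑³ k + ∑³ k + ∑³ k) + (∑³ k + ∑³ k + ∑³ k))
          ≡⟨ cong (distance (filterᵇ P l) E (induced F₁) + distance (filterᵇ (not ∘ P) l) E (induced F₂) +_)
               (six (∑³ k)) ⟩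
        distance (filterᵇ P l) E (induced F₁) + distance (filterᵇ (not ∘ P) l) E (induced F₂) + 6 * ∑³ k
          ∎
        where
        ∑³ : (Fin n → Fin n → Fin n → ℕ) → ℕ
        ∑³ f = ∑[ x ∈ l ] ∑[ y ∈ l ] ∑[ z ∈ l ] f x y z
        ∑³-+ : ∀ f g → ∑³ (λ x y z → f x y z + g x y z) ≡ ∑³ f + ∑³ g
        ∑³-+ f g = trans
          (∑-cong l λ x → trans (∑-cong l λ y → ∑-+ l (f x y) (g x y)) (∑-+ l _ _))
          (∑-+ l _ _)
        k : Fin n → Fin n → Fin n → ℕ
        k x y z = ⟦ (P x ∧ not (P y)) ∧ (E x y z xor b) ⟧
        swap-yz : ∑³ (λ x y z → k x z y) ≡ ∑³ k
        swap-yz = ∑-cong l λ x → ∑-comm l l _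
        six : ∀ k → (k + k + k) + (k + k + k) ≡ 6 * k
        six = solve-∀
        weighted : (Fin n → Bool) → (Subset n → Bool) → Fin n → Fin n → Fin n → ℕ
        weighted P F x y z = ⟦ P x ⟧ * (⟦ P y ⟧ * (⟦ P z ⟧ * ⟦ E x y z xor induced F x y z ⟧))
        distance-filter : ∀ P F → distance (filterᵇ P l) E (induced F) ≡ ∑³ (weighted P F)
        distance-filter P F = trans (∑-filter l P _) (∑-cong l λ x → trans
          (cong (⟦ P x ⟧ *_) (trans (∑-filter l P _) (∑-cong l λ y → trans
            (cong (⟦ P y ⟧ *_) (∑-filter l P _)) (sym (∑-*ˡ l ⟦ P y ⟧ _)))))
          (trans (sym (∑-*ˡ l ⟦ P x ⟧ _)) (∑-cong l λ y → sym (∑-*ˡ l ⟦ P x ⟧ _))))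
        pointwise : ∀ x y z → ⟦ E x y z xor induced (join P b F₁ F₂) x y z ⟧ ≤
          (weighted P F₁ x y z + weighted (not ∘ P) F₂ x y z)
          + ((k x y z + k x z y + k y x z) + (k z x y + k y z x + k z y x))
        pointwise x y z
          rewrite induced-join P b F₁ F₂ x y z
                | swap₁₂ z x y | swap₂₃ y z x | swap₂₃ x z y | swap₁₂ y x z
                | swap₁₂ z y x | swap₂₃ y z x | swap₁₂ y x z =
          by-valuation 7
            (λ { (p ∷ q ∷ r ∷ e ∷ f ∷ g ∷ b ∷ []) → ⟦ e xor node p q r f g b ⟧ })
            (λ { (p ∷ q ∷ r ∷ e ∷ f ∷ g ∷ b ∷ []) →
              (⟦ p ⟧ * (⟦ q ⟧ * (⟦ r ⟧ * ⟦ e xor f ⟧)) + ⟦ not p ⟧ * (⟦ not q ⟧ * (⟦ not r ⟧ * ⟦ e xor g ⟧)))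
              + ((⟦ (p ∧ not q) ∧ (e xor b) ⟧ + ⟦ (p ∧ not r) ∧ (e xor b) ⟧ + ⟦ (q ∧ not p) ∧ (e xor b) ⟧)
               + (⟦ (r ∧ not p) ∧ (e xor b) ⟧ + ⟦ (q ∧ not r) ∧ (e xor b) ⟧ + ⟦ (r ∧ not q) ∧ (e xor b) ⟧)) })
            (P x ∷ P y ∷ P z ∷ E x y z ∷ induced F₁ x y z ∷ induced F₂ x y z ∷ b ∷ [])

  ∑-filter≤ : ∀ {A : Set} (l : List A) P f → ∑ (filterᵇ P l) f ≤ ∑ l f
  ∑-filter≤ l P f = ≤-trans (m≤m+n _ _) (≤-reflexive (sym (∑-split l P f)))

  ∑-D₂-filter : ∀ {A : Set} (l : List A) P E → ∑-D₂ (filterᵇ P l) E ≤ ∑-D₂ l E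
  ∑-D₂-filter l P E = ≤-trans
    (∑-mono (filterᵇ P l) λ a → ≤-trans
      (∑-mono (filterᵇ P l) λ b → ≤-trans
        (∑-mono (filterᵇ P l) λ c → ∑-filter≤ l P _)
        (∑-filter≤ l P _))
      (∑-filter≤ l P _))
    (∑-filter≤ l P _)

  -- Fitting the scales to a set of given size.

  module Scale (p : ℕ) (16≤p : 16 ≤ p) where

    open Base p 16≤p

    opaque

      -- For a set of size `m` the scale `e` will be `m / β`, which makes `b * θ` equal to `e * β`;
      -- the extra factor `b` in `M` absorbs the rounding and gives `m ≤ M * e`.
      β M : ℕ
      β = b * b * b * (b * b * b) * b
      M = b * β

      β≡ : β ≡ b * b * b * (b * b * b) * b
      β≡ = refl

      M≡ : M ≡ b * β
      M≡ = refl

    instance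
      β≢0 : NonZero β
      β≢0 = >-nonZero (≤-trans (*-mono-≤ (*-mono-≤ 1≤b³ 1≤b³) 1≤b) (≤-reflexive (sym β≡)))

    1≤M : 1 ≤ M
    1≤M = ≤-trans (*-mono-≤ 1≤b (>-nonZero⁻¹ β)) (≤-reflexive (sym M≡))

    p⁴≤b : p * p * (p * p) ≤ b
    p⁴≤b = begin
      p * p * (p * p)                  ≡⟨ *-identityˡ _ ⟨
      1 * (p * p * (p * p))            ≤⟨ *-monoˡ-≤ (p * p * (p * p)) (*-mono-≤ 1≤κ 1≤κ) ⟩
      κ * κ * (p * p * (p * p))        ≡⟨ *-assoc (κ * κ) (p * p) (p * p) ⟨
      κ * κ * (p * p) * (p * p)        ≡⟨ b≡ ⟨
      b                                ∎

    p≤b : p ≤ b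
    p≤b = begin
      p                    ≡⟨ trans (*-identityʳ (1 * p)) (*-identityˡ p) ⟨
      1 * p * 1            ≤⟨ *-mono-≤ (*-monoˡ-≤ p 1≤p) (*-mono-≤ 1≤p 1≤p) ⟩
      p * p * (p * p)      ≤⟨ p⁴≤b ⟩
      b                    ∎

    5p⁴≤b² : 5 * (p * p * (p * p)) ≤ b * b
    5p⁴≤b² = *-mono-≤ (≤-trans (≤ᵇ⇒≤ 5 256 _) 256≤b) p⁴≤b

    module Large (n q m D : ℕ) (q≤p : q ≤ p) (M≤n : M ≤ n) (large : n * n < q * (m * m))
                 (few : b * b * (b * b) * D * (M * M * (M * M)) ≤ n * n * (n * n)) where

      n<pm : n < p * m
      n<pm = ≰⇒> λ pm≤n → <-irrefl refl (begin-strict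
        n * n              <⟨ large ⟩
        q * (m * m)        ≤⟨ *-monoˡ-≤ (m * m) (≤-trans q≤p (≤-trans (≤-reflexive (sym (*-identityʳ p))) (*-monoʳ-≤ p 1≤p))) ⟩
        p * p * (m * m)    ≡⟨ shape p m ⟩
        p * m * (p * m)    ≤⟨ *-mono-≤ pm≤n pm≤n ⟩
        n * n              ∎)
        where
        shape : ∀ p m → p * p * (m * m) ≡ p * m * (p * m)
        shape = solve-∀

      β≤m : β ≤ m
      β≤m = *-cancelˡ-≤ p {{>-nonZero 1≤p}} (begin
        p * β    ≤⟨ *-monoˡ-≤ β p≤b ⟩
        b * β    ≡⟨ M≡ ⟨
        M        ≤⟨ M≤n ⟩
        n        ≤⟨ <⇒≤ n<pm ⟩
        p * m    ∎)

      e : ℕ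
      e = m / β

      1≤e : 1 ≤ e
      1≤e = m≥n⇒m/n>0 β≤m

      open Parameters p 16≤p m e 1≤e

      bθ≡ : b * θ ≡ e * β
      bθ≡ = trans (cong (b *_) (trans θ≡ (cong (b * b * b *_) u≡)))
        (trans (shape b e) (cong (e *_) (sym β≡)))
        where
        shape : ∀ b e → b * (b * b * b * (b * b * b * e)) ≡ e * (b * b * b * (b * b * b) * b)
        shape = solve-∀

      bθ≤m : b * θ ≤ m
      bθ≤m = ≤-trans (≤-reflexive bθ≡) (m/n*n≤m m β)

      m≤b²θ : m ≤ b * (b * θ)
      m≤b²θ = begin
        m                      ≡⟨ m≡m%n+[m/n]*n m β ⟩
        m % β + e * β          ≤⟨ +-monoˡ-≤ (e * β) (<⇒≤ (m%n<n m β)) ⟩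
        β + e * β              ≤⟨ +-monoˡ-≤ (e * β) (≤-trans (≤-reflexive (sym (*-identityˡ β))) (*-monoˡ-≤ β 1≤e)) ⟩
        e * β + e * β          ≡⟨ cong (e * β +_) (+-identityʳ (e * β)) ⟨
        2 * (e * β)            ≤⟨ *-monoˡ-≤ (e * β) (≤-trans (≤ᵇ⇒≤ 2 256 _) 256≤b) ⟩
        b * (e * β)            ≡⟨ cong (b *_) bθ≡ ⟨
        b * (b * θ)            ∎

      m≤Me : m ≤ M * e
      m≤Me = ≤-trans m≤b²θ (≤-reflexive (trans (cong (b *_) (trans bθ≡ (*-comm e β)))
        (trans (sym (*-assoc b β e)) (cong (_* e) (sym M≡)))))

      -- Of the b⁴ in `few`, half is what remains here; the other b² pays for 5 p⁴, where p⁴ comes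
      -- from n < p m.
      few-bad : b * (b * (5 * D)) ≤ e * (e * (e * e))
      few-bad = *-cancelˡ-≤ (p * p * (p * p) * (M * M * (M * M)))
        {{>-nonZero (*-mono-≤ (*-mono-≤ (*-mono-≤ 1≤p 1≤p) (*-mono-≤ 1≤p 1≤p))
                              (*-mono-≤ (*-mono-≤ 1≤M 1≤M) (*-mono-≤ 1≤M 1≤M)))}} (begin
        p * p * (p * p) * (M * M * (M * M)) * (b * (b * (5 * D)))
          ≡⟨ shape p M b D ⟩
        5 * (p * p * (p * p)) * (b * b * D * (M * M * (M * M)))
          ≤⟨ *-monoˡ-≤ (b * b * D * (M * M * (M * M))) 5p⁴≤b² ⟩
        b * b * (b * b * D * (M * M * (M * M)))
          ≡⟨ shape′ b D (M * M * (M * M)) ⟩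
        b * b * (b * b) * D * (M * M * (M * M))
          ≤⟨ few ⟩
        n * n * (n * n)
          ≤⟨ *-mono-≤ (*-mono-≤ n≤ n≤) (*-mono-≤ n≤ n≤) ⟩
        (p * (M * e)) * (p * (M * e)) * ((p * (M * e)) * (p * (M * e)))
          ≡⟨ shape″ p M e ⟩
        p * p * (p * p) * (M * M * (M * M)) * (e * (e * (e * e)))
          ∎)
        where
        n≤ : n ≤ p * (M * e)
        n≤ = ≤-trans (<⇒≤ n<pm) (*-monoʳ-≤ p m≤Me)
        shape : ∀ p M b D → p * p * (p * p) * (M * M * (M * M)) * (b * (b * (5 * D))) ≡
          5 * (p * p * (p * p)) * (b * b * D * (M * M * (M * M)))
        shape = solve-∀
        shape′ : ∀ b D x → b * b * (b * b * D * x) ≡ b * b * (b * b) * D * x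
        shape′ = solve-∀
        shape″ : ∀ p M e → (p * (M * e)) * (p * (M * e)) * ((p * (M * e)) * (p * (M * e))) ≡
          p * p * (p * p) * (M * M * (M * M)) * (e * (e * (e * e)))
        shape″ = solve-∀

  -- Recursive splitting.

  module Approximate {n : ℕ} (E : Fin n → Fin n → Fin n → Bool) (E-sym : Symmetric₃ E)
                     (p q : ℕ) (16≤p : 16 ≤ p) (2q≤p : 2 * q ≤ p) where

    open Base p 16≤p
    open Scale p 16≤p

    -- The budget adds up under splitting: (m₁ + m₂)³ exceeds m₁³ + m₂³ by exactly 3 m₁ m₂ (m₁ +
    -- m₂), which pays for the cut, and the summand with n² pays for sets too small to be
    -- decomposed. On the whole vertex set it amounts to 2 n³.
    record Approximation (l : List (Fin n)) : Set where
      field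
        F     : Subset n → Bool
        free  : D₂-free F
        close : q * distance l E (induced F) ≤
                length l * (length l * length l) + length l * (n * n)

    private
      q≤p : q ≤ p
      q≤p = ≤-trans (m≤m+n q _) 2q≤p

    join-approximations : ∀ l P b →
      p * (∑[ x ∈ l ] ∑[ y ∈ l ] ∑[ z ∈ l ] ⟦ (P x ∧ not (P y)) ∧ (E x y z xor b) ⟧) ≤
        # l P * # l (not ∘ P) * length l →
      Approximation (filterᵇ P l) → Approximation (filterᵇ (not ∘ P) l) → Approximation l
    join-approximations l P b bound A₁ A₂ = record
      { F = join P b A₁.F A₂.F
      ; free = join-D₂-free P b A₁.F A₂.F A₁.free A₂.free
      ; close = begin
          q * distance l E (induced (join P b A₁.F A₂.F))
            ≤⟨ *-monoʳ-≤ q (join-distance E E-sym l P b A₁.F A₂.F) ⟩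
          q * (d₁ + d₂ + 6 * K)
            ≡⟨ expand q d₁ d₂ K ⟩
          q * d₁ + q * d₂ + 3 * (2 * q * K)
            ≤⟨ +-mono-≤ (+-mono-≤ A₁.close A₂.close)
                 (*-monoʳ-≤ 3 (≤-trans (*-monoˡ-≤ K 2q≤p) bound)) ⟩
          length (filterᵇ P l) * (length (filterᵇ P l) * length (filterᵇ P l)) + length (filterᵇ P l) * (n * n)
            + (length (filterᵇ (not ∘ P) l) * (length (filterᵇ (not ∘ P) l) * length (filterᵇ (not ∘ P) l))
               + length (filterᵇ (not ∘ P) l) * (n * n))
            + 3 * (# l P * # l (not ∘ P) * length l)
            ≡⟨ cong₂ (λ i j → i * (i * i) + i * (n * n) + (j * (j * j) + j * (n * n)) + 3 * (# l P * # l (not ∘ P) * length l))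
                 (length-filter l P) (length-filter l (not ∘ P)) ⟩
          m₁ * (m₁ * m₁) + m₁ * (n * n) + (m₂ * (m₂ * m₂) + m₂ * (n * n)) + 3 * (m₁ * m₂ * length l)
            ≡⟨ cong (λ m → m₁ * (m₁ * m₁) + m₁ * (n * n) + (m₂ * (m₂ * m₂) + m₂ * (n * n)) + 3 * (m₁ * m₂ * m)) (#-not l P) ⟨
          m₁ * (m₁ * m₁) + m₁ * (n * n) + (m₂ * (m₂ * m₂) + m₂ * (n * n)) + 3 * (m₁ * m₂ * (m₁ + m₂))
            ≡⟨ cube m₁ m₂ n ⟩
          (m₁ + m₂) * ((m₁ + m₂) * (m₁ + m₂)) + (m₁ + m₂) * (n * n)
            ≡⟨ cong (λ m → m * (m * m) + m * (n * n)) (#-not l P) ⟩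
          length l * (length l * length l) + length l * (n * n)
            ∎
      }
      where
      module A₁ = Approximation A₁
      module A₂ = Approximation A₂
      d₁ d₂ K m₁ m₂ : ℕ
      d₁ = distance (filterᵇ P l) E (induced A₁.F)
      d₂ = distance (filterᵇ (not ∘ P) l) E (induced A₂.F)
      K = ∑[ x ∈ l ] ∑[ y ∈ l ] ∑[ z ∈ l ] ⟦ (P x ∧ not (P y)) ∧ (E x y z xor b) ⟧
      m₁ = # l P
      m₂ = # l (not ∘ P)
      expand : ∀ q d d′ k → q * (d + d′ + 6 * k) ≡ q * d + q * d′ + 3 * (2 * q * k)
      expand = solve-∀
      cube : ∀ i j n → i * (i * i) + i * (n * n) + (j * (j * j) + j * (n * n)) + 3 * (i * j * (i + j)) ≡
        (i + j) * ((i + j) * (i + j)) + (i + j) * (n * n)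
      cube = solve-∀

    constant : ∀ l b → q * distance l E (λ _ _ _ → b) ≤
      length l * (length l * length l) + length l * (n * n) → Approximation l
    constant l b bound = record { F = λ _ → b ; free = λ _ _ _ _ → two-const {n} b ; close = bound }

    -- `k` bounds the length and drives the recursion. The hypothesis on copies refers to `n` rather
    -- than to the length of `l`, so it passes unchanged to both parts.
    approximate : M ≤ n → ∀ k l → length l ≤ k →
      b * b * (b * b) * ∑-D₂ l E * (M * M * (M * M)) ≤ n * n * (n * n) → Approximation l
    approximate M≤n k l l≤k few with n * n <? q * (length l * length l)
    ... | no small = constant l false (begin
        q * distance l E (λ _ _ _ → false)
          ≤⟨ *-monoʳ-≤ q (distance≤m³ l E (λ _ _ _ → false)) ⟩
        q * (length l * (length l * length l))
          ≡⟨ shape q (length l) (length l * length l) ⟩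
        length l * (q * (length l * length l))
          ≤⟨ *-monoʳ-≤ (length l) (≮⇒≥ small) ⟩
        length l * (n * n)
          ≤⟨ m≤n+m _ _ ⟩
        length l * (length l * length l) + length l * (n * n)
          ∎)
      where
      shape : ∀ q m s → q * (m * s) ≡ m * (q * s)
      shape = solve-∀
    approximate M≤n k l l≤k few | yes large = by-decomposition k l≤k
        (decomposition l p 16≤p e 1≤e bθ≤m m≤b²θ E E-sym few-bad)
      where
      open Large n q (length l) (∑-D₂ l E) q≤p M≤n large few
      few-filter : ∀ P → b * b * (b * b) * ∑-D₂ (filterᵇ P l) E * (M * M * (M * M)) ≤ n * n * (n * n)
      few-filter P = ≤-trans (*-monoˡ-≤ (M * M * (M * M)) (*-monoʳ-≤ (b * b * (b * b)) (∑-D₂-filter l P E))) few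
      by-decomposition : ∀ k → length l ≤ k → Decomposition l E p → Approximation l
      by-decomposition k l≤k (leaf c bound) = constant l c
        (≤-trans (*-monoˡ-≤ (distance l E (λ _ _ _ → c)) q≤p) (≤-trans bound (m≤m+n _ _)))
      by-decomposition zero l≤0 (cut c P 1≤P 1≤P̄ bound) =
        ⊥-elim (<-irrefl refl (<-≤-trans 1≤P (≤-trans (#≤length l P) l≤0)))
      by-decomposition (suc k) l≤k (cut c P 1≤P 1≤P̄ bound) = join-approximations l P c bound
        (approximate M≤n k (filterᵇ P l) (shrink P (not ∘ P) (#-not l P) 1≤P̄) (few-filter P))
        (approximate M≤n k (filterᵇ (not ∘ P) l)
          (shrink (not ∘ P) P (trans (+-comm (# l (not ∘ P)) _) (#-not l P)) 1≤P) (few-filter (not ∘ P)))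
        where
        shrink : ∀ P Q → # l P + # l Q ≡ length l → 1 ≤ # l Q → length (filterᵇ P l) ≤ k
        shrink P Q split 1≤Q = ≤-pred (begin
          suc (length (filterᵇ P l))    ≡⟨ trans (cong suc (length-filter l P)) (+-comm 1 (# l P)) ⟩
          # l P + 1                     ≤⟨ +-monoʳ-≤ (# l P) 1≤Q ⟩
          # l P + # l Q                 ≡⟨ split ⟩
          length l                      ≤⟨ l≤k ⟩
          suc k                         ∎)

  -- From ordered tuples to subsets.

  private
    variable
      n : ℕ
      A B : Set

  ∑-++ : ∀ (k l : List A) f → ∑ (k ++ l) f ≡ ∑ k f + ∑ l f
  ∑-++ []      l f = refl
  ∑-++ (x ∷ k) l f = trans (cong (f x +_) (∑-++ k l f)) (sym (+-assoc (f x) _ _))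

  ∑-map : ∀ (g : A → B) l f → ∑ (map g l) f ≡ ∑ l (f ∘ g)
  ∑-map g []      f = refl
  ∑-map g (x ∷ l) f = cong (f (g x) +_) (∑-map g l f)

  ∈⇒≤∑ : ∀ {l : List A} {x} f → x ∈ l → f x ≤ ∑ l f
  ∈⇒≤∑ f (here refl) = m≤m+n _ _
  ∈⇒≤∑ f (there x∈)  = ≤-trans (∈⇒≤∑ f x∈) (m≤n+m _ _)

  T⇒≡ : ∀ {b} → T b → b ≡ true
  T⇒≡ = Equivalence.to T-≡

  ≡⇒T : ∀ {b} → b ≡ true → T b
  ≡⇒T = Equivalence.from T-≡

  -- The comparison principle for all cardinalities below: `count` and `∣_∣` are turned into lengths
  -- of duplicate-free lists.
  unique-⊆⇒length≤ : ∀ {xs ys : List A} → Unique xs → (∀ {x} → x ∈ xs → x ∈ ys) → length xs ≤ length ys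
  unique-⊆⇒length≤ [] sub = z≤n
  unique-⊆⇒length≤ {xs = x ∷ xs} (x∉xs ∷ unique) sub with ∈-∃++ (sub (here refl))
  ... | as , bs , refl = begin
    suc (length xs)              ≤⟨ s≤s (unique-⊆⇒length≤ unique within) ⟩
    suc (length (as ++ bs))      ≡⟨ cong suc (length-++ as) ⟩
    suc (length as + length bs)  ≡⟨ +-suc (length as) (length bs) ⟨
    length as + suc (length bs)  ≡⟨ length-++ as ⟨
    length (as ++ x ∷ bs)        ∎
    where
    within : ∀ {y} → y ∈ xs → y ∈ as ++ bs
    within y∈ with ∈-++⁻ as (sub (there y∈))
    ... | inj₁ y∈as = ∈-++⁺ˡ y∈as
    ... | inj₂ (here refl) = ⊥-elim (All.lookup x∉xs y∈ refl)
    ... | inj₂ (there y∈bs) = ∈-++⁺ʳ as y∈bs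

  ∈-subsets : ∀ (s : Subset n) → s ∈ subsets n
  ∈-subsets []            = here refl
  ∈-subsets (outside ∷ s) = ∈-++⁺ˡ (∈-map⁺ (outside ∷_) (∈-subsets s))
  ∈-subsets (inside  ∷ s) = ∈-++⁺ʳ (map (outside ∷_) (subsets _)) (∈-map⁺ (inside ∷_) (∈-subsets s))

  subsets-unique : ∀ n → Unique (subsets n)
  subsets-unique zero    = [] ∷ []
  subsets-unique (suc n) = ++⁺ (map⁺ ∷-injectiveʳ (subsets-unique n)) (map⁺ ∷-injectiveʳ (subsets-unique n))
    λ (o , i) → case ∈-map⁻ _ o , ∈-map⁻ _ i of λ where
      ((_ , _ , refl) , (_ , _ , ()))

  ∣∣-as-# : ∀ (s : Subset n) → # (allFin n) (lookup s) ≡ ∣ s ∣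
  ∣∣-as-# []      = refl
  ∣∣-as-# {suc n} (b ∷ s) = trans
    (cong (⟦ b ⟧ +_) (trans (cong (λ l → ∑ l (λ x → ⟦ lookup (b ∷ s) x ⟧)) (sym (map-tabulate id suc)))
      (trans (∑-map suc (allFin n) _) (∣∣-as-# s))))
    (head b)
    where
    head : ∀ b → ⟦ b ⟧ + ∣ s ∣ ≡ ∣ b ∷ s ∣
    head false = refl
    head true  = refl

  elements : Subset n → List (Fin n)
  elements {n} s = filterᵇ (lookup s) (allFin n)

  elements-unique : ∀ (s : Subset n) → Unique (elements s)
  elements-unique {n} s = filter⁺ (T? ∘ lookup s) (allFin⁺ n)

  ∈-elements⁺ : ∀ {s : Subset n} {x} → x ∈ₛ s → x ∈ elements s
  ∈-elements⁺ {s = s} {x} x∈ = ∈-filter⁺ (T? ∘ lookup s) (∈-allFin x) (≡⇒T ([]=⇒lookup x∈))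

  ∈-elements⁻ : ∀ {s : Subset n} {x} → x ∈ elements s → x ∈ₛ s
  ∈-elements⁻ {s = s} {x} x∈ =
    lookup⇒[]= x s (T⇒≡ (proj₂ (∈-filter⁻ (T? ∘ lookup s) {xs = allFin _} x∈)))

  length-elements : ∀ (s : Subset n) → length (elements s) ≡ ∣ s ∣
  length-elements {n} s = trans (length-filter (allFin n) (lookup s)) (∣∣-as-# s)

  ∣∣≡length : ∀ {s : Subset n} {xs} → Unique xs → (∀ {x} → x ∈ xs → x ∈ₛ s) → (∀ {x} → x ∈ₛ s → x ∈ xs) →
    ∣ s ∣ ≡ length xs
  ∣∣≡length {s = s} unique to from = trans (sym (length-elements s)) (≤-antisym
    (unique-⊆⇒length≤ (elements-unique s) (from ∘ ∈-elements⁻))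
    (unique-⊆⇒length≤ unique (∈-elements⁺ ∘ to)))

  ⊆-≥⇒≡ : ∀ {s t : Subset n} → s ⊆ t → ∣ t ∣ ≤ ∣ s ∣ → s ≡ t
  ⊆-≥⇒≡ {s = s} {t} s⊆t t≤s = ⊆-antisym s⊆t t⊆s
    where
    t⊆s : t ⊆ s
    t⊆s {x} x∈t with x ∈? s
    ... | yes x∈s = x∈s
    ... | no  x∉s = ⊥-elim (<⇒≱ (p⊂q⇒∣p∣<∣q∣ (s⊆t , x , x∈t , x∉s)) t≤s)

  triple-from : ∀ {a b c : Fin n} {s} → a ∈ₛ s → b ∈ₛ s → c ∈ₛ s → triple a b c ⊆ s
  triple-from a∈ b∈ c∈ x∈ = case ∈-triple x∈ of λ where
    (inj₁ refl) → a∈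
    (inj₂ (inj₁ refl)) → b∈
    (inj₂ (inj₂ refl)) → c∈

  ∈-list₃ : ∀ {x a b c : Fin n} → x ∈ a ∷ b ∷ c ∷ [] → x ∈ₛ triple a b c
  ∈-list₃ {a = a} {b} {c} (here refl) = a∈triple a b c
  ∈-list₃ {a = a} {b} {c} (there (here refl)) = b∈triple a b c
  ∈-list₃ {a = a} {b} {c} (there (there (here refl))) = c∈triple a b c

  ∣triple∣ : ∀ {a b c : Fin n} → Unique (a ∷ b ∷ c ∷ []) → ∣ triple a b c ∣ ≡ 3
  ∣triple∣ unique = ∣∣≡length unique ∈-list₃ λ x∈ → case ∈-triple x∈ of λ where
    (inj₁ refl) → here refl
    (inj₂ (inj₁ refl)) → there (here refl)
    (inj₂ (inj₂ refl)) → there (there (here refl))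

  ∣s∣≡3⇒triple : ∀ (s : Subset n) → ∣ s ∣ ≡ 3 → ∃[ a ] ∃[ b ] ∃[ c ] s ≡ triple a b c
  ∣s∣≡3⇒triple s ∣s∣≡3 = from-list (elements s) (trans (length-elements s) ∣s∣≡3) ∈-elements⁻ ∈-elements⁺
    where
    from-list : ∀ xs → length xs ≡ 3 → (∀ {x} → x ∈ xs → x ∈ₛ s) → (∀ {x} → x ∈ₛ s → x ∈ xs) →
      ∃[ a ] ∃[ b ] ∃[ c ] s ≡ triple a b c
    from-list (a ∷ b ∷ c ∷ []) refl to from = a , b , c , ⊆-antisym (∈-list₃ ∘ from)
      (triple-from (to (here refl)) (to (there (here refl))) (to (there (there (here refl)))))

  quad : Fin n → Fin n → Fin n → Fin n → Subset n
  quad a b c d = ⁅ a ⁆ ∪ triple b c d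

  ∈-quad : ∀ {x a b c d : Fin n} → x ∈ₛ quad a b c d → x ∈ a ∷ b ∷ c ∷ d ∷ []
  ∈-quad {a = a} x∈ with x∈p∪q⁻ ⁅ a ⁆ _ x∈
  ... | inj₁ x∈a = here (x∈⁅y⁆⇒x≡y a x∈a)
  ... | inj₂ x∈bcd with ∈-triple x∈bcd
  ...   | inj₁ x≡b = there (here x≡b)
  ...   | inj₂ (inj₁ x≡c) = there (there (here x≡c))
  ...   | inj₂ (inj₂ x≡d) = there (there (there (here x≡d)))

  quad-∈ : ∀ {x a b c d : Fin n} → x ∈ a ∷ b ∷ c ∷ d ∷ [] → x ∈ₛ quad a b c d
  quad-∈ {a = a} (here refl) = x∈p∪q⁺ (inj₁ (x∈⁅x⁆ a))
  quad-∈ (there x∈) = x∈p∪q⁺ (inj₂ (∈-list₃ x∈))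

  ∣quad∣ : ∀ {a b c d : Fin n} → Unique (a ∷ b ∷ c ∷ d ∷ []) → ∣ quad a b c d ∣ ≡ 4
  ∣quad∣ unique = ∣∣≡length unique quad-∈ ∈-quad

  ∣s∣≡4⇒quad : ∀ (s : Subset n) → ∣ s ∣ ≡ 4 →
    ∃[ a ] ∃[ b ] ∃[ c ] ∃[ d ] (Unique (a ∷ b ∷ c ∷ d ∷ []) × s ≡ quad a b c d)
  ∣s∣≡4⇒quad s ∣s∣≡4 =
    from-list (elements s) (trans (length-elements s) ∣s∣≡4) (elements-unique s) ∈-elements⁻ ∈-elements⁺
    where
    from-list : ∀ xs → length xs ≡ 4 → Unique xs → (∀ {x} → x ∈ xs → x ∈ₛ s) → (∀ {x} → x ∈ₛ s → x ∈ xs) →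
      ∃[ a ] ∃[ b ] ∃[ c ] ∃[ d ] (Unique (a ∷ b ∷ c ∷ d ∷ []) × s ≡ quad a b c d)
    from-list (a ∷ b ∷ c ∷ d ∷ []) refl unique to from =
      a , b , c , d , unique , ⊆-antisym (quad-∈ ∘ from) (to ∘ ∈-quad)

  module _ {a b c d : Fin n} (unique : Unique (a ∷ b ∷ c ∷ d ∷ [])) where

    private
      a≢b : a ≢ b
      a≢b = All.lookup (case unique of λ { (p ∷ _) → p }) (here refl)
      a≢c : a ≢ c
      a≢c = All.lookup (case unique of λ { (p ∷ _) → p }) (there (here refl))
      a≢d : a ≢ d
      a≢d = All.lookup (case unique of λ { (p ∷ _) → p }) (there (there (here refl)))
      b≢c : b ≢ c
      b≢c = All.lookup (case unique of λ { (_ ∷ p ∷ _) → p }) (here refl)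
      b≢d : b ≢ d
      b≢d = All.lookup (case unique of λ { (_ ∷ p ∷ _) → p }) (there (here refl))
      c≢d : c ≢ d
      c≢d = All.lookup (case unique of λ { (_ ∷ _ ∷ p ∷ _) → p }) (here refl)

      ∉-triple : ∀ {x p q r : Fin n} → x ≢ p → x ≢ q → x ≢ r → x ∉ₛ triple p q r
      ∉-triple x≢p x≢q x≢r x∈ = case ∈-triple x∈ of λ where
        (inj₁ x≡p) → x≢p x≡p
        (inj₂ (inj₁ x≡q)) → x≢q x≡q
        (inj₂ (inj₂ x≡r)) → x≢r x≡r

      separated : ∀ {x} {s t : Subset n} → x ∈ₛ s → x ∉ₛ t → s ≢ t
      separated x∈s x∉t refl = x∉t x∈s

    ∣abc∣ : ∣ triple a b c ∣ ≡ 3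
    ∣abc∣ = ∣triple∣ ((a≢b ∷ a≢c ∷ []) ∷ (b≢c ∷ []) ∷ [] ∷ [])
    ∣abd∣ : ∣ triple a b d ∣ ≡ 3
    ∣abd∣ = ∣triple∣ ((a≢b ∷ a≢d ∷ []) ∷ (b≢d ∷ []) ∷ [] ∷ [])
    ∣acd∣ : ∣ triple a c d ∣ ≡ 3
    ∣acd∣ = ∣triple∣ ((a≢c ∷ a≢d ∷ []) ∷ (c≢d ∷ []) ∷ [] ∷ [])
    ∣bcd∣ : ∣ triple b c d ∣ ≡ 3
    ∣bcd∣ = ∣triple∣ ((b≢c ∷ b≢d ∷ []) ∷ (c≢d ∷ []) ∷ [] ∷ [])

    triples : List (Subset n)
    triples = triple a b c ∷ triple a b d ∷ triple a c d ∷ triple b c d ∷ []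

    triples-unique : Unique triples
    triples-unique =
      (separated (c∈triple a b c) (∉-triple (a≢c ∘ sym) (b≢c ∘ sym) c≢d)
        ∷ separated (b∈triple a b c) (∉-triple (a≢b ∘ sym) b≢c b≢d)
        ∷ separated (a∈triple a b c) (∉-triple a≢b a≢c a≢d) ∷ [])
      ∷ (separated (b∈triple a b d) (∉-triple (a≢b ∘ sym) b≢c b≢d)
        ∷ separated (a∈triple a b d) (∉-triple a≢b a≢c a≢d) ∷ [])
      ∷ (separated (a∈triple a c d) (∉-triple a≢b a≢c a≢d) ∷ [])
      ∷ [] ∷ []

    triples-in-quad : ∀ {s} → s ∈ triples → s ⊆ quad a b c d
    triples-in-quad (here refl) = triple-from (quad-∈ (here refl)) (quad-∈ (there (here refl))) (quad-∈ (there (there (here refl))))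
    triples-in-quad (there (here refl)) = triple-from (quad-∈ (here refl)) (quad-∈ (there (here refl))) (quad-∈ (there (there (there (here refl)))))
    triples-in-quad (there (there (here refl))) = triple-from (quad-∈ (here refl)) (quad-∈ (there (there (here refl)))) (quad-∈ (there (there (there (here refl)))))
    triples-in-quad (there (there (there (here refl)))) = triple-from (quad-∈ (there (here refl))) (quad-∈ (there (there (here refl)))) (quad-∈ (there (there (there (here refl)))))

    3-subsets-of-quad : ∀ {s} → s ⊆ quad a b c d → ∣ s ∣ ≡ 3 → s ∈ triples
    3-subsets-of-quad {s} s⊆ ∣s∣≡3 with a ∈? s | b ∈? s | c ∈? s | d ∈? s
    ... | no a∉ | _ | _ | _ = there (there (there (here (⊆-≥⇒≡ within (≤-reflexive (trans ∣bcd∣ (sym ∣s∣≡3)))))))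
      where
      within : s ⊆ triple b c d
      within x∈ with ∈-quad (s⊆ x∈)
      ... | here refl = ⊥-elim (a∉ x∈)
      ... | there x∈bcd = ∈-list₃ x∈bcd
    ... | yes _ | no b∉ | _ | _ = there (there (here (⊆-≥⇒≡ within (≤-reflexive (trans ∣acd∣ (sym ∣s∣≡3))))))
      where
      within : s ⊆ triple a c d
      within x∈ with ∈-quad (s⊆ x∈)
      ... | here refl = a∈triple a c d
      ... | there (here refl) = ⊥-elim (b∉ x∈)
      ... | there (there (here refl)) = b∈triple a c d
      ... | there (there (there (here refl))) = c∈triple a c d
    ... | yes _ | yes _ | no c∉ | _ = there (here (⊆-≥⇒≡ within (≤-reflexive (trans ∣abd∣ (sym ∣s∣≡3)))))
      where
      within : s ⊆ triple a b d
      within x∈ with ∈-quad (s⊆ x∈)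
      ... | here refl = a∈triple a b d
      ... | there (here refl) = b∈triple a b d
      ... | there (there (here refl)) = ⊥-elim (c∉ x∈)
      ... | there (there (there (here refl))) = c∈triple a b d
    ... | yes _ | yes _ | yes _ | no d∉ = here (⊆-≥⇒≡ within (≤-reflexive (trans ∣abc∣ (sym ∣s∣≡3))))
      where
      within : s ⊆ triple a b c
      within x∈ with ∈-quad (s⊆ x∈)
      ... | here refl = a∈triple a b c
      ... | there (here refl) = b∈triple a b c
      ... | there (there (here refl)) = c∈triple a b c
      ... | there (there (there (here refl))) = ⊥-elim (d∉ x∈)
    ... | yes a∈ | yes b∈ | yes c∈ | yes d∈ = ⊥-elim (n≮n 3 (begin
      4                   ≡⟨ ∣quad∣ unique ⟨
      ∣ quad a b c d ∣    ≤⟨ p⊆q⇒∣p∣≤∣q∣ all-in ⟩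
      ∣ s ∣               ≡⟨ ∣s∣≡3 ⟩
      3                   ∎))
      where
      all-in : quad a b c d ⊆ s
      all-in x∈ with ∈-quad x∈
      ... | here refl = a∈
      ... | there (here refl) = b∈
      ... | there (there (here refl)) = c∈
      ... | there (there (there (here refl))) = d∈

    -- By uniformity an edge inside the quadruple has three elements, hence is one of its four
    -- distinct triples.
    #edgesIn-quad : ∀ H → #edgesIn H (quad a b c d) ≡
      ⟦ edge H (triple a b c) ⟧ + ⟦ edge H (triple a b d) ⟧ + ⟦ edge H (triple a c d) ⟧ + ⟦ edge H (triple b c d) ⟧
    #edgesIn-quad H = trans (≤-antisym
        (unique-⊆⇒length≤ (filter⁺ (edgeIn? H W) (subsets-unique n)) to)
        (unique-⊆⇒length≤ (filter⁺ (T? ∘ edge H) triples-unique) from))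
      (trans (length-filter triples (edge H))
        (regroup ⟦ edge H (triple a b c) ⟧ ⟦ edge H (triple a b d) ⟧ ⟦ edge H (triple a c d) ⟧ ⟦ edge H (triple b c d) ⟧))
      where
      W = quad a b c d
      to : ∀ {s} → s ∈ filter (edgeIn? H W) (subsets n) → s ∈ filter (T? ∘ edge H) triples
      to {s} s∈ with ∈-filter⁻ (edgeIn? H W) {xs = subsets n} s∈
      ... | _ , e , s⊆ = ∈-filter⁺ (T? ∘ edge H) (3-subsets-of-quad s⊆ (uniform H s e)) e
      from : ∀ {s} → s ∈ filter (T? ∘ edge H) triples → s ∈ filter (edgeIn? H W) (subsets n)
      from {s} s∈ with ∈-filter⁻ (T? ∘ edge H) {xs = triples} s∈
      ... | s∈triples , e = ∈-filter⁺ (edgeIn? H W) (∈-subsets s) (e , triples-in-quad s∈triples)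
      regroup : ∀ p q r s → p + (q + (r + (s + 0))) ≡ p + q + r + s
      regroup = solve-∀

  #-≟ : ∀ (a : Fin n) → # (allFin n) (λ x → does (a ≟ x)) ≤ 1
  #-≟ {n} a = ≤-trans (∑-mono (allFin n) pointwise)
    (≤-reflexive (trans (∣∣-as-# ⁅ a ⁆) (∣⁅x⁆∣≡1 a)))
    where
    pointwise : ∀ x → ⟦ does (a ≟ x) ⟧ ≤ ⟦ lookup ⁅ a ⁆ x ⟧
    pointwise x with a ≟ x
    ... | no _ = z≤n
    ... | yes refl = ≤-reflexive (sym (cong ⟦_⟧ ([]=⇒lookup (x∈⁅x⁆ a))))

  two-≡2 : ∀ p q r s → two p q r s ≡ 1 → ⟦ p ⟧ + ⟦ q ⟧ + ⟦ r ⟧ + ⟦ s ⟧ ≡ 2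
  two-≡2 p q r s eq with ⟦ p ⟧ + ⟦ q ⟧ + ⟦ r ⟧ + ⟦ s ⟧
  ... | 0 = case eq of λ ()
  ... | 1 = case eq of λ ()
  ... | 2 = refl
  ... | suc (suc (suc _)) = case eq of λ ()

  module _ (H : Hypergraph₃ n) where

    private
      V = allFin n
      E = induced (edge H)

      ∣V∣ : length V ≡ n
      ∣V∣ = length-tabulate id

      copies : List (Subset n)
      copies = filter (isInducedD₂? H) (subsets n)

      in-copy : Fin n → Fin n → Fin n → Fin n → Subset n → ℕ
      in-copy a b c d s = ⟦ lookup s a ⟧ * (⟦ lookup s b ⟧ * (⟦ lookup s c ⟧ * ⟦ lookup s d ⟧))

      _==_ : Fin n → Fin n → ℕ
      a == b = ⟦ does (a ≟ b) ⟧

      degenerate : Fin n → Fin n → Fin n → Fin n → ℕ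
      degenerate a b c d = a == b + a == c + a == d + b == c + b == d + c == d

      D₂≤ : ∀ a b c d → D₂ E a b c d ≤ ∑ copies (in-copy a b c d) + degenerate a b c d
      D₂≤ a b c d with a ≟ b | a ≟ c | a ≟ d | b ≟ c | b ≟ d | c ≟ d
      ... | yes _ | ac | ad | bc | bd | cd = ≤-trans (⟦⟧≤1 _)
        (≤-trans (s≤s z≤n) (m≤n+m _ (∑ copies (in-copy a b c d))))
      ... | no _ | yes _ | ad | bc | bd | cd = ≤-trans (⟦⟧≤1 _)
        (≤-trans (s≤s z≤n) (m≤n+m _ (∑ copies (in-copy a b c d))))
      ... | no _ | no _ | yes _ | bc | bd | cd = ≤-trans (⟦⟧≤1 _)
        (≤-trans (s≤s z≤n) (m≤n+m _ (∑ copies (in-copy a b c d))))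
      ... | no _ | no _ | no _ | yes _ | bd | cd = ≤-trans (⟦⟧≤1 _)
        (≤-trans (s≤s z≤n) (m≤n+m _ (∑ copies (in-copy a b c d))))
      ... | no _ | no _ | no _ | no _ | yes _ | cd = ≤-trans (⟦⟧≤1 _)
        (≤-trans (s≤s z≤n) (m≤n+m _ (∑ copies (in-copy a b c d))))
      ... | no _ | no _ | no _ | no _ | no _ | yes _ = ≤-trans (⟦⟧≤1 _)
        (≤-trans (s≤s z≤n) (m≤n+m _ (∑ copies (in-copy a b c d))))
      ... | no a≢b | no a≢c | no a≢d | no b≢c | no b≢d | no c≢d = ≤-trans (⟦⟧≤ copy) (m≤m+n _ 0)
        where
        unique : Unique (a ∷ b ∷ c ∷ d ∷ [])
        unique = (a≢b ∷ a≢c ∷ a≢d ∷ []) ∷ (b≢c ∷ b≢d ∷ []) ∷ (c≢d ∷ []) ∷ [] ∷ []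
        inside-quad : ∀ {x} → x ∈ a ∷ b ∷ c ∷ d ∷ [] → lookup (quad a b c d) x ≡ true
        inside-quad x∈ = []=⇒lookup (quad-∈ x∈)
        copy : (⟦ E a b c ⟧ + ⟦ E a b d ⟧ + ⟦ E a c d ⟧ + ⟦ E b c d ⟧ ≡ᵇ 2) ≡ true → 1 ≤ ∑ copies (in-copy a b c d)
        copy eq = ≤-trans
          (≤-reflexive (sym (cong₂ _*_ (cong ⟦_⟧ (inside-quad (here refl)))
            (cong₂ _*_ (cong ⟦_⟧ (inside-quad (there (here refl))))
              (cong₂ _*_ (cong ⟦_⟧ (inside-quad (there (there (here refl)))))
                (cong ⟦_⟧ (inside-quad (there (there (there (here refl)))))))))))
          (∈⇒≤∑ (in-copy a b c d) (∈-filter⁺ (isInducedD₂? H) (∈-subsets (quad a b c d))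
            (∣quad∣ unique , trans (#edgesIn-quad unique H)
              (two-≡2 (E a b c) (E a b d) (E a c d) (E b c d) (cong ⟦_⟧ eq)))))

      V⁴ : (Fin n → Fin n → Fin n → Fin n → ℕ) → ℕ
      V⁴ f = ∑[ a ∈ V ] ∑[ b ∈ V ] ∑[ c ∈ V ] ∑[ d ∈ V ] f a b c d

      V⁴-+ : ∀ f g → V⁴ (λ a b c d → f a b c d + g a b c d) ≡ V⁴ f + V⁴ g
      V⁴-+ f g = trans (∑-cong V λ a → trans (∑-cong V λ b → trans (∑-cong V λ c →
        ∑-+ V (f a b c) (g a b c)) (∑-+ V _ _)) (∑-+ V _ _)) (∑-+ V _ _)

      -- Each copy contains 4⁴ = 256 ordered quadruples, repetitions included.
      copies-bound : V⁴ (λ a b c d → ∑ copies (in-copy a b c d)) ≤ 256 * #inducedD₂ H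
      copies-bound = begin
        V⁴ (λ a b c d → ∑ copies (in-copy a b c d))
          ≡⟨ (∑-cong V λ a → trans (∑-cong V λ b → trans (∑-cong V λ c → ∑-comm V copies _) (∑-comm V copies _)) (∑-comm V copies _)) ⟩
        ∑[ a ∈ V ] ∑[ s ∈ copies ] ∑[ b ∈ V ] ∑[ c ∈ V ] ∑[ d ∈ V ] in-copy a b c d s
          ≡⟨ ∑-comm V copies _ ⟩
        ∑[ s ∈ copies ] V⁴ (λ a b c d → in-copy a b c d s)
          ≡⟨ (∑-cong copies λ s → trans
               (∑-cong V λ a → trans (∑-cong V λ b → trans (∑-cong V λ c → trans
                 (∑-*ˡ V ⟦ lookup s a ⟧ _) (cong (⟦ lookup s a ⟧ *_) (trans (∑-*ˡ V ⟦ lookup s b ⟧ _)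
                   (cong (⟦ lookup s b ⟧ *_) (∑-*ˡ V ⟦ lookup s c ⟧ _)))))
                 (trans (∑-*ˡ V ⟦ lookup s a ⟧ _) (cong (⟦ lookup s a ⟧ *_) (∑-*ˡ V ⟦ lookup s b ⟧ _))))
                 (∑-*ˡ V ⟦ lookup s a ⟧ _))
               (trans (∑-*ʳ V _ _) (cong (# V (lookup s) *_) (trans (∑-*ʳ V _ _)
                 (cong (# V (lookup s) *_) (∑-*ʳ V _ _)))))) ⟩
        ∑[ s ∈ copies ] (# V (lookup s) * (# V (lookup s) * (# V (lookup s) * # V (lookup s))))
          ≤⟨ ∑-mono-∈ copies (λ s s∈ → ≤-reflexive (cong (λ k → k * (k * (k * k)))
               (trans (∣∣-as-# s) (proj₁ (proj₂ (∈-filter⁻ (isInducedD₂? H) {xs = subsets n} s∈)))))) ⟩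
        ∑[ s ∈ copies ] 256
          ≡⟨ trans (∑-const copies 256) (*-comm (length copies) 256) ⟩
        256 * #inducedD₂ H
          ∎

      n× : ∀ {f : Fin n → ℕ} {k} → (∀ x → f x ≤ k) → ∑ V f ≤ n * k
      n× {k = k} p = ≤-trans (∑-≤const V k p) (≤-reflexive (cong (_* k) ∣V∣))

      1× : ∀ {f : Fin n → ℕ} a {k} → (∀ x → f x ≤ a == x * k) → ∑ V f ≤ k
      1× a {k} p = ≤-trans (∑-mono V p) (≤-trans (≤-reflexive (∑-*ʳ V k _))
        (≤-trans (*-monoˡ-≤ k (#-≟ a)) (≤-reflexive (*-identityˡ k))))

      degenerate-bound : V⁴ degenerate ≤ 6 * (n * (n * n))
      degenerate-bound = begin
        V⁴ degenerate
          ≡⟨ trans (V⁴-+ (λ a b c d → a == b + a == c + a == d + b == c + b == d) _) (cong (_+ V⁴ (λ a b c d → c == d))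
              (trans (V⁴-+ (λ a b c d → a == b + a == c + a == d + b == c) _) (cong (_+ V⁴ (λ a b c d → b == d))
              (trans (V⁴-+ (λ a b c d → a == b + a == c + a == d) _) (cong (_+ V⁴ (λ a b c d → b == c))
              (trans (V⁴-+ (λ a b c d → a == b + a == c) _) (cong (_+ V⁴ (λ a b c d → a == d))
              (V⁴-+ (λ a b c d → a == b) (λ a b c d → a == c))))))))) ⟩
        V⁴ (λ a b c d → a == b) + V⁴ (λ a b c d → a == c) + V⁴ (λ a b c d → a == d)
          + V⁴ (λ a b c d → b == c) + V⁴ (λ a b c d → b == d) + V⁴ (λ a b c d → c == d)
          ≤⟨ +-mono-≤ (+-mono-≤ (+-mono-≤ (+-mono-≤ (+-mono-≤
               (n× λ a → 1× a λ b → ≤-trans (n× λ c → n× λ d → ≤-refl) (≤-reflexive (pull n (a == b))))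
               (n× λ a → n× λ b → 1× a λ c → ≤-trans (n× λ d → ≤-refl) (≤-reflexive (*-comm n (a == c)))))
               (n× λ a → n× λ b → n× λ c → #-≟ a))
               (n× λ a → n× λ b → 1× b λ c → ≤-trans (n× λ d → ≤-refl) (≤-reflexive (*-comm n (b == c)))))
               (n× λ a → n× λ b → n× λ c → #-≟ b))
               (n× λ a → n× λ b → n× λ c → #-≟ c) ⟩
        n * (n * n) + n * (n * n) + n * (n * (n * 1)) + n * (n * n) + n * (n * (n * 1)) + n * (n * (n * 1))
          ≡⟨ six n ⟩
        6 * (n * (n * n))
          ∎
        where
        pull : ∀ n k → n * (n * k) ≡ k * (n * n)
        pull = solve-∀
        six : ∀ n → n * (n * n) + n * (n * n) + n * (n * (n * 1)) + n * (n * n) + n * (n * (n * 1)) + n * (n * (n * 1)) ≡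
          6 * (n * (n * n))
        six = solve-∀

    ∑-D₂≤ : ∑-D₂ (allFin n) (induced (edge H)) ≤ 256 * #inducedD₂ H + 6 * (n * (n * n))
    ∑-D₂≤ = ≤-trans (∑-≤+ V λ a → ∑-≤+ V λ b → ∑-≤+ V λ c → ∑-≤+ V λ d → D₂≤ a b c d)
      (+-mono-≤ copies-bound degenerate-bound)

  3-part : (Subset n → Bool) → Hypergraph₃ n
  3-part F = record
    { edge    = λ s → (∣ s ∣ ≡ᵇ 3) ∧ F s
    ; uniform = λ s t → ≡ᵇ⇒≡ ∣ s ∣ 3 (proj₁ (∧-elim (∣ s ∣ ≡ᵇ 3) t))
    }

  3-part-edge : ∀ (F : Subset n → Bool) {s} → ∣ s ∣ ≡ 3 → edge (3-part F) s ≡ F s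
  3-part-edge F {s} ∣s∣≡3 = cong (λ k → (k ≡ᵇ 3) ∧ F s) ∣s∣≡3

  3-part-free : ∀ (F : Subset n → Bool) → D₂-free F → InducedD₂-free (3-part F)
  3-part-free F free s (∣s∣≡4 , two-edges) with ∣s∣≡4⇒quad s ∣s∣≡4
  ... | a , b , c , d , unique , refl = case trans (sym (free a b c d)) (cong (λ k → ⟦ k ≡ᵇ 2 ⟧) (begin-equality
      ⟦ induced F a b c ⟧ + ⟦ induced F a b d ⟧ + ⟦ induced F a c d ⟧ + ⟦ induced F b c d ⟧
        ≡⟨ cong₂ _+_ (cong₂ _+_ (cong₂ _+_
             (cong ⟦_⟧ (3-part-edge F (∣abc∣ unique))) (cong ⟦_⟧ (3-part-edge F (∣abd∣ unique))))
             (cong ⟦_⟧ (3-part-edge F (∣acd∣ unique)))) (cong ⟦_⟧ (3-part-edge F (∣bcd∣ unique))) ⟨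
      _ ≡⟨ #edgesIn-quad unique (3-part F) ⟨
      #edgesIn (3-part F) (quad a b c d)
        ≡⟨ two-edges ⟩
      2 ∎)) of λ ()

  ∑-cartesianProductWith : ∀ {A B C : Set} (g : A → B → C) xs ys f →
    ∑ (cartesianProductWith g xs ys) f ≡ ∑[ x ∈ xs ] ∑[ y ∈ ys ] f (g x y)
  ∑-cartesianProductWith g []       ys f = refl
  ∑-cartesianProductWith g (x ∷ xs) ys f = trans (∑-++ (map (g x) ys) _ f)
    (cong₂ _+_ (∑-map (g x) ys f) (∑-cartesianProductWith g xs ys f))

  -- Any set on which the two differ has three elements, so it occurs among the unions of three
  -- singletons; running over all ordered triples only lists it repeatedly.
  editDistance≤ : ∀ (H : Hypergraph₃ n) F →
    editDistance H (3-part F) ≤ distance (allFin n) (induced (edge H)) (induced F)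
  editDistance≤ {n} H F = begin
    editDistance H (3-part F)
      ≤⟨ unique-⊆⇒length≤ (filter⁺ (λ s → T? (edge H s xor edge (3-part F) s)) (subsets-unique n)) into ⟩
    length (filterᵇ differs all-triples)
      ≡⟨ length-filter all-triples differs ⟩
    # all-triples differs
      ≡⟨ ∑-cartesianProductWith (λ a s → ⁅ a ⁆ ∪ s) (allFin n) pairs (⟦_⟧ ∘ differs) ⟩
    ∑[ a ∈ allFin n ] ∑[ s ∈ pairs ] ⟦ differs (⁅ a ⁆ ∪ s) ⟧
      ≡⟨ (∑-cong (allFin n) λ a → ∑-cartesianProductWith (λ b c → ⁅ b ⁆ ∪ ⁅ c ⁆) (allFin n) (allFin n) _) ⟩
    distance (allFin n) (induced (edge H)) (induced F)
      ∎
    where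
    differs : Subset n → Bool
    differs s = edge H s xor F s
    pairs all-triples : List (Subset n)
    pairs = cartesianProductWith (λ b c → ⁅ b ⁆ ∪ ⁅ c ⁆) (allFin n) (allFin n)
    all-triples = cartesianProductWith (λ a s → ⁅ a ⁆ ∪ s) (allFin n) pairs
    xor-edge : ∀ h f → T (h xor f) → T h ⊎ T f
    xor-edge true  f t = inj₁ _
    xor-edge false f t = inj₂ t
    into : ∀ {s} → s ∈ filter (λ s → T? (edge H s xor edge (3-part F) s)) (subsets n) → s ∈ filterᵇ differs all-triples
    into {s} s∈ with ∈-filter⁻ (λ s → T? (edge H s xor edge (3-part F) s)) {xs = subsets n} s∈
    ... | _ , t = ∈-filter⁺ (T? ∘ differs) listed (subst (λ e → T (edge H s xor e)) (3-part-edge F ∣s∣≡3) t)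
      where
      ∣s∣≡3 : ∣ s ∣ ≡ 3
      ∣s∣≡3 = case xor-edge (edge H s) _ t of λ where
        (inj₁ e) → uniform H s e
        (inj₂ e) → uniform (3-part F) s e
      listed : s ∈ all-triples
      listed with ∣s∣≡3⇒triple s ∣s∣≡3
      ... | a , b , c , refl = ∈-cartesianProductWith⁺ (λ a s → ⁅ a ⁆ ∪ s) (∈-allFin a)
        (∈-cartesianProductWith⁺ (λ b c → ⁅ b ⁆ ∪ ⁅ c ⁆) (∈-allFin b) (∈-allFin c))

  -- Λ below is b³⁶, and b = p²².
  opaque

    exponent : ℕ
    exponent = 792

  -- The removal lemma over the integers.

  module Threshold-constant (p : ℕ) (16≤p : 16 ≤ p) where

    open Base p 16≤p
    open Scale p 16≤p

    opaque

      Λ : ℕ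
      Λ = b * b * (b * b) * (M * M * (M * M))

      Λ≡ : Λ ≡ b * b * (b * b) * (M * M * (M * M))
      Λ≡ = refl

    M≤Λ : M ≤ Λ
    M≤Λ = begin
      M                          ≡⟨ *-identityʳ M ⟨
      M * 1                      ≤⟨ *-monoʳ-≤ M (*-mono-≤ 1≤M (*-mono-≤ 1≤M 1≤M)) ⟩
      M * (M * (M * M))          ≡⟨ *-assoc M M (M * M) ⟨
      M * M * (M * M)            ≡⟨ *-identityˡ _ ⟨
      1 * (M * M * (M * M))      ≤⟨ *-monoˡ-≤ (M * M * (M * M)) (*-mono-≤ (*-mono-≤ 1≤b 1≤b) (*-mono-≤ 1≤b 1≤b)) ⟩
      b * b * (b * b) * (M * M * (M * M))  ≡⟨ Λ≡ ⟨
      Λ                          ∎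

    1≤Λ : 1 ≤ Λ
    1≤Λ = ≤-trans 1≤M M≤Λ

    opaque
      unfolding exponent

      Λ≡p^ : Λ ≡ p ^ exponent
      Λ≡p^ = begin-equality
        Λ                                    ≡⟨ Λ≡ ⟩
        b * b * (b * b) * (M * M * (M * M))  ≡⟨ cong (λ M → b * b * (b * b) * (M * M * (M * M))) M≡b^8 ⟩
        b * b * (b * b) * (b ^ 8 * b ^ 8 * (b ^ 8 * b ^ 8))
          ≡⟨ cong₂ _*_ (fourth b) (trans (fourth (b ^ 8)) (^-*-assoc b 8 4)) ⟩
        b ^ 4 * b ^ 32                       ≡⟨ ^-distribˡ-+-* b 4 32 ⟨
        b ^ 36                               ≡⟨ cong (_^ 36) b≡p^22 ⟩
        (p ^ 22) ^ 36                        ≡⟨ ^-*-assoc p 22 36 ⟩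
        p ^ exponent                         ∎
        where
        fourth : ∀ x → x * x * (x * x) ≡ x ^ 4
        fourth x = trans (*-assoc x x (x * x)) (cong (λ y → x * (x * (x * y))) (sym (*-identityʳ x)))
        cube : ∀ x → x * x * x ≡ x ^ 3
        cube x = trans (*-assoc x x x) (cong (λ y → x * (x * y)) (sym (*-identityʳ x)))
        square : ∀ x → x * x ≡ x ^ 2
        square x = cong (x *_) (sym (*-identityʳ x))
        M≡b^8 : M ≡ b ^ 8
        M≡b^8 = trans M≡ (cong (b *_) (trans β≡ (trans (*-comm (b * b * b * (b * b * b)) b)
          (cong (b *_) (trans (cong₂ _*_ (cube b) (cube b)) (sym (^-distribˡ-+-* b 3 3)))))))
        κ≡p^9 : κ ≡ p ^ 9
        κ≡p^9 = trans κ≡ (trans (cube (p * p * p)) (trans (cong (_^ 3) (cube p)) (^-*-assoc p 3 3)))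
        b≡p^22 : b ≡ p ^ 22
        b≡p^22 = trans b≡ (trans
          (cong₂ _*_ (cong₂ _*_ (trans (cong₂ _*_ κ≡p^9 κ≡p^9) (sym (^-distribˡ-+-* p 9 9))) (square p)) (square p))
          (trans (cong (_* p ^ 2) (sym (^-distribˡ-+-* p 18 2))) (sym (^-distribˡ-+-* p 20 2))))

  module _ (q : ℕ) (1≤q : 1 ≤ q) where

    16≤32q : 16 ≤ 32 * q
    16≤32q = ≤-trans (≤ᵇ⇒≤ 16 32 _) (*-monoʳ-≤ 32 1≤q)

    open Threshold-constant (32 * q) 16≤32q public
    open Base (32 * q) 16≤32q
    open Scale (32 * q) 16≤32q

    -- 512 = 2 · 256 and 12 = 2 · 6 share the allowance n⁴ evenly between genuine copies and
    -- degenerate quadruples. The recursion runs with `2 * q` in place of `q`, because its budget on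
    -- the whole vertex set is 2 n³.
    removal : ∀ {n} (H : Hypergraph₃ n) → 12 * Λ ≤ n → 512 * Λ * #inducedD₂ H ≤ n * (n * (n * n)) →
      ∃[ H′ ] (InducedD₂-free H′ × q * editDistance H H′ ≤ n * (n * n))
    removal {n} H large few = 3-part F , 3-part-free F free , *-cancelˡ-≤ 2 (begin
      2 * (q * editDistance H (3-part F))
        ≤⟨ *-monoʳ-≤ 2 (*-monoʳ-≤ q (editDistance≤ H F)) ⟩
      2 * (q * distance (allFin n) E (induced F))
        ≡⟨ *-assoc 2 q _ ⟨
      2 * q * distance (allFin n) E (induced F)
        ≤⟨ close ⟩
      length (allFin n) * (length (allFin n) * length (allFin n)) + length (allFin n) * (n * n)
        ≡⟨ cong (λ m → m * (m * m) + m * (n * n)) ∣V∣ ⟩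
      n * (n * n) + n * (n * n)
        ≡⟨ cong (n * (n * n) +_) (+-identityʳ (n * (n * n))) ⟨
      2 * (n * (n * n))
        ∎)
      where
      E = induced (edge H)

      ∣V∣ : length (allFin n) ≡ n
      ∣V∣ = length-tabulate id

      4q≤p : 2 * (2 * q) ≤ 32 * q
      4q≤p = ≤-trans (≤-reflexive (sym (*-assoc 2 2 q))) (*-monoˡ-≤ q (≤ᵇ⇒≤ 4 32 _))

      few-D₂ : b * b * (b * b) * ∑-D₂ (allFin n) E * (M * M * (M * M)) ≤ n * n * (n * n)
      few-D₂ = *-cancelˡ-≤ 2 (begin
        2 * (b * b * (b * b) * ∑-D₂ (allFin n) E * (M * M * (M * M)))
          ≡⟨ cong (2 *_) (shape₁ (b * b * (b * b)) _ _) ⟩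
        2 * (b * b * (b * b) * (M * M * (M * M)) * ∑-D₂ (allFin n) E)
          ≡⟨ cong (λ k → 2 * (k * ∑-D₂ (allFin n) E)) Λ≡ ⟨
        2 * (Λ * ∑-D₂ (allFin n) E)
          ≤⟨ *-monoʳ-≤ 2 (*-monoʳ-≤ Λ (∑-D₂≤ H)) ⟩
        2 * (Λ * (256 * #inducedD₂ H + 6 * (n * (n * n))))
          ≡⟨ shape₂ Λ (#inducedD₂ H) (n * (n * n)) ⟩
        512 * Λ * #inducedD₂ H + 12 * Λ * (n * (n * n))
          ≤⟨ +-mono-≤ few (*-monoˡ-≤ (n * (n * n)) large) ⟩
        n * (n * (n * n)) + n * (n * (n * n))
          ≡⟨ shape₃ n ⟩
        2 * (n * n * (n * n))
          ∎)
        where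
        shape₁ : ∀ x y z → x * y * z ≡ x * z * y
        shape₁ = solve-∀
        shape₂ : ∀ L d c → 2 * (L * (256 * d + 6 * c)) ≡ 512 * L * d + 12 * L * c
        shape₂ = solve-∀
        shape₃ : ∀ n → n * (n * (n * n)) + n * (n * (n * n)) ≡ 2 * (n * n * (n * n))
        shape₃ = solve-∀

      M≤n : M ≤ n
      M≤n = ≤-trans M≤Λ (≤-trans (≤-trans (≤-reflexive (sym (*-identityˡ Λ))) (*-monoˡ-≤ Λ (≤ᵇ⇒≤ 1 12 _))) large)

      open Approximate E (induced-sym (edge H)) (32 * q) (2 * q) 16≤32q 4q≤p
      open Approximation (approximate M≤n (length (allFin n)) (allFin n) ≤-refl few-D₂)

-- Rational ε, and the polynomial bounds for δ and n₀.

open Hypergraphs using (exponent; Λ; 1≤Λ; Λ≡p^; removal)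
open import Algebra.Bundles using (CommutativeMonoid; CommutativeRing)
open import Algebra.Properties.CommutativeSemigroup using (xy∙z≈xz∙y)
open import Defs
open import Data.Integer as ℤ using (+_)
import Data.Integer.Properties as ℤ
open import Data.Nat as ℕ using (ℕ; zero; suc; z≤n; s≤s)
open import Data.Nat.DivMod using (m≡m%n+[m/n]*n; m%n<n; m/n*n≤m)
import Data.Nat.Properties as ℕ
open import Data.Nat.Tactic.RingSolver using (solve-∀)
open import Data.Product using (_×_; _,_; ∃-syntax; Σ-syntax; proj₁; proj₂)
open import Data.Rational
  using (ℚ; mkℚ; 0ℚ; 1ℚ; toℚᵘ; _<_; _≤_; _*_; _/_; 1/_; >-nonZero; positive; nonNegative;
         NonNegative; Positive)
open import Data.Rational.Properties
open import Data.Rational.Unnormalised as ℚᵘ using (mkℚᵘ; *≡*; *≤*)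
import Data.Rational.Unnormalised.Properties as ℚᵘ
open import Relation.Binary.PropositionalEquality

open import Algebra.Properties.CommutativeSemiring.Exp
  (CommutativeRing.commutativeSemiring +-*-commutativeRing) using (^-distrib-*)

*-commutativeSemigroup = CommutativeMonoid.commutativeSemigroup *-1-commutativeMonoid

-- `fromℕ` normalises by a gcd that does not reduce for a variable, so identities are verified on
-- unnormalised rationals.
toℚᵘ-fromℕ : ∀ k → toℚᵘ (fromℕ k) ℚᵘ.≃ mkℚᵘ (+ k) 0
toℚᵘ-fromℕ k = toℚᵘ-fromℚᵘ (mkℚᵘ (+ k) 0)

fromℕ-* : ∀ a b → fromℕ (a ℕ.* b) ≡ fromℕ a * fromℕ b
fromℕ-* a b = toℚᵘ-injective (ℚᵘ.≃-trans (toℚᵘ-fromℕ (a ℕ.* b)) (ℚᵘ.≃-trans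
  (*≡* (cong (ℤ._* (+ 1)) (ℤ.pos-* a b)))
  (ℚᵘ.≃-sym (ℚᵘ.≃-trans (toℚᵘ-homo-* (fromℕ a) (fromℕ b)) (ℚᵘ.*-cong (toℚᵘ-fromℕ a) (toℚᵘ-fromℕ b))))))

fromℕ-^ : ∀ a k → fromℕ (a ℕ.^ k) ≡ fromℕ a ^ k
fromℕ-^ a zero    = refl
fromℕ-^ a (suc k) = trans (fromℕ-* a (a ℕ.^ k)) (cong (fromℕ a *_) (fromℕ-^ a k))

fromℕ-mono : ∀ {a b} → a ℕ.≤ b → fromℕ a ≤ fromℕ b
fromℕ-mono {a} {b} a≤b = toℚᵘ-cancel-≤ (ℚᵘ.≤-trans (ℚᵘ.≤-reflexive (toℚᵘ-fromℕ a)) (ℚᵘ.≤-trans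
  (*≤* (ℤ.*-monoʳ-≤-nonNeg (+ 1) (ℤ.+≤+ a≤b)))
  (ℚᵘ.≤-reflexive (ℚᵘ.≃-sym (toℚᵘ-fromℕ b)))))

fromℕ-cancel-< : ∀ {a b} → fromℕ a < fromℕ b → a ℕ.< b
fromℕ-cancel-< a<b = ℕ.≰⇒> λ b≤a → <-irrefl refl (<-≤-trans a<b (fromℕ-mono b≤a))

fromℕ-nonNeg : ∀ k → NonNegative (fromℕ k)
fromℕ-nonNeg k = nonNegative (fromℕ-mono {0} {k} z≤n)

fromℕ-pos : ∀ {k} → 1 ℕ.≤ k → Positive (fromℕ k)
fromℕ-pos 1≤k = positive (<-≤-trans (positive⁻¹ 1ℚ) (fromℕ-mono 1≤k))

recip-* : ∀ k .{{_ : ℕ.NonZero k}} → (+ 1 / k) * fromℕ k ≡ 1ℚ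
recip-* (suc k) = toℚᵘ-injective (ℚᵘ.≃-trans (toℚᵘ-homo-* (+ 1 / suc k) (fromℕ (suc k)))
  (ℚᵘ.≃-trans (ℚᵘ.*-cong (toℚᵘ-fromℚᵘ (mkℚᵘ (+ 1) k)) (toℚᵘ-fromℕ (suc k)))
    (*≡* (cong +_ (shape k)))))
  where
  shape : ∀ k → suc (k ℕ.+ 0) ℕ.* 1 ≡ suc ((k ℕ.* 1) ℕ.+ 0)
  shape = solve-∀

recip-nonNeg : ∀ k .{{_ : ℕ.NonZero k}} → NonNegative (+ 1 / k)
recip-nonNeg k = nonNegative {+ 1 / k} (*-cancelʳ-≤-pos {0ℚ} {+ 1 / k} (fromℕ k) {{fromℕ-pos (ℕ.>-nonZero⁻¹ k)}}
  (≤-trans (≤-reflexive (*-zeroˡ (fromℕ k))) (≤-trans (fromℕ-mono {0} {1} z≤n) (≤-reflexive (sym (recip-* k))))))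

record Fraction (ε : ℚ) : Set where
  field
    N D : ℕ
    1≤N : 1 ℕ.≤ N
    1≤D : 1 ℕ.≤ D
    ε*D≡N : ε * fromℕ D ≡ fromℕ N

fraction : ∀ ε → Positive ε → Fraction ε
fraction ε@(mkℚ (+ suc a) d c) _ = record
  { N = suc a ; D = suc d ; 1≤N = s≤s z≤n ; 1≤D = s≤s z≤n
  ; ε*D≡N = toℚᵘ-injective (ℚᵘ.≃-trans (toℚᵘ-homo-* ε (fromℕ (suc d)))
      (ℚᵘ.≃-trans (ℚᵘ.*-cong (ℚᵘ.≃-refl {toℚᵘ ε}) (toℚᵘ-fromℕ (suc d)))
        (ℚᵘ.≃-trans (*≡* (cong +_ (shape a d))) (ℚᵘ.≃-sym (toℚᵘ-fromℕ (suc a))))))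
  }
  where
  shape : ∀ a d → (suc a ℕ.* suc d) ℕ.* 1 ≡ suc a ℕ.* (suc d ℕ.* 1)
  shape a d = ℕ.*-assoc (suc a) (suc d) 1
fraction (mkℚ (+ zero) d c) record { pos = () }
fraction (mkℚ ℤ.-[1+ a ] d c) record { pos = () }

^-nonNeg : ∀ x .{{_ : NonNegative x}} k → NonNegative (x ^ k)
^-nonNeg x zero    = _
^-nonNeg x (suc k) = nonNeg*nonNeg⇒nonNeg x (x ^ k) {{^-nonNeg x k}}

^-pos : ∀ x .{{_ : Positive x}} k → Positive (x ^ k)
^-pos x zero    = _
^-pos x (suc k) = pos*pos⇒pos x (x ^ k) {{^-pos x k}}

*-mono-≤-nonNeg : ∀ {a b} c d .{{_ : NonNegative a}} .{{_ : NonNegative d}} → a ≤ b → c ≤ d → a * c ≤ b * d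
*-mono-≤-nonNeg {a} c d a≤b c≤d = ≤-trans (*-monoˡ-≤-nonNeg a c≤d) (*-monoʳ-≤-nonNeg d a≤b)

^-mono-≤ : ∀ {x y} .{{_ : NonNegative x}} .{{_ : NonNegative y}} k → x ≤ y → x ^ k ≤ y ^ k
^-mono-≤ zero x≤y = ≤-refl
^-mono-≤ {x} {y} {{x≥0}} (suc k) x≤y =
  *-mono-≤-nonNeg (x ^ k) (y ^ k) {{x≥0}} {{^-nonNeg y k}} x≤y (^-mono-≤ k x≤y)

1^ : ∀ k → 1ℚ ^ k ≡ 1ℚ
1^ zero    = refl
1^ (suc k) = trans (*-identityˡ (1ℚ ^ k)) (1^ k)

^-antitone : ∀ {x} .{{_ : NonNegative x}} {j k} → x ≤ 1ℚ → j ℕ.≤ k → x ^ k ≤ x ^ j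
^-antitone {x} {k = k} x≤1 z≤n = ≤-trans (^-mono-≤ k x≤1) (≤-reflexive (1^ k))
^-antitone {x} x≤1 (s≤s j≤k) = *-monoˡ-≤-nonNeg x (^-antitone x≤1 j≤k)

opaque

  -- One number serves as exponent and as factor. It dominates `exponent` as well as the factor
  -- arising from 512 Λ, where 64 bounds p ε; being opaque, it is never evaluated.
  constant : ℕ
  constant = exponent ℕ.+ 512 ℕ.* 64 ℕ.^ exponent

  exponent≤constant : exponent ℕ.≤ constant
  exponent≤constant = ℕ.m≤m+n _ _

  512*64^≤constant : 512 ℕ.* 64 ℕ.^ exponent ℕ.≤ constant
  512*64^≤constant = ℕ.m≤n+m _ exponent

  1≤constant : 1 ℕ.≤ constant
  1≤constant = ℕ.≤-trans (ℕ.*-mono-≤ {1} {512} (s≤s z≤n) (ℕ.m^n>0 64 exponent)) (ℕ.m≤n+m _ exponent)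

module _ (ε : ℚ) (ε>0 : 0ℚ < ε) where

  private
    instance
      ε-pos : Positive ε
      ε-pos = positive ε>0
      ε-nonNeg : NonNegative ε
      ε-nonNeg = pos⇒nonNeg ε

  open Fraction (fraction ε ε-pos)

  private
    instance
      N≢0 : ℕ.NonZero N
      N≢0 = ℕ.>-nonZero 1≤N

    C : ℕ
    C = constant

    -- `q` is the integer part of 1/ε plus one. That q ≥ 1/ε gives the edit distance, and q ≤ 2/ε
    -- for ε < 1 gives the polynomial bounds; `p` is the value with which `removal` works.
    q p L : ℕ
    q = suc (D ℕ./ N)
    p = 32 ℕ.* q
    L = Λ q (s≤s z≤n)

    D≤qN : D ℕ.≤ q ℕ.* N
    D≤qN = begin
      D                              ≡⟨ m≡m%n+[m/n]*n D N ⟩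
      D ℕ.% N ℕ.+ D ℕ./ N ℕ.* N      ≤⟨ ℕ.+-monoˡ-≤ _ (ℕ.<⇒≤ (m%n<n D N)) ⟩
      q ℕ.* N                        ∎
      where open ℕ.≤-Reasoning

    N<D : ε < 1ℚ → N ℕ.< D
    N<D ε<1 = fromℕ-cancel-< (<-≤-trans
      (≤-<-trans (≤-reflexive (sym ε*D≡N)) (*-monoˡ-<-pos (fromℕ D) {{fromℕ-pos 1≤D}} ε<1))
      (≤-reflexive (*-identityˡ (fromℕ D))))

    qε≤2 : ε < 1ℚ → fromℕ q * ε ≤ fromℕ 2
    qε≤2 ε<1 = *-cancelʳ-≤-pos (fromℕ D) {{fromℕ-pos 1≤D}} (begin
      fromℕ q * ε * fromℕ D      ≡⟨ trans (*-assoc (fromℕ q) ε (fromℕ D)) (cong (fromℕ q *_) ε*D≡N) ⟩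
      fromℕ q * fromℕ N          ≡⟨ fromℕ-* q N ⟨
      fromℕ (q ℕ.* N)            ≤⟨ fromℕ-mono (ℕ.+-mono-≤ (ℕ.<⇒≤ (N<D ε<1))
                                      (ℕ.≤-trans (m/n*n≤m D N) (ℕ.≤-reflexive (sym (ℕ.+-identityʳ D))))) ⟩
      fromℕ (2 ℕ.* D)            ≡⟨ fromℕ-* 2 D ⟩
      fromℕ 2 * fromℕ D          ∎)
      where open ≤-Reasoning

    pε≤64 : ε < 1ℚ → fromℕ p * ε ≤ fromℕ 64
    pε≤64 ε<1 = begin
      fromℕ p * ε                  ≡⟨ trans (cong (_* ε) (fromℕ-* 32 q)) (*-assoc (fromℕ 32) (fromℕ q) ε) ⟩
      fromℕ 32 * (fromℕ q * ε)     ≤⟨ *-monoˡ-≤-nonNeg (fromℕ 32) (qε≤2 ε<1) ⟩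
      fromℕ 32 * fromℕ 2           ≡⟨ fromℕ-* 32 2 ⟨
      fromℕ 64                     ∎
      where open ≤-Reasoning

    Lε^≤ : ε < 1ℚ → fromℕ L * ε ^ exponent ≤ fromℕ (64 ℕ.^ exponent)
    Lε^≤ ε<1 = begin
      fromℕ L * ε ^ exponent               ≡⟨ cong (λ k → fromℕ k * ε ^ exponent) (Λ≡p^ q (s≤s z≤n)) ⟩
      fromℕ (p ℕ.^ exponent) * ε ^ exponent  ≡⟨ cong (_* ε ^ exponent) (fromℕ-^ p exponent) ⟩
      fromℕ p ^ exponent * ε ^ exponent    ≡⟨ ^-distrib-* (fromℕ p) ε exponent ⟨
      (fromℕ p * ε) ^ exponent             ≤⟨ ^-mono-≤ {{nonNeg*nonNeg⇒nonNeg (fromℕ p) {{fromℕ-nonNeg p}} ε}} exponent (pε≤64 ε<1) ⟩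
      fromℕ 64 ^ exponent                  ≡⟨ fromℕ-^ 64 exponent ⟨
      fromℕ (64 ℕ.^ exponent)              ∎
      where open ≤-Reasoning

  -- Λ is a power of p, so Λ times the same power of ε is at most that power of 64; passing to the
  -- larger exponent `C` only decreases powers of ε < 1. It is used with `j = 512` for δ and
  -- `j = 12` for `n₀`.
  multiple-of-Λ : ε < 1ℚ → ∀ {j} → j ℕ.≤ 512 → fromℕ (j ℕ.* L) * ε ^ C ≤ fromℕ C
  multiple-of-Λ ε<1 {j} j≤512 = begin
    fromℕ (j ℕ.* L) * ε ^ C                 ≡⟨ trans (cong (_* ε ^ C) (fromℕ-* j L)) (*-assoc (fromℕ j) (fromℕ L) (ε ^ C)) ⟩
    fromℕ j * (fromℕ L * ε ^ C)             ≤⟨ *-monoˡ-≤-nonNeg (fromℕ j) {{fromℕ-nonNeg j}}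
                                                 (*-monoˡ-≤-nonNeg (fromℕ L) {{fromℕ-nonNeg L}} (^-antitone (<⇒≤ ε<1) exponent≤constant)) ⟩
    fromℕ j * (fromℕ L * ε ^ exponent)      ≤⟨ *-monoˡ-≤-nonNeg (fromℕ j) {{fromℕ-nonNeg j}} (Lε^≤ ε<1) ⟩
    fromℕ j * fromℕ (64 ℕ.^ exponent)       ≡⟨ fromℕ-* j (64 ℕ.^ exponent) ⟨
    fromℕ (j ℕ.* 64 ℕ.^ exponent)           ≤⟨ fromℕ-mono (ℕ.≤-trans (ℕ.*-monoˡ-≤ (64 ℕ.^ exponent) j≤512) 512*64^≤constant) ⟩
    fromℕ C                                 ∎
    where open ≤-Reasoning

  private
    K : ℕ
    K = 512 ℕ.* L

    instance
      K≢0 : ℕ.NonZero K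
      K≢0 = ℕ.>-nonZero (ℕ.*-mono-≤ {1} {512} (s≤s z≤n) (1≤Λ q (s≤s z≤n)))
      C≢0 : ℕ.NonZero C
      C≢0 = ℕ.>-nonZero 1≤constant

    K-pos : Positive (fromℕ K)
    K-pos = fromℕ-pos (ℕ.>-nonZero⁻¹ K)

  δ : ℚ
  δ = + 1 / K

  n₀ : ℕ
  n₀ = 12 ℕ.* L

  δ>0 : 0ℚ < δ
  δ>0 = *-cancelʳ-<-nonNeg (fromℕ K) {{fromℕ-nonNeg K}} (≤-<-trans (≤-reflexive (*-zeroˡ (fromℕ K)))
    (<-≤-trans (positive⁻¹ 1ℚ) (≤-reflexive (sym (recip-* K)))))

  δ≥ : ε < 1ℚ → ε ^ C * (+ 1 / C) ≤ δ
  δ≥ ε<1 = *-cancelʳ-≤-pos (fromℕ K) {{K-pos}} (begin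
    ε ^ C * (+ 1 / C) * fromℕ K      ≡⟨ trans (xy∙z≈xz∙y *-commutativeSemigroup (ε ^ C) _ _) (cong (_* (+ 1 / C)) (*-comm (ε ^ C) _)) ⟩
    fromℕ K * ε ^ C * (+ 1 / C)      ≤⟨ *-monoʳ-≤-nonNeg (+ 1 / C) {{recip-nonNeg C}} (multiple-of-Λ ε<1 ℕ.≤-refl) ⟩
    fromℕ C * (+ 1 / C)              ≡⟨ trans (*-comm (fromℕ C) _) (recip-* C) ⟩
    1ℚ                                 ≡⟨ recip-* K ⟨
    δ * fromℕ K                        ∎)
    where open ≤-Reasoning

  n₀≤ : ε < 1ℚ → fromℕ n₀ ≤ fromℕ C * (1/ ε) {{>-nonZero ε>0}} ^ C
  n₀≤ ε<1 = *-cancelʳ-≤-pos (ε ^ C) {{^-pos ε C}} (begin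
    fromℕ n₀ * ε ^ C                   ≤⟨ multiple-of-Λ ε<1 (ℕ.≤ᵇ⇒≤ 12 512 _) ⟩
    fromℕ C                            ≡⟨ *-identityʳ (fromℕ C) ⟨
    fromℕ C * 1ℚ                       ≡⟨ cong (fromℕ C *_) inverse ⟨
    fromℕ C * (ε⁻¹ ^ C * ε ^ C)        ≡⟨ *-assoc (fromℕ C) _ _ ⟨
    fromℕ C * ε⁻¹ ^ C * ε ^ C          ∎)
    where
    open ≤-Reasoning
    ε⁻¹ : ℚ
    ε⁻¹ = (1/ ε) {{>-nonZero ε>0}}
    inverse : ε⁻¹ ^ C * ε ^ C ≡ 1ℚ
    inverse = trans (sym (^-distrib-* ε⁻¹ ε C)) (trans (cong (_^ C) (*-inverseˡ ε {{>-nonZero ε>0}})) (1^ C))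

  ε-removal : ∀ n → n₀ ℕ.≤ n → (H : Hypergraph₃ n) → fromℕ (#inducedD₂ H) < δ * fromℕ n ^ 4 →
    ∃[ H′ ] (InducedD₂-free H′ × fromℕ (editDistance H H′) ≤ ε * fromℕ n ^ 3)
  ε-removal n n₀≤n H few = H′ , proj₁ (proj₂ removed) , *-cancelʳ-≤-pos (fromℕ D) {{fromℕ-pos 1≤D}} (begin
    fromℕ x * fromℕ D                ≡⟨ fromℕ-* x D ⟨
    fromℕ (x ℕ.* D)                  ≤⟨ fromℕ-mono xD≤ ⟩
    fromℕ (N ℕ.* n ℕ.^ 3)            ≡⟨ trans (fromℕ-* N (n ℕ.^ 3)) (cong₂ _*_ (sym ε*D≡N) (fromℕ-^ n 3)) ⟩
    ε * fromℕ D * fromℕ n ^ 3        ≡⟨ xy∙z≈xz∙y *-commutativeSemigroup ε (fromℕ D) _ ⟩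
    ε * fromℕ n ^ 3 * fromℕ D        ∎)
    where
    open ≤-Reasoning
    KD<n⁴ : K ℕ.* #inducedD₂ H ℕ.< n ℕ.^ 4
    KD<n⁴ = fromℕ-cancel-< (begin-strict
      fromℕ (K ℕ.* #inducedD₂ H)       ≡⟨ fromℕ-* K _ ⟩
      fromℕ K * fromℕ (#inducedD₂ H)   <⟨ *-monoʳ-<-pos (fromℕ K) {{K-pos}} few ⟩
      fromℕ K * (δ * fromℕ n ^ 4)      ≡⟨ *-assoc (fromℕ K) δ _ ⟨
      fromℕ K * δ * fromℕ n ^ 4        ≡⟨ cong (_* fromℕ n ^ 4) (trans (*-comm (fromℕ K) δ) (recip-* K)) ⟩
      1ℚ * fromℕ n ^ 4                 ≡⟨ *-identityˡ (fromℕ n ^ 4) ⟩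
      fromℕ n ^ 4                      ≡⟨ fromℕ-^ n 4 ⟨
      fromℕ (n ℕ.^ 4)                  ∎)
    removed = removal q (s≤s z≤n) H n₀≤n (ℕ.≤-trans (ℕ.<⇒≤ KD<n⁴)
      (ℕ.≤-reflexive (cong (λ k → n ℕ.* (n ℕ.* (n ℕ.* k))) (ℕ.*-identityʳ n))))
    H′ = proj₁ removed
    x : ℕ
    x = editDistance H H′
    xD≤ : x ℕ.* D ℕ.≤ N ℕ.* n ℕ.^ 3
    xD≤ = ℕ.≤-trans (ℕ.*-monoʳ-≤ x D≤qN) (ℕ.≤-trans (ℕ.≤-reflexive (shape x q N))
      (ℕ.*-monoʳ-≤ N (ℕ.≤-trans (proj₂ (proj₂ removed))
        (ℕ.≤-reflexive (cong (λ k → n ℕ.* (n ℕ.* k)) (sym (ℕ.*-identityʳ n)))))))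
      where
      shape : ∀ x q N → x ℕ.* (q ℕ.* N) ≡ N ℕ.* (q ℕ.* x)
      shape = solve-∀

theorem1p1 : ∃[ C ] Σ[ C≥1 ∈ 1 ℕ.≤ C ]
    ((ε : ℚ) (ε>0 : 0ℚ < ε) →
    ∃[ δ ] ∃[ n₀ ]
    ( 0ℚ < δ
    × (ε < 1ℚ →
    ε ^ C * (+ 1 / C) {{ℕ.>-nonZero C≥1}} ≤ δ
    × fromℕ n₀ ≤ fromℕ C * (1/ ε) {{>-nonZero ε>0}} ^ C)
    × (∀ (n : ℕ) → n₀ ℕ.≤ n → (H : Hypergraph₃ n) →
    fromℕ (#inducedD₂ H) < δ * fromℕ n ^ 4 →
    ∃[ H′ ] (InducedD₂-free H′
    × fromℕ (editDistance H H′) ≤ ε * fromℕ n ^ 3))))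
theorem1p1 = constant , 1≤constant , λ ε ε>0 →
  δ ε ε>0 , n₀ ε ε>0 , δ>0 ε ε>0 , (λ ε<1 → δ≥ ε ε>0 ε<1 , n₀≤ ε ε>0 ε<1) , ε-removal ε ε>0
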